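{- Let $\mathcal R$ be a tame equality rule set that satisfies the support condition and has pruning, disc removal, and endo-coherence removal. Then for any ps-context $\Delta$ and any term $t$ over $\Delta$ that is well-formed in $\mathrm{Catt}_{\mathcal R}$, there is a term $s$ over $\Delta$ that is well-formed in $\mathrm{Catt}$ (the theory with empty equality rule set) such that $\Delta\vdash s=t$ in $\mathrm{Catt}_{\mathcal R}$.
   Context: Syntax. Syntax is taken up to renaming of variables; $\equiv$ is syntactic equality, and syntax over $\Gamma$ is silently regarded as syntax over $\Gamma,(x:A)$ (weakening). By mutual induction: a context is a finite list $(x_1:A_1),\dots,(x_m:A_m)$ with $A_i$ a type over the preceding entries; a type over $\Gamma$ is $\star$ or $s\to_A t$ with $A$ a type and $s,t$ terms over $\Gamma$; a term over $\Gamma$ is a variable of $\Gamma$ or $\mathrm{Coh}_{(\Delta;A)}[\sigma]$ with $\Delta$ a context, $A$ a type over $\Delta$ and $\sigma:\Delta\to\Gamma$; a substitution $\sigma:\Delta\to\Gamma$ is a list of terms over $\Gamma$, one for each variable of $\Delta$. $x[\![\sigma]\!]$ is the entry of $\sigma$ at the variable $x$; $\mathrm{Coh}_{(\Theta;A)}[\tau][\![\sigma]\!]=\mathrm{Coh}_{(\Theta;A)}[\tau\bullet\sigma]$, where $\tau\bullet\sigma$ applies $[\![\sigma]\!]$ to each entry of $\tau$; $\star[\![\sigma]\!]=\star$; $(s\to_At)[\![\sigma]\!]=s[\![\sigma]\!]\to_{A[\![\sigma]\!]}t[\![\sigma]\!]$. $\dim\star=0$, $\dim(s\to_At)=\dim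 A+1$; the dimension of a context is the maximal dimension of its types. $\mathrm{src}(s\to_At)=s$, $\mathrm{tgt}(s\to_At)=t$. Suspension: $\Sigma\Gamma$ is $(N:\star),(S:\star)$ followed by $(x:\Sigma A)$ for $(x:A)\in\Gamma$; $\Sigma\star=N\to_\star S$, $\Sigma(s\to_At)=\Sigma s\to_{\Sigma A}\Sigma t$, $\Sigma x=x$, $\Sigma\mathrm{Coh}_{(\Delta;A)}[\sigma]=\mathrm{Coh}_{(\Sigma\Delta;\Sigma A)}[\Sigma\sigma]$, and $\Sigma\sigma$ sends $N\mapsto N$, $S\mapsto S$, $x\mapsto\Sigma(x[\![\sigma]\!])$. Ps-contexts. $(x:\star)\vdash_{ps}x:\star$; if $\Gamma\vdash_{ps}x:A$ then $\Gamma,(y:A),(f:x\to_Ay)\vdash_{ps}f:x\to_Ay$; if $\Gamma\vdash_{ps}x:s\to_At$ then $\Gamma\vdash_{ps}t:A$; if $\Gamma\vdash_{ps}x:\star$ then $\Gamma\vdash_{ps}$ ($\Gamma$ is a ps-context). For $i\in\mathbb N$, $\epsilon\in\{ -,+\}$: $\partial_i^\epsilon((x:\star))=\{x\}$, and for $\Delta=\Gamma,(y:A),(f:x\to_Ay)$, $\partial^\epsilon_i(\Delta)$ is $\partial_i^\epsilon(\Gamma)$ if $i<\dim A$; $\partial_i^-(\Gamma)$ if $i=\dim A$, $\epsilon=-$; $(\partial_i^+(\Gamma)\cup\{y\})\setminus\{x\}$ if $i=\dim A$, $\epsilon=+$; $\partial_i^\epsilon(\Gamma)\cup\{y,f\}$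 if $i>\dim A$. Support. $\mathrm{FV}(x)=\{x\}$, $\mathrm{FV}(\mathrm{Coh}_{(\Delta;A)}[\sigma])=\mathrm{FV}(\sigma)$, $\mathrm{FV}(\star)=\emptyset$, and $\mathrm{FV}$ of arrow types and substitutions is the union over components. $\mathrm{Supp}$ of syntax over $\Gamma$ is the smallest set $U\supseteq\mathrm{FV}$ such that $x\in U$ and $(x:A)\in\Gamma$ imply $\mathrm{FV}(A)\subseteq U$. Typing and equality. Let $\mathcal O$ be the regular operation set: all triples $(\Delta,\partial_n^-(\Delta),\partial_n^+(\Delta))$ with $\Delta$ a ps-context, $n\in\mathbb N$, $n\ge\dim\Delta-1$. An equality rule set $\mathcal R$ is a set of triples $(\Gamma,s,t)$, $s,t$ terms over $\Gamma$. The theory $\mathrm{Catt}_{\mathcal R}$ (judgements $\vdash$ or $\vdash_{\mathcal R}$) is generated mutually by: $\emptyset\vdash$; $\Gamma\vdash$, $\Gamma\vdash A$ give $\Gamma,(x:A)\vdash$; $\Gamma\vdash\star$; $\Gamma\vdash A$, $\Gamma\vdash s:A$, $\Gamma\vdash t:A$ give $\Gamma\vdash s\to_At$; $\Gamma\vdash\langle\rangle:\emptyset$; $\Gamma\vdash\sigma:\Delta$, $\Gamma\vdash t:A[\![\sigma]\!]$ give $\Gamma\vdash\langle\sigma,t\rangle:\Delta,(x:A)$; $(x:A)\in\Gamma$ gives $\Gamma\vdash x:A$; $\Gamma\vdash t:A$, $\Gamma\vdash A=B$ give $\Gamma\vdash t:B$; $\Delta\vdash_{ps}$, $\Delta\vdash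 s\to_At$, $\Gamma\vdash\sigma:\Delta$, $(\Delta,\mathrm{Supp}(s),\mathrm{Supp}(t))\in\mathcal O$ give $\Gamma\vdash\mathrm{Coh}_{(\Delta;s\to_At)}[\sigma]:(s\to_At)[\![\sigma]\!]$; equality is a congruence for all constructors (for coherences: $\Delta\vdash A=B$, $\Gamma\vdash\sigma=\tau$ give $\Gamma\vdash\mathrm{Coh}_{(\Delta;A)}[\sigma]=\mathrm{Coh}_{(\Delta;B)}[\tau]$), reflexive on variables, symmetric and transitive on terms, and $\Gamma\vdash s=t$ whenever $(\Gamma,s,t)\in\mathcal R$ and $\Gamma\vdash s:A$ for some $A$. A term is well-formed if $\Gamma\vdash t:A$ for some $A$. Conditions on $\mathcal R$. Weakening: $(\Gamma,s,t)\in\mathcal R$ implies $((\Gamma,(x:A)),s,t)\in\mathcal R$ for all types $A$ over $\Gamma$. Suspension: $(\Gamma,s,t)\in\mathcal R$ implies $(\Sigma\Gamma,\Sigma s,\Sigma t)\in\mathcal R$. Substitution: $(\Delta,s,t)\in\mathcal R$ and $\Gamma\vdash_{\mathcal R}\sigma:\Delta$ imply $(\Gamma,s[\![\sigma]\!],t[\![\sigma]\!])\in\mathcal R$. Tame: all three hold. Support: $(\Gamma,s,t)\in\mathcal R$ and $\Gamma\vdash_{\mathcal R}s:A$ imply $\mathrm{Supp}(s)=\mathrm{Supp}(t)$. Discs. $U^0=\star$, $U^{k+1}=d_k^-\to_{U^k}d_k^+$; $D^n$ has variables $d_0^-,d_0^+,\dots,d_{n-1}^-,d_{n-1}^+,d_n$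 with $d_k^\pm:U^k$, $d_n:U^n$. For a type $A$ over $\Gamma$ with $\dim A=n$ and a term $t$, $\{A,t\}:D^n\to\Gamma$ is the substitution with $d_n\mapsto t$ and $U^n[\![\{A,t\}]\!]\equiv A$. $\mathrm{id}(A,t)=\mathrm{Coh}_{(D^n;d_n\to_{U^n}d_n)}[\{A,t\}]$; terms of this form are identities. Dyck words and pruning. Dyck words $W\in\mathrm{Dyck}_d$: $\ominus\in\mathrm{Dyck}_0$; $W\in\mathrm{Dyck}_d$ gives $W\Uparrow\in\mathrm{Dyck}_{d+1}$; $W\in\mathrm{Dyck}_{d+1}$ gives $W\Downarrow\in\mathrm{Dyck}_d$. $\lfloor\ominus\rfloor=(x:\star)$, $\mathrm{Ty}_\ominus=\star$, $\mathrm{Tm}_\ominus=x$; $\lfloor W\Uparrow\rfloor=\lfloor W\rfloor,(y_W:\mathrm{Ty}_W),(f_W:\mathrm{Tm}_W\to_{\mathrm{Ty}_W}y_W)$, $\mathrm{Ty}_{W\Uparrow}=\mathrm{Tm}_W\to_{\mathrm{Ty}_W}y_W$, $\mathrm{Tm}_{W\Uparrow}=f_W$; $\lfloor W\Downarrow\rfloor=\lfloor W\rfloor$ and, if $\mathrm{Ty}_W=s\to_At$, $\mathrm{Ty}_{W\Downarrow}=A$, $\mathrm{Tm}_{W\Downarrow}=t$. A peak $p$ of $W$ is an occurrence in $W$ of $\Uparrow$ immediately followed by $\Downarrow$; if $E$ is the prefix of $W$ before it, $\lfloor p\rfloor=f_E$, and $W/\!\!/p$ is $W$ with these two letters deleted.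 $\pi_p:\lfloor W\rfloor\to\lfloor W/\!\!/p\rfloor$ sends $y_E\mapsto\mathrm{Tm}_E$, $f_E\mapsto\mathrm{id}(\mathrm{Ty}_E,\mathrm{Tm}_E)$ and each other variable to the corresponding variable. $\sigma/\!\!/p$ is $\sigma$ with the entries at $y_E,f_E$ deleted. $\mathcal R$ has disc removal if $\Gamma\vdash A$, $\Gamma\vdash t:A$, $\dim A=n>0$ imply $\Gamma\vdash\mathrm{Coh}_{(D^n;U^n)}[\{A,t\}]=t$. $\mathcal R$ has endo-coherence removal if $\Delta\vdash_{ps}$, $\Delta\vdash A$, $\Delta\vdash s:A$, $\mathrm{Supp}(s)=\mathrm{Var}(\Delta)$, $\Gamma\vdash\sigma:\Delta$ imply $\Gamma\vdash\mathrm{Coh}_{(\Delta;s\to_As)}[\sigma]=\mathrm{id}(A[\![\sigma]\!],s[\![\sigma]\!])$. $\mathcal R$ has pruning if for $W\in\mathrm{Dyck}_0$, $p$ a peak of $W$, $\lfloor W\rfloor\vdash A$, $\Gamma\vdash\sigma:\lfloor W\rfloor$, $(\lfloor W\rfloor,\mathrm{Supp}(\mathrm{src}(A)),\mathrm{Supp}(\mathrm{tgt}(A)))\in\mathcal O$ and $\lfloor p\rfloor[\![\sigma]\!]$ an identity, one has $\Gamma\vdash\mathrm{Coh}_{(\lfloor W\rfloor;A)}[\sigma]=\mathrm{Coh}_{(\lfloor W/\!\!/p\rfloor;A[\![\pi_p]\!])}[\sigma/\!\!/p]$. -}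

module Defs where

open import Level using (Level; 0ℓ)
open import Data.Empty using (⊥)
open import Data.Fin using (Fin; zero; suc; fromℕ; inject₁)
open import Data.Fin.Subset as Subset
  using (Subset; inside; outside; ⁅_⁆; _∪_; _-_; _∈_; _⊆_)
open import Data.Fin.Subset.Properties using (p⊆p∪q; q⊆p∪q; x∈p∪q⁻; drop-there)
open import Data.Nat using (ℕ; zero; suc; _+_; _*_; _≤_; _<_; _⊔_)
open import Data.Nat.Properties using (<-cmp; suc-injective)
open import Data.Product using (∃-syntax; ∃₂; _,_)
open import Data.Sum using (inj₁; inj₂)
open import Data.Vec using ([]; _∷_; here; there)
open import Relation.Binary.Definitions using (tri<; tri≈; tri>)
open import Relation.Binary.PropositionalEquality using (_≡_; refl; sym; trans; cong; cong₂)

infixl 5 _▸_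
infix  6 _⟶[_]_
infixl 8 _[_]ty _[_]tm _•_

------------------------------------------------------------------------
-- Raw syntax

-- Syntax up to renaming is represented by well-scoped de Bruijn indices:
-- syntax over a context depends only on its number of variables, and
-- index zero is the most recently added variable.

data Ctx : ℕ → Set
data Ty  : ℕ → Set
data Tm  : ℕ → Set
data Sub : ℕ → ℕ → Set

data Ctx where
  ∅   : Ctx 0
  _▸_ : ∀ {n} → Ctx n → Ty n → Ctx (suc n)

data Ty where
  ⋆      : ∀ {n} → Ty n
  _⟶[_]_ : ∀ {n} → Tm n → Ty n → Tm n → Ty n

data Tm where
  var : ∀ {n} → Fin n → Tm n
  Coh : ∀ {m n} → Ctx m → Ty m → Sub m n → Tm n

-- Sub m n: one term over n variables for each of m variables.
data Sub where
  ⟨⟩    : ∀ {n} → Sub 0 n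
  ⟨_,_⟩ : ∀ {m n} → Sub m n → Tm n → Sub (suc m) n

wkTy  : ∀ {n} → Ty n → Ty (suc n)
wkTm  : ∀ {n} → Tm n → Tm (suc n)
wkSub : ∀ {m n} → Sub m n → Sub m (suc n)

wkTy ⋆            = ⋆
wkTy (s ⟶[ A ] t) = wkTm s ⟶[ wkTy A ] wkTm t

wkTm (var x)     = var (suc x)
wkTm (Coh Δ A σ) = Coh Δ A (wkSub σ)

wkSub ⟨⟩        = ⟨⟩
wkSub ⟨ σ , t ⟩ = ⟨ wkSub σ , wkTm t ⟩

lookup : ∀ {n} → Ctx n → Fin n → Ty n
lookup (Γ ▸ A) zero    = wkTy A
lookup (Γ ▸ A) (suc x) = wkTy (lookup Γ x)

entry : ∀ {m n} → Sub m n → Fin m → Tm n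
entry ⟨ σ , t ⟩ zero    = t
entry ⟨ σ , t ⟩ (suc x) = entry σ x

_[_]ty : ∀ {m n} → Ty m → Sub m n → Ty n
_[_]tm : ∀ {m n} → Tm m → Sub m n → Tm n
_•_    : ∀ {l m n} → Sub l m → Sub m n → Sub l n

⋆            [ σ ]ty = ⋆
(s ⟶[ A ] t) [ σ ]ty = s [ σ ]tm ⟶[ A [ σ ]ty ] t [ σ ]tm

var x     [ σ ]tm = entry σ x
Coh Θ A τ [ σ ]tm = Coh Θ A (τ • σ)

⟨⟩        • σ = ⟨⟩
⟨ τ , t ⟩ • σ = ⟨ τ • σ , t [ σ ]tm ⟩

idSub : ∀ n → Sub n n
idSub zero    = ⟨⟩
idSub (suc n) = ⟨ wkSub (idSub n) , var zero ⟩

dim : ∀ {n} → Ty n → ℕ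
dim ⋆            = 0
dim (s ⟶[ A ] t) = suc (dim A)

dimCtx : ∀ {n} → Ctx n → ℕ
dimCtx ∅       = 0
dimCtx (Γ ▸ A) = dimCtx Γ ⊔ dim A

-- The components of s ⟶[ A ] t; the irrelevant argument excludes ⋆.

tgt : ∀ {n d} (A : Ty n) → .(dim A ≡ suc d) → Tm n
tgt (s ⟶[ A ] t) _ = t

base : ∀ {n d} (A : Ty n) → .(dim A ≡ suc d) → Ty n
base (s ⟶[ A ] t) _ = A

dim-wk : ∀ {n} (A : Ty n) → dim (wkTy A) ≡ dim A
dim-wk ⋆            = refl
dim-wk (s ⟶[ A ] t) = cong suc (dim-wk A)

dim-base : ∀ {n d} (A : Ty n) (p : dim A ≡ suc d) → dim (base A p) ≡ d
dim-base (s ⟶[ A ] t) p = suc-injective p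

------------------------------------------------------------------------
-- Suspension

-- N and S are the two first variables of a suspended context, hence carry
-- the two largest indices; every other variable keeps its index.

north south : ∀ n → Fin (2 + n)
north n = fromℕ (suc n)
south n = inject₁ (fromℕ n)

suspTy  : ∀ {n} → Ty n → Ty (2 + n)
suspTm  : ∀ {n} → Tm n → Tm (2 + n)
suspSub : ∀ {m n} → Sub m n → Sub (2 + m) (2 + n)
suspCtx : ∀ {n} → Ctx n → Ctx (2 + n)

suspTy {n} ⋆        = var (north n) ⟶[ ⋆ ] var (south n)
suspTy (s ⟶[ A ] t) = suspTm s ⟶[ suspTy A ] suspTm t

suspTm (var x)     = var (inject₁ (inject₁ x))
suspTm (Coh Δ A σ) = Coh (suspCtx Δ) (suspTy A) (suspSub σ)

suspSub {n = n} ⟨⟩ = ⟨ ⟨ ⟨⟩ , var (north n) ⟩ , var (south n) ⟩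
suspSub ⟨ σ , t ⟩  = ⟨ suspSub σ , suspTm t ⟩

suspCtx ∅       = ∅ ▸ ⋆ ▸ ⋆
suspCtx (Γ ▸ A) = suspCtx Γ ▸ suspTy A

------------------------------------------------------------------------
-- Support

FVTy  : ∀ {n} → Ty n → Subset n
FVTm  : ∀ {n} → Tm n → Subset n
FVSub : ∀ {m n} → Sub m n → Subset n

FVTy ⋆            = Subset.⊥
FVTy (s ⟶[ A ] t) = FVTm s ∪ FVTy A ∪ FVTm t

FVTm (var x)     = ⁅ x ⁆
FVTm (Coh Δ A σ) = FVSub σ

FVSub ⟨⟩        = Subset.⊥
FVSub ⟨ σ , t ⟩ = FVSub σ ∪ FVTm t

Closed : ∀ {n} → Ctx n → Subset n → Set
Closed Γ U = ∀ {x} → x ∈ U → FVTy (lookup Γ x) ⊆ U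

record IsSmallestClosed {n} (Γ : Ctx n) (V U : Subset n) : Set where
  field
    contains : V ⊆ U
    closed   : Closed Γ U
    least    : ∀ {U′} → V ⊆ U′ → Closed Γ U′ → U ⊆ U′

closure : ∀ {n} → Ctx n → Subset n → Subset n
closure ∅       []            = []
closure (Γ ▸ A) (outside ∷ V) = outside ∷ closure Γ V
closure (Γ ▸ A) (inside  ∷ V) = inside  ∷ closure Γ (V ∪ FVTy A)

FVTy-wk  : ∀ {n} (A : Ty n) → FVTy (wkTy A) ≡ outside ∷ FVTy A
FVTm-wk  : ∀ {n} (t : Tm n) → FVTm (wkTm t) ≡ outside ∷ FVTm t
FVSub-wk : ∀ {m n} (σ : Sub m n) → FVSub (wkSub σ) ≡ outside ∷ FVSub σ

FVTy-wk ⋆            = refl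
FVTy-wk (s ⟶[ A ] t) rewrite FVTm-wk s | FVTy-wk A | FVTm-wk t = refl

FVTm-wk (var x)     = refl
FVTm-wk (Coh Δ A σ) = FVSub-wk σ

FVSub-wk ⟨⟩        = refl
FVSub-wk ⟨ σ , t ⟩ rewrite FVSub-wk σ | FVTm-wk t = refl

module _ where
  open IsSmallestClosed

  private
    closed-tail : ∀ {n} {Γ : Ctx n} {A b U} → Closed (Γ ▸ A) (b ∷ U) → Closed Γ U
    closed-tail {Γ = Γ} c {x} x∈U y∈ with c (there x∈U)
    ... | p rewrite FVTy-wk (lookup Γ x) = drop-there (p (there y∈))

    closed-head : ∀ {n} {Γ : Ctx n} {A U} → Closed (Γ ▸ A) (inside ∷ U) → FVTy A ⊆ U
    closed-head {A = A} c y∈ with c here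
    ... | p rewrite FVTy-wk A = drop-there (p (there y∈))

    closed-cons : ∀ {n} {Γ : Ctx n} {A b U} → Closed Γ U →
                  (b ≡ inside → FVTy A ⊆ U) → Closed (Γ ▸ A) (b ∷ U)
    closed-cons {A = A} c h {zero} here y∈ rewrite FVTy-wk A with y∈
    ... | there y∈′ = there (h refl y∈′)
    closed-cons {Γ = Γ} c h {suc x} (there x∈) y∈ rewrite FVTy-wk (lookup Γ x) with y∈
    ... | there y∈′ = there (c x∈ y∈′)

  closure-smallest : ∀ {n} (Γ : Ctx n) V → IsSmallestClosed Γ V (closure Γ V)
  closure-smallest ∅ [] = record
    { contains = λ () ; closed = λ () ; least = λ _ _ () }
  closure-smallest (Γ ▸ A) (outside ∷ V) with closure-smallest Γ V
  ... | ih = record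
    { contains = λ { (there x∈) → there (contains ih x∈) }
    ; closed   = closed-cons (closed ih) (λ ())
    ; least    = λ { {_ ∷ _} V⊆ c (there x∈) →
                     there (least ih (λ y∈ → drop-there (V⊆ (there y∈))) (closed-tail c) x∈) }
    }
  closure-smallest (Γ ▸ A) (inside ∷ V) with closure-smallest Γ (V ∪ FVTy A)
  ... | ih = record
    { contains = λ { here → here
                   ; (there x∈) → there (contains ih (p⊆p∪q (FVTy A) x∈)) }
    ; closed   = closed-cons (closed ih) (λ _ y∈ → contains ih (q⊆p∪q V (FVTy A) y∈))
    ; least    = λ { V⊆ c here → V⊆ here
                   ; {_ ∷ U} V⊆ c (there x∈) → there (least ih (sub V⊆ c) (closed-tail c) x∈) }
    }
    where
    sub : ∀ {b U} → (inside ∷ V) ⊆ (b ∷ U) → Closed (Γ ▸ A) (b ∷ U) → (V ∪ FVTy A) ⊆ U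
    sub V⊆ c y∈ with V⊆ here | x∈p∪q⁻ V (FVTy A) y∈
    ... | here | inj₁ y∈V = drop-there (V⊆ (there y∈V))
    ... | here | inj₂ y∈A = closed-head c y∈A

Supp : ∀ {n} → Ctx n → Tm n → Subset n
Supp Γ t = closure Γ (FVTm t)

------------------------------------------------------------------------
-- Ps-contexts and the regular operation set

infix 4 _⊢ps_∶_

-- The subject of the judgement is always a variable.
data _⊢ps_∶_ : ∀ {n} → Ctx n → Fin n → Ty n → Set where
  pss : ∅ ▸ ⋆ ⊢ps zero ∶ ⋆
  pse : ∀ {n} {Γ : Ctx n} {x A} → Γ ⊢ps x ∶ A →
        Γ ▸ A ▸ (var (suc x) ⟶[ wkTy A ] var zero)
          ⊢ps zero ∶ wkTy (var (suc x) ⟶[ wkTy A ] var zero)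
  psd : ∀ {n} {Γ : Ctx n} {x s A y} → Γ ⊢ps x ∶ s ⟶[ A ] var y → Γ ⊢ps y ∶ A

PsContext : ∀ {n} → Ctx n → Set
PsContext Γ = ∃[ x ] Γ ⊢ps x ∶ ⋆

data Sign : Set where
  ⁻ ⁺ : Sign

∂ : ∀ {n} {Γ : Ctx n} {x A} → ℕ → Sign → Γ ⊢ps x ∶ A → Subset n
∂ i ε pss = inside ∷ []
∂ i ε (psd p) = ∂ i ε p
∂ i ε (pse {x = x} {A = A} p) with <-cmp i (dim A)
∂ i ε (pse {x = x} {A = A} p) | tri< _ _ _ = outside ∷ outside ∷ ∂ i ε p
∂ i ⁻ (pse {x = x} {A = A} p) | tri≈ _ _ _ = outside ∷ outside ∷ ∂ i ⁻ p
∂ i ⁺ (pse {x = x} {A = A} p) | tri≈ _ _ _ = outside ∷ inside ∷ (∂ i ⁺ p - x)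
∂ i ε (pse {x = x} {A = A} p) | tri> _ _ _ = inside ∷ inside ∷ ∂ i ε p

-- dimCtx Δ ≤ suc n is n ≥ dim Δ − 1 with the subtraction taken in ℤ.
data Regular : ∀ {m} → Ctx m → Subset m → Subset m → Set where
  regular : ∀ {m} {Δ : Ctx m} ((x , p) : PsContext Δ) n → dimCtx Δ ≤ suc n →
            Regular Δ (∂ n ⁻ p) (∂ n ⁺ p)

------------------------------------------------------------------------
-- The theory generated by an equality rule set

RuleSet : (ℓ : Level) → Set (Level.suc ℓ)
RuleSet ℓ = ∀ {n} → Ctx n → Tm n → Tm n → Set ℓ

module Typing {ℓ} (R : RuleSet ℓ) where

  infix 4 _⊢ctx _⊢ty_ _⊢_∶_ _⊢sub_∶_ _⊢_≈ty_ _⊢_≈tm_ _⊢_≈sub_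

  data _⊢ctx     : ∀ {n} → Ctx n → Set ℓ
  data _⊢ty_     : ∀ {n} → Ctx n → Ty n → Set ℓ
  data _⊢_∶_     : ∀ {n} → Ctx n → Tm n → Ty n → Set ℓ
  data _⊢sub_∶_  : ∀ {m n} → Ctx n → Sub m n → Ctx m → Set ℓ
  data _⊢_≈ty_   : ∀ {n} → Ctx n → Ty n → Ty n → Set ℓ
  data _⊢_≈tm_   : ∀ {n} → Ctx n → Tm n → Tm n → Set ℓ
  data _⊢_≈sub_  : ∀ {m n} → Ctx n → Sub m n → Sub m n → Set ℓ

  data _⊢ctx where
    ctx-∅ : ∅ ⊢ctx
    ctx-▸ : ∀ {n} {Γ : Ctx n} {A} → Γ ⊢ctx → Γ ⊢ty A → Γ ▸ A ⊢ctx

  data _⊢ty_ where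
    ty-⋆ : ∀ {n} {Γ : Ctx n} → Γ ⊢ty ⋆
    ty-⟶ : ∀ {n} {Γ : Ctx n} {s A t} →
           Γ ⊢ty A → Γ ⊢ s ∶ A → Γ ⊢ t ∶ A → Γ ⊢ty s ⟶[ A ] t

  data _⊢_∶_ where
    tm-var  : ∀ {n} {Γ : Ctx n} x → Γ ⊢ var x ∶ lookup Γ x
    tm-conv : ∀ {n} {Γ : Ctx n} {t A B} → Γ ⊢ t ∶ A → Γ ⊢ A ≈ty B → Γ ⊢ t ∶ B
    tm-coh  : ∀ {m n} {Δ : Ctx m} {Γ : Ctx n} {s A t σ} →
              PsContext Δ → Δ ⊢ty s ⟶[ A ] t → Γ ⊢sub σ ∶ Δ →
              Regular Δ (Supp Δ s) (Supp Δ t) →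
              Γ ⊢ Coh Δ (s ⟶[ A ] t) σ ∶ (s ⟶[ A ] t) [ σ ]ty

  data _⊢sub_∶_ where
    sub-⟨⟩ : ∀ {n} {Γ : Ctx n} → Γ ⊢sub ⟨⟩ ∶ ∅
    sub-▸  : ∀ {m n} {Δ : Ctx m} {Γ : Ctx n} {σ t A} →
             Γ ⊢sub σ ∶ Δ → Γ ⊢ t ∶ A [ σ ]ty → Γ ⊢sub ⟨ σ , t ⟩ ∶ Δ ▸ A

  data _⊢_≈ty_ where
    ≈-⋆ : ∀ {n} {Γ : Ctx n} → Γ ⊢ ⋆ ≈ty ⋆
    ≈-⟶ : ∀ {n} {Γ : Ctx n} {s s′ A A′ t t′} →
          Γ ⊢ s ≈tm s′ → Γ ⊢ A ≈ty A′ → Γ ⊢ t ≈tm t′ →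
          Γ ⊢ s ⟶[ A ] t ≈ty s′ ⟶[ A′ ] t′

  data _⊢_≈tm_ where
    ≈-var   : ∀ {n} {Γ : Ctx n} x → Γ ⊢ var x ≈tm var x
    ≈-sym   : ∀ {n} {Γ : Ctx n} {s t} → Γ ⊢ s ≈tm t → Γ ⊢ t ≈tm s
    ≈-trans : ∀ {n} {Γ : Ctx n} {s t u} → Γ ⊢ s ≈tm t → Γ ⊢ t ≈tm u → Γ ⊢ s ≈tm u
    ≈-coh   : ∀ {m n} {Δ : Ctx m} {Γ : Ctx n} {A B σ τ} →
              Δ ⊢ A ≈ty B → Γ ⊢ σ ≈sub τ → Γ ⊢ Coh Δ A σ ≈tm Coh Δ B τ
    ≈-rule  : ∀ {n} {Γ : Ctx n} {s t A} → R Γ s t → Γ ⊢ s ∶ A → Γ ⊢ s ≈tm t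

  data _⊢_≈sub_ where
    ≈-⟨⟩ : ∀ {n} {Γ : Ctx n} → Γ ⊢ ⟨⟩ ≈sub ⟨⟩
    ≈-▸  : ∀ {m n} {Γ : Ctx n} {σ τ : Sub m n} {s t} →
           Γ ⊢ σ ≈sub τ → Γ ⊢ s ≈tm t → Γ ⊢ ⟨ σ , s ⟩ ≈sub ⟨ τ , t ⟩

  WellFormed : ∀ {n} → Ctx n → Tm n → Set ℓ
  WellFormed Γ t = ∃[ A ] Γ ⊢ t ∶ A

Catt : RuleSet 0ℓ
Catt _ _ _ = ⊥

------------------------------------------------------------------------
-- Discs and identities

-- The variables d₀⁻, d₀⁺, …, dₙ₋₁⁻, dₙ₋₁⁺ of Dⁿ form a context of their
-- own, over which Uⁿ is defined.

Sphere : ∀ n → Ctx (n * 2)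
U      : ∀ n → Ty (n * 2)

Sphere zero    = ∅
Sphere (suc n) = Sphere n ▸ U n ▸ wkTy (U n)

U zero    = ⋆
U (suc n) = var (suc zero) ⟶[ wkTy (wkTy (U n)) ] var zero

Disc : ∀ n → Ctx (suc (n * 2))
Disc n = Sphere n ▸ U n

sphereSub : ∀ {m} (A : Ty m) → Sub (dim A * 2) m
sphereSub ⋆            = ⟨⟩
sphereSub (s ⟶[ A ] t) = ⟨ ⟨ sphereSub A , s ⟩ , t ⟩

discSub : ∀ {m} (A : Ty m) → Tm m → Sub (suc (dim A * 2)) m
discSub A t = ⟨ sphereSub A , t ⟩

wkTy-⟨,⟩  : ∀ {m n} (A : Ty m) {σ : Sub m n} {u} → wkTy A [ ⟨ σ , u ⟩ ]ty ≡ A [ σ ]ty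
wkTm-⟨,⟩  : ∀ {m n} (t : Tm m) {σ : Sub m n} {u} → wkTm t [ ⟨ σ , u ⟩ ]tm ≡ t [ σ ]tm
wkSub-⟨,⟩ : ∀ {l m n} (τ : Sub l m) {σ : Sub m n} {u} → wkSub τ • ⟨ σ , u ⟩ ≡ τ • σ

wkTy-⟨,⟩ ⋆ = refl
wkTy-⟨,⟩ (s ⟶[ A ] t) {σ} {u}
  rewrite wkTm-⟨,⟩ s {σ} {u} | wkTy-⟨,⟩ A {σ} {u} | wkTm-⟨,⟩ t {σ} {u} = refl

wkTm-⟨,⟩ (var x)     = refl
wkTm-⟨,⟩ (Coh Δ A τ) = cong (Coh Δ A) (wkSub-⟨,⟩ τ)

wkSub-⟨,⟩ ⟨⟩        = refl
wkSub-⟨,⟩ ⟨ τ , t ⟩ = cong₂ ⟨_,_⟩ (wkSub-⟨,⟩ τ) (wkTm-⟨,⟩ t)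

U-sphereSub : ∀ {m} (A : Ty m) → U (dim A) [ sphereSub A ]ty ≡ A
U-sphereSub ⋆ = refl
U-sphereSub (s ⟶[ A ] t) = cong (s ⟶[_] t)
  (trans (wkTy-⟨,⟩ (wkTy (U (dim A)))) (trans (wkTy-⟨,⟩ (U (dim A))) (U-sphereSub A)))

-- discSub A t is the substitution out of Dⁿ determined by dₙ ↦ t and this equation.
U-discSub : ∀ {m} (A : Ty m) t → wkTy (U (dim A)) [ discSub A t ]ty ≡ A
U-discSub A t = trans (wkTy-⟨,⟩ (U (dim A))) (U-sphereSub A)

identity : ∀ {m} → Ty m → Tm m → Tm m
identity A t =
  Coh (Disc (dim A)) (var zero ⟶[ wkTy (U (dim A)) ] var zero) (discSub A t)

IsIdentity : ∀ {m} → Tm m → Set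
IsIdentity u = ∃₂ λ A t → u ≡ identity A t

------------------------------------------------------------------------
-- Dyck words and pruning

infixl 7 _⇑ _⇓ _//_ _//ˢ_

data Dyck : ℕ → Set where
  ⊖  : Dyck 0
  _⇑ : ∀ {d} → Dyck d → Dyck (suc d)
  _⇓ : ∀ {d} → Dyck (suc d) → Dyck d

size : ∀ {d} → Dyck d → ℕ
size ⊖     = 1
size (W ⇑) = 2 + size W
size (W ⇓) = size W

dyckTy     : ∀ {d} (W : Dyck d) → Ty (size W)
dyckTm     : ∀ {d} (W : Dyck d) → Tm (size W)
dim-dyckTy : ∀ {d} (W : Dyck d) → dim (dyckTy W) ≡ d

-- The type of f_W over ⌊ W ⌋, y_W.
arrowTy : ∀ {d} (W : Dyck d) → Ty (suc (size W))
arrowTy W = wkTm (dyckTm W) ⟶[ wkTy (dyckTy W) ] var zero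

dyckTy ⊖     = ⋆
dyckTy (W ⇑) = wkTy (arrowTy W)
dyckTy (W ⇓) = base (dyckTy W) (dim-dyckTy W)

dyckTm ⊖     = var zero
dyckTm (W ⇑) = var zero
dyckTm (W ⇓) = tgt (dyckTy W) (dim-dyckTy W)

dim-dyckTy ⊖     = refl
dim-dyckTy (W ⇑) =
  cong suc (trans (dim-wk (wkTy (dyckTy W))) (trans (dim-wk (dyckTy W)) (dim-dyckTy W)))
dim-dyckTy (W ⇓) = dim-base (dyckTy W) (dim-dyckTy W)

⌊_⌋ : ∀ {d} (W : Dyck d) → Ctx (size W)
⌊ ⊖ ⌋   = ∅ ▸ ⋆
⌊ W ⇑ ⌋ = ⌊ W ⌋ ▸ dyckTy W ▸ arrowTy W
⌊ W ⇓ ⌋ = ⌊ W ⌋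

data Peak : ∀ {d} → Dyck d → Set where
  peak : ∀ {d} {E : Dyck d} → Peak (E ⇑ ⇓)
  _⇑   : ∀ {d} {W : Dyck d} → Peak W → Peak (W ⇑)
  _⇓   : ∀ {d} {W : Dyck (suc d)} → Peak W → Peak (W ⇓)

_//_ : ∀ {d} (W : Dyck d) → Peak W → Dyck d
_ // peak {E = E}   = E
_ // (_⇑ {W = W} p) = (W // p) ⇑
_ // (_⇓ {W = W} p) = (W // p) ⇓

peakVar : ∀ {d} {W : Dyck d} → Peak W → Fin (size W)
peakVar peak  = zero
peakVar (p ⇑) = suc (suc (peakVar p))
peakVar (p ⇓) = peakVar p

π : ∀ {d} {W : Dyck d} (p : Peak W) → Sub (size W) (size (W // p))
π (peak {E = E}) = ⟨ ⟨ idSub (size E) , dyckTm E ⟩ , identity (dyckTy E) (dyckTm E) ⟩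
π (p ⇑)          = ⟨ ⟨ wkSub (wkSub (π p)) , var (suc zero) ⟩ , var zero ⟩
π (p ⇓)          = π p

_//ˢ_ : ∀ {d n} {W : Dyck d} → Sub (size W) n → (p : Peak W) → Sub (size (W // p)) n
⟨ ⟨ σ , _ ⟩ , _ ⟩ //ˢ peak  = σ
⟨ ⟨ σ , s ⟩ , t ⟩ //ˢ (p ⇑) = ⟨ ⟨ σ //ˢ p , s ⟩ , t ⟩
σ                 //ˢ (p ⇓) = σ //ˢ p

------------------------------------------------------------------------
-- Conditions on an equality rule set

module _ {ℓ} (R : RuleSet ℓ) where
  open Typing R

  WeakeningCondition : Set ℓ
  WeakeningCondition = ∀ {n} {Γ : Ctx n} {s t} (A : Ty n) →
    R Γ s t → R (Γ ▸ A) (wkTm s) (wkTm t)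

  SuspensionCondition : Set ℓ
  SuspensionCondition = ∀ {n} {Γ : Ctx n} {s t} →
    R Γ s t → R (suspCtx Γ) (suspTm s) (suspTm t)

  SubstitutionCondition : Set ℓ
  SubstitutionCondition = ∀ {m n} {Δ : Ctx m} {Γ : Ctx n} {s t} {σ : Sub m n} →
    R Δ s t → Γ ⊢sub σ ∶ Δ → R Γ (s [ σ ]tm) (t [ σ ]tm)

  record Tame : Set ℓ where
    field
      weakening    : WeakeningCondition
      suspension   : SuspensionCondition
      substitution : SubstitutionCondition

  SupportCondition : Set ℓ
  SupportCondition = ∀ {n} {Γ : Ctx n} {s t A} →
    R Γ s t → Γ ⊢ s ∶ A → Supp Γ s ≡ Supp Γ t

  DiscRemoval : Set ℓ
  DiscRemoval = ∀ {n} {Γ : Ctx n} {A t} → Γ ⊢ty A → Γ ⊢ t ∶ A → 0 < dim A →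
    Γ ⊢ Coh (Disc (dim A)) (wkTy (U (dim A))) (discSub A t) ≈tm t

  EndoCoherenceRemoval : Set ℓ
  EndoCoherenceRemoval = ∀ {m n} {Δ : Ctx m} {Γ : Ctx n} {A s} {σ : Sub m n} →
    PsContext Δ → Δ ⊢ty A → Δ ⊢ s ∶ A → Supp Δ s ≡ Subset.⊤ → Γ ⊢sub σ ∶ Δ →
    Γ ⊢ Coh Δ (s ⟶[ A ] s) σ ≈tm identity (A [ σ ]ty) (s [ σ ]tm)

  HasPruning : Set ℓ
  HasPruning = ∀ {n} {W : Dyck 0} (p : Peak W) {Γ : Ctx n} {s A t} {σ : Sub (size W) n} →
    ⌊ W ⌋ ⊢ty s ⟶[ A ] t → Γ ⊢sub σ ∶ ⌊ W ⌋ →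
    Regular ⌊ W ⌋ (Supp ⌊ W ⌋ s) (Supp ⌊ W ⌋ t) →
    IsIdentity (entry σ (peakVar p)) →
    Γ ⊢ Coh ⌊ W ⌋ (s ⟶[ A ] t) σ
      ≈tm Coh ⌊ W // p ⌋ ((s ⟶[ A ] t) [ π p ]ty) (σ //ˢ p)

{-# OPTIONS --safe #-}
module Submission where

-- A derivation in the theory of R is turned into one in Catt by recursion. The only
-- obstacle is that the Catt terms obtained for the pieces of a substitution or of an
-- arrow type have types that agree only up to R, so one must convert a Catt term t : A
-- over a ps-context into a Catt term t′ : B with t′ = t, where A = B in R. The levels of
-- A and B are aligned from the bottom up: if p → q lies below A and p′ → q′ below B over
-- the same type, then t is whiskered with coherences φ : p′ → p and ψ : q → q′. In R both
-- are identities by endo-coherence removal, so pruning removes them from the composite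
-- and disc removal leaves t.
--
-- The coherences exist because p and p′ have the same support and the support of a Catt
-- term over a ps-context is again a ps-context, onto which the ambient one retracts. This
-- is shown by removing the last pair (y , f) with f : x → y from the ps-context. The
-- critical case, a term whose support contains x and y but not f, is excluded by mapping
-- the ps-context to a globe, where every term evaluates to a single cell.

open import Defs
open import Data.Empty using (⊥; ⊥-elim)
open import Data.Fin as Fin using (Fin; zero; suc)
import Data.Fin.Properties as Fin
open import Data.Fin.Subset as Subset using (Subset; inside; outside; ⁅_⁆; _∪_; _∈_; _∉_; _⊆_; _-_; _─_)
open import Data.Fin.Subset.Properties
  using (p⊆p∪q; q⊆p∪q; x∈p∪q⁻; x∈⁅x⁆; x∈⁅y⁆⇒x≡y; ∉⊥; ∈⊤; ⊆⊤; ⊆-antisym; p─q⊆p; p─⊥≡p; x∈p∧x≢y⇒x∈p-y; ∪-identityˡ; _∈?_)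
open import Data.Nat using (ℕ; zero; suc; _+_; _*_; _⊔_; _≤_; _<_; z≤n; s≤s; _≤?_; _<?_)
open import Data.Nat.Properties hiding (_≤?_; _<?_)
open import Data.Product using (∃-syntax; Σ-syntax; _×_; _,_; proj₁; proj₂)
open import Data.Sum using (_⊎_; inj₁; inj₂; [_,_]′)
open import Data.Unit using (⊤; tt)
open import Data.Vec using (here; there; []; _∷_)
open import Function using (_∘_)
open import Relation.Binary.Definitions using (tri<; tri≈; tri>)
open import Relation.Binary.PropositionalEquality
open import Relation.Nullary using (¬_; yes; no)

-- Raw substitution calculus

-- With no rules, equality is syntactic identity, so a Catt term has exactly one type and a mismatch
-- that R would absorb by conversion has to be repaired by changing the term. The repair goes
-- upwards because whiskering fixes one level exactly while replacing every higher source and target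
-- by a composite; these composites agree with the old cells in R, so the hypothesis survives for
-- the remaining levels.
--
-- The same rigidity helps with supports: only Catt terms are evaluated in the globe, so no rule of
-- R has to be interpreted there. In the globe two nondegenerate cells are never composable, so a
-- pasting diagram has a largest value, which is its composite. The map used for the critical pair
-- sends `x` and `y` to the incomparable cells of one level and only `f` above them; a term that
-- sees both `x` and `y` takes a value above both and hence mentions `f`.

⟶-cong : ∀ {n} {s s′ : Tm n} {A A′ t t′} → s ≡ s′ → A ≡ A′ → t ≡ t′ → s ⟶[ A ] t ≡ s′ ⟶[ A′ ] t′
⟶-cong refl refl refl = refl

wk-[]ty : ∀ {m n} (A : Ty m) (σ : Sub m n) → A [ wkSub σ ]ty ≡ wkTy (A [ σ ]ty)
wk-[]tm : ∀ {m n} (t : Tm m) (σ : Sub m n) → t [ wkSub σ ]tm ≡ wkTm (t [ σ ]tm)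
wk-•    : ∀ {l m n} (τ : Sub l m) (σ : Sub m n) → τ • wkSub σ ≡ wkSub (τ • σ)
entry-wk : ∀ {m n} (σ : Sub m n) x → entry (wkSub σ) x ≡ wkTm (entry σ x)

wk-[]ty ⋆ σ = refl
wk-[]ty (s ⟶[ A ] t) σ = ⟶-cong (wk-[]tm s σ) (wk-[]ty A σ) (wk-[]tm t σ)
wk-[]tm (var x) σ = entry-wk σ x
wk-[]tm (Coh Δ A τ) σ = cong (Coh Δ A) (wk-• τ σ)
wk-• ⟨⟩ σ = refl
wk-• ⟨ τ , t ⟩ σ = cong₂ ⟨_,_⟩ (wk-• τ σ) (wk-[]tm t σ)
entry-wk ⟨ σ , t ⟩ zero = refl
entry-wk ⟨ σ , t ⟩ (suc x) = entry-wk σ x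

entry-id : ∀ {n} (x : Fin n) → entry (idSub n) x ≡ var x
entry-id zero = refl
entry-id {suc n} (suc x) = trans (entry-wk (idSub n) x) (cong wkTm (entry-id x))

[id]ty : ∀ {n} (A : Ty n) → A [ idSub n ]ty ≡ A
[id]tm : ∀ {n} (t : Tm n) → t [ idSub n ]tm ≡ t
•-id   : ∀ {m n} (σ : Sub m n) → σ • idSub n ≡ σ
[id]ty ⋆ = refl
[id]ty (s ⟶[ A ] t) = ⟶-cong ([id]tm s) ([id]ty A) ([id]tm t)
[id]tm (var x) = entry-id x
[id]tm (Coh Δ A σ) = cong (Coh Δ A) (•-id σ)
•-id ⟨⟩ = refl
•-id ⟨ σ , t ⟩ = cong₂ ⟨_,_⟩ (•-id σ) ([id]tm t)

id-• : ∀ {m n} (σ : Sub m n) → idSub m • σ ≡ σ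
id-• ⟨⟩ = refl
id-• {suc m} ⟨ σ , t ⟩ = cong ⟨_, t ⟩ (trans (wkSub-⟨,⟩ (idSub m)) (id-• σ))

entry-• : ∀ {l m n} (τ : Sub l m) (σ : Sub m n) x → entry (τ • σ) x ≡ entry τ x [ σ ]tm
entry-• ⟨ τ , t ⟩ σ zero = refl
entry-• ⟨ τ , t ⟩ σ (suc x) = entry-• τ σ x

assoc-ty : ∀ {l m n} (A : Ty l) (τ : Sub l m) (σ : Sub m n) → A [ τ ]ty [ σ ]ty ≡ A [ τ • σ ]ty
assoc-tm : ∀ {l m n} (t : Tm l) (τ : Sub l m) (σ : Sub m n) → t [ τ ]tm [ σ ]tm ≡ t [ τ • σ ]tm
•-assoc  : ∀ {k l m n} (υ : Sub k l) (τ : Sub l m) (σ : Sub m n) → υ • τ • σ ≡ υ • (τ • σ)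
assoc-ty ⋆ τ σ = refl
assoc-ty (s ⟶[ A ] t) τ σ = ⟶-cong (assoc-tm s τ σ) (assoc-ty A τ σ) (assoc-tm t τ σ)
assoc-tm (var x) τ σ = sym (entry-• τ σ x)
assoc-tm (Coh Δ A υ) τ σ = cong (Coh Δ A) (•-assoc υ τ σ)
•-assoc ⟨⟩ τ σ = refl
•-assoc ⟨ υ , t ⟩ τ σ = cong₂ ⟨_,_⟩ (•-assoc υ τ σ) (assoc-tm t τ σ)

sub-ext : ∀ {m n} {σ τ : Sub m n} → (∀ x → entry σ x ≡ entry τ x) → σ ≡ τ
sub-ext {σ = ⟨⟩} {⟨⟩} h = refl
sub-ext {σ = ⟨ σ , s ⟩} {⟨ τ , t ⟩} h = cong₂ ⟨_,_⟩ (sub-ext λ x → h (suc x)) (h zero)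

dim-[] : ∀ {m n} (A : Ty m) (σ : Sub m n) → dim (A [ σ ]ty) ≡ dim A
dim-[] ⋆ σ = refl
dim-[] (s ⟶[ A ] t) σ = cong suc (dim-[] A σ)

ren : ∀ {m n} → (Fin m → Fin n) → Sub m n
ren {zero} f = ⟨⟩
ren {suc m} f = ⟨ ren (λ x → f (suc x)) , var (f zero) ⟩

entry-ren : ∀ {m n} (f : Fin m → Fin n) x → entry (ren f) x ≡ var (f x)
entry-ren f zero = refl
entry-ren f (suc x) = entry-ren (λ x → f (suc x)) x

var-injective : ∀ {n} {x y : Fin n} → var x ≡ var y → x ≡ y
var-injective refl = refl

-- Free variables under substitution

∪⁻ : ∀ {n} {V W : Subset n} {x} → x ∈ V ∪ W → x ∈ V ⊎ x ∈ W
∪⁻ {V = V} {W} = x∈p∪q⁻ V W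

∪⁺ˡ : ∀ {n} {V W : Subset n} {x} → x ∈ V → x ∈ V ∪ W
∪⁺ˡ {W = W} = p⊆p∪q W

∪⁺ʳ : ∀ {n} {V W : Subset n} {x} → x ∈ W → x ∈ V ∪ W
∪⁺ʳ {V = V} {W} = q⊆p∪q V W

data InArrow {n} (x : Fin n) (s : Tm n) (A : Ty n) (t : Tm n) : Set where
  in-src  : x ∈ FVTm s → InArrow x s A t
  in-base : x ∈ FVTy A → InArrow x s A t
  in-tgt  : x ∈ FVTm t → InArrow x s A t

arrow⁻ : ∀ {n} {x : Fin n} s A t → x ∈ FVTy (s ⟶[ A ] t) → InArrow x s A t
arrow⁻ s A t h with ∪⁻ {V = FVTm s} h
... | inj₁ y = in-src y
... | inj₂ y with ∪⁻ {V = FVTy A} y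
...   | inj₁ z = in-base z
...   | inj₂ z = in-tgt z

arrow⁺ : ∀ {n} {x : Fin n} s A t → InArrow x s A t → x ∈ FVTy (s ⟶[ A ] t)
arrow⁺ s A t (in-src h) = ∪⁺ˡ h
arrow⁺ s A t (in-base h) = ∪⁺ʳ {V = FVTm s} (∪⁺ˡ h)
arrow⁺ s A t (in-tgt h) = ∪⁺ʳ {V = FVTm s} (∪⁺ʳ {V = FVTy A} h)

FVTy-[]⁻ : ∀ {m n} (A : Ty m) {σ : Sub m n} {x} → x ∈ FVTy (A [ σ ]ty) → ∃[ z ] (z ∈ FVTy A × x ∈ FVTm (entry σ z))
FVTm-[]⁻ : ∀ {m n} (t : Tm m) {σ : Sub m n} {x} → x ∈ FVTm (t [ σ ]tm) → ∃[ z ] (z ∈ FVTm t × x ∈ FVTm (entry σ z))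
FVSub-•⁻ : ∀ {l m n} (τ : Sub l m) {σ : Sub m n} {x} → x ∈ FVSub (τ • σ) → ∃[ z ] (z ∈ FVSub τ × x ∈ FVTm (entry σ z))
FVTy-[]⁻ ⋆ h = ⊥-elim (∉⊥ h)
FVTy-[]⁻ (s ⟶[ A ] t) {σ} h with arrow⁻ (s [ σ ]tm) (A [ σ ]ty) (t [ σ ]tm) h
... | in-src h′ = let z , z∈ , x∈ = FVTm-[]⁻ s h′ in z , arrow⁺ s A t (in-src z∈) , x∈
... | in-base h′ = let z , z∈ , x∈ = FVTy-[]⁻ A h′ in z , arrow⁺ s A t (in-base z∈) , x∈
... | in-tgt h′ = let z , z∈ , x∈ = FVTm-[]⁻ t h′ in z , arrow⁺ s A t (in-tgt z∈) , x∈
FVTm-[]⁻ (var z) h = z , x∈⁅x⁆ z , h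
FVTm-[]⁻ (Coh Δ A τ) h = FVSub-•⁻ τ h
FVSub-•⁻ ⟨⟩ h = ⊥-elim (∉⊥ h)
FVSub-•⁻ ⟨ τ , t ⟩ {σ} h with ∪⁻ {V = FVSub (τ • σ)} h
... | inj₁ h′ = let z , z∈ , x∈ = FVSub-•⁻ τ h′ in z , ∪⁺ˡ z∈ , x∈
... | inj₂ h′ = let z , z∈ , x∈ = FVTm-[]⁻ t h′ in z , ∪⁺ʳ {V = FVSub τ} z∈ , x∈

FVTy-[]⁺ : ∀ {m n} (A : Ty m) {σ : Sub m n} {x z} → z ∈ FVTy A → x ∈ FVTm (entry σ z) → x ∈ FVTy (A [ σ ]ty)
FVTm-[]⁺ : ∀ {m n} (t : Tm m) {σ : Sub m n} {x z} → z ∈ FVTm t → x ∈ FVTm (entry σ z) → x ∈ FVTm (t [ σ ]tm)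
FVSub-•⁺ : ∀ {l m n} (τ : Sub l m) {σ : Sub m n} {x z} → z ∈ FVSub τ → x ∈ FVTm (entry σ z) → x ∈ FVSub (τ • σ)
FVTy-[]⁺ ⋆ h _ = ⊥-elim (∉⊥ h)
FVTy-[]⁺ (s ⟶[ A ] t) {σ} h x∈ with arrow⁻ s A t h
... | in-src z∈ = arrow⁺ (s [ σ ]tm) (A [ σ ]ty) (t [ σ ]tm) (in-src (FVTm-[]⁺ s {σ} z∈ x∈))
... | in-base z∈ = arrow⁺ (s [ σ ]tm) (A [ σ ]ty) (t [ σ ]tm) (in-base (FVTy-[]⁺ A {σ} z∈ x∈))
... | in-tgt z∈ = arrow⁺ (s [ σ ]tm) (A [ σ ]ty) (t [ σ ]tm) (in-tgt (FVTm-[]⁺ t {σ} z∈ x∈))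
FVTm-[]⁺ (var y) h x∈ with refl ← x∈⁅y⁆⇒x≡y y h = x∈
FVTm-[]⁺ (Coh Δ A τ) h x∈ = FVSub-•⁺ τ h x∈
FVSub-•⁺ ⟨⟩ h _ = ⊥-elim (∉⊥ h)
FVSub-•⁺ ⟨ τ , t ⟩ {σ} h x∈ with ∪⁻ {V = FVSub τ} h
... | inj₁ z∈ = ∪⁺ˡ (FVSub-•⁺ τ z∈ x∈)
... | inj₂ z∈ = ∪⁺ʳ {V = FVSub (τ • σ)} (FVTm-[]⁺ t z∈ x∈)

FVSub⁺ : ∀ {m n} (σ : Sub m n) z {x} → x ∈ FVTm (entry σ z) → x ∈ FVSub σ
FVSub⁺ ⟨ σ , t ⟩ zero h = ∪⁺ʳ {V = FVSub σ} h
FVSub⁺ ⟨ σ , t ⟩ (suc z) h = ∪⁺ˡ (FVSub⁺ σ z h)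

FVSub⁻ : ∀ {m n} (σ : Sub m n) {x} → x ∈ FVSub σ → ∃[ z ] x ∈ FVTm (entry σ z)
FVSub⁻ ⟨⟩ h = ⊥-elim (∉⊥ h)
FVSub⁻ ⟨ σ , t ⟩ h with ∪⁻ {V = FVSub σ} h
... | inj₁ h′ = let z , x∈ = FVSub⁻ σ h′ in suc z , x∈
... | inj₂ h′ = zero , h′

agree-ty : ∀ {m n} (A : Ty m) {σ τ : Sub m n} → (∀ {x} → x ∈ FVTy A → entry σ x ≡ entry τ x) → A [ σ ]ty ≡ A [ τ ]ty
agree-tm : ∀ {m n} (t : Tm m) {σ τ : Sub m n} → (∀ {x} → x ∈ FVTm t → entry σ x ≡ entry τ x) → t [ σ ]tm ≡ t [ τ ]tm
agree-sub : ∀ {l m n} (υ : Sub l m) {σ τ : Sub m n} → (∀ {x} → x ∈ FVSub υ → entry σ x ≡ entry τ x) → υ • σ ≡ υ • τ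
agree-ty ⋆ h = refl
agree-ty (s ⟶[ A ] t) h =
  ⟶-cong (agree-tm s λ x∈ → h (arrow⁺ s A t (in-src x∈))) (agree-ty A λ x∈ → h (arrow⁺ s A t (in-base x∈)))
         (agree-tm t λ x∈ → h (arrow⁺ s A t (in-tgt x∈)))
agree-tm (var x) h = h (x∈⁅x⁆ x)
agree-tm (Coh Δ A υ) h = cong (Coh Δ A) (agree-sub υ h)
agree-sub ⟨⟩ h = refl
agree-sub ⟨ υ , t ⟩ h = cong₂ ⟨_,_⟩ (agree-sub υ λ x∈ → h (∪⁺ˡ x∈)) (agree-tm t λ x∈ → h (∪⁺ʳ {V = FVSub υ} x∈))

wk∈ty : ∀ {n} (A : Ty n) {x} → x ∈ FVTy A → suc x ∈ FVTy (wkTy A)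
wk∈ty A h rewrite FVTy-wk A = there h

wk∈ty⁻ : ∀ {n} (A : Ty n) {x} → suc x ∈ FVTy (wkTy A) → x ∈ FVTy A
wk∈ty⁻ A h rewrite FVTy-wk A with h
... | there h′ = h′

zero∉wkTy : ∀ {n} (A : Ty n) → zero ∉ FVTy (wkTy A)
zero∉wkTy A h rewrite FVTy-wk A with h
... | ()

-- Supports

module _ {n} {Γ : Ctx n} {V : Subset n} where
  open IsSmallestClosed (closure-smallest Γ V) public
    using () renaming (contains to closure-contains; closed to closure-closed; least to closure-least)

-- `closure-least` only compares with a `Subset`; this form admits arbitrary predicates, such as
-- inclusions of supports or existence statements.
closure-ind : ∀ {n} (Γ : Ctx n) V {ℓ} (P : Fin n → Set ℓ) → (∀ {x} → x ∈ V → P x) →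
              (∀ {x y} → P x → y ∈ FVTy (lookup Γ x) → P y) → ∀ {x} → x ∈ closure Γ V → P x
closure-ind (Γ ▸ A) (outside ∷ V) P b s (there h) =
  closure-ind Γ V (λ x → P (suc x)) (λ x∈ → b (there x∈)) (λ {x} p y∈ → s p (wk∈ty (lookup Γ x) y∈)) h
closure-ind (Γ ▸ A) (inside ∷ V) P b s here = b here
closure-ind (Γ ▸ A) (inside ∷ V) P b s (there h) =
  closure-ind Γ (V ∪ FVTy A) (λ x → P (suc x))
    (λ x∈ → [ (λ x∈V → b (there x∈V)) , (λ x∈A → s (b here) (wk∈ty A x∈A)) ]′ (∪⁻ {V = V} x∈))
    (λ {x} p y∈ → s p (wk∈ty (lookup Γ x) y∈)) h

closure-mono : ∀ {n} {Γ : Ctx n} {V W} → V ⊆ closure Γ W → closure Γ V ⊆ closure Γ W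
closure-mono {Γ = Γ} V⊆ = closure-least {Γ = Γ} V⊆ (closure-closed {Γ = Γ})

closure-∪-cong : ∀ {n} {Γ : Ctx n} {V V′ W W′} → closure Γ V ≡ closure Γ V′ → closure Γ W ≡ closure Γ W′ →
  closure Γ (V ∪ W) ≡ closure Γ (V′ ∪ W′)
closure-∪-cong {Γ = Γ} p q = ⊆-antisym (half p q) (half (sym p) (sym q))
  where
  half : ∀ {V V′ W W′} → closure Γ V ≡ closure Γ V′ → closure Γ W ≡ closure Γ W′ →
         closure Γ (V ∪ W) ⊆ closure Γ (V′ ∪ W′)
  half {V} {V′} {W} {W′} p q = closure-mono {Γ = Γ} λ x∈ → [
    (λ h → closure-mono {Γ = Γ} {V = V′} (λ z → closure-contains {Γ = Γ} (∪⁺ˡ z)) (subst (_ ∈_) p (closure-contains {Γ = Γ} h))) ,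
    (λ h → closure-mono {Γ = Γ} {V = W′} (λ z → closure-contains {Γ = Γ} (∪⁺ʳ {V = V′} z)) (subst (_ ∈_) q (closure-contains {Γ = Γ} h))) ]′ (∪⁻ {V = V} x∈)

-- Structural lemmas of the theories

module RawTyping {ℓ} {R : RuleSet ℓ} where
  open Typing R

  retype : ∀ {n} {Γ : Ctx n} {t A B} → A ≡ B → Γ ⊢ t ∶ A → Γ ⊢ t ∶ B
  retype refl h = h

  sub-entry : ∀ {m n} {Γ : Ctx n} {Δ : Ctx m} {σ} → Γ ⊢sub σ ∶ Δ → ∀ x → Γ ⊢ entry σ x ∶ lookup Δ x [ σ ]ty
  sub-entry (sub-▸ {A = A} h t) zero = retype (sym (wkTy-⟨,⟩ A)) t
  sub-entry {Δ = Δ ▸ _} (sub-▸ h t) (suc x) = retype (sym (wkTy-⟨,⟩ (lookup Δ x))) (sub-entry h x)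

  sub-intro : ∀ {m n} {Γ : Ctx n} {Δ : Ctx m} {σ} → (∀ x → Γ ⊢ entry σ x ∶ lookup Δ x [ σ ]ty) → Γ ⊢sub σ ∶ Δ
  sub-intro {Δ = ∅} {⟨⟩} h = sub-⟨⟩
  sub-intro {Δ = Δ ▸ A} {⟨ σ , t ⟩} h =
    sub-▸ (sub-intro λ x → retype (wkTy-⟨,⟩ (lookup Δ x)) (h (suc x))) (retype (wkTy-⟨,⟩ A) (h zero))

  idSub-typed : ∀ {n} {Γ : Ctx n} → Γ ⊢sub idSub n ∶ Γ
  idSub-typed {Γ = Γ} = sub-intro λ x →
    subst₂ (Γ ⊢_∶_) (sym (entry-id x)) (sym ([id]ty (lookup Γ x))) (tm-var x)

  wk-typed : ∀ {n} {Γ : Ctx n} {A} → Γ ▸ A ⊢sub wkSub (idSub n) ∶ Γ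
  wk-typed {Γ = Γ} {A} = sub-intro λ x →
    subst₂ (Γ ▸ A ⊢_∶_) (sym (trans (entry-wk (idSub _) x) (cong wkTm (entry-id x))))
      (sym (trans (wk-[]ty (lookup Γ x) (idSub _)) (cong wkTy ([id]ty (lookup Γ x))))) (tm-var (suc x))

  ≈ty-refl  : ∀ {n} {Γ : Ctx n} (A : Ty n) → Γ ⊢ A ≈ty A
  ≈tm-refl  : ∀ {n} {Γ : Ctx n} (t : Tm n) → Γ ⊢ t ≈tm t
  ≈sub-refl : ∀ {m n} {Γ : Ctx n} (σ : Sub m n) → Γ ⊢ σ ≈sub σ
  ≈ty-refl ⋆ = ≈-⋆
  ≈ty-refl (s ⟶[ A ] t) = ≈-⟶ (≈tm-refl s) (≈ty-refl A) (≈tm-refl t)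
  ≈tm-refl (var x) = ≈-var x
  ≈tm-refl (Coh Δ A σ) = ≈-coh (≈ty-refl A) (≈sub-refl σ)
  ≈sub-refl ⟨⟩ = ≈-⟨⟩
  ≈sub-refl ⟨ σ , t ⟩ = ≈-▸ (≈sub-refl σ) (≈tm-refl t)

  ≈tm-reflexive : ∀ {n} {Γ : Ctx n} {s t : Tm n} → s ≡ t → Γ ⊢ s ≈tm t
  ≈tm-reflexive refl = ≈tm-refl _

  ≈ty-reflexive : ∀ {n} {Γ : Ctx n} {A B : Ty n} → A ≡ B → Γ ⊢ A ≈ty B
  ≈ty-reflexive refl = ≈ty-refl _

  ≈ty-sym : ∀ {n} {Γ : Ctx n} {A B} → Γ ⊢ A ≈ty B → Γ ⊢ B ≈ty A
  ≈ty-sym ≈-⋆ = ≈-⋆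
  ≈ty-sym (≈-⟶ p q r) = ≈-⟶ (≈-sym p) (≈ty-sym q) (≈-sym r)

  ≈ty-trans : ∀ {n} {Γ : Ctx n} {A B C} → Γ ⊢ A ≈ty B → Γ ⊢ B ≈ty C → Γ ⊢ A ≈ty C
  ≈ty-trans ≈-⋆ ≈-⋆ = ≈-⋆
  ≈ty-trans (≈-⟶ p q r) (≈-⟶ p′ q′ r′) = ≈-⟶ (≈-trans p p′) (≈ty-trans q q′) (≈-trans r r′)

  -- Coherences are congruent in their arguments with no typing assumption, so
  -- substituting equal substitutions needs none either.
  []-congʳ-ty  : ∀ {m n} {Γ : Ctx n} (A : Ty m) {σ τ} → Γ ⊢ σ ≈sub τ → Γ ⊢ A [ σ ]ty ≈ty A [ τ ]ty
  []-congʳ-tm  : ∀ {m n} {Γ : Ctx n} (t : Tm m) {σ τ} → Γ ⊢ σ ≈sub τ → Γ ⊢ t [ σ ]tm ≈tm t [ τ ]tm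
  []-congʳ-sub : ∀ {l m n} {Γ : Ctx n} (υ : Sub l m) {σ τ} → Γ ⊢ σ ≈sub τ → Γ ⊢ υ • σ ≈sub υ • τ
  []-congʳ-ty ⋆ h = ≈-⋆
  []-congʳ-ty (s ⟶[ A ] t) h = ≈-⟶ ([]-congʳ-tm s h) ([]-congʳ-ty A h) ([]-congʳ-tm t h)
  []-congʳ-tm (var zero) (≈-▸ h p) = p
  []-congʳ-tm (var (suc x)) (≈-▸ h p) = []-congʳ-tm (var x) h
  []-congʳ-tm (Coh Δ A υ) h = ≈-coh (≈ty-refl A) ([]-congʳ-sub υ h)
  []-congʳ-sub ⟨⟩ h = ≈-⟨⟩
  []-congʳ-sub ⟨ υ , t ⟩ h = ≈-▸ ([]-congʳ-sub υ h) ([]-congʳ-tm t h)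

  arrow-base : ∀ {n} {Γ : Ctx n} {s A t} → Γ ⊢ty s ⟶[ A ] t → Γ ⊢ty A
  arrow-base (ty-⟶ h _ _) = h

module SubstitutionLemma {ℓ} {R : RuleSet ℓ} (R-sub : SubstitutionCondition R) where
  open Typing R
  open RawTyping {R = R}

  -- A coherence carries its own context and type, so substitution only composes with its argument;
  -- the condition on R enters at `≈-rule` alone.
  ty-[]   : ∀ {m n} {Δ : Ctx m} {Γ : Ctx n} {A σ} → Δ ⊢ty A → Γ ⊢sub σ ∶ Δ → Γ ⊢ty A [ σ ]ty
  tm-[]   : ∀ {m n} {Δ : Ctx m} {Γ : Ctx n} {t A σ} → Δ ⊢ t ∶ A → Γ ⊢sub σ ∶ Δ → Γ ⊢ t [ σ ]tm ∶ A [ σ ]ty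
  sub-•   : ∀ {l m n} {Θ : Ctx l} {Δ : Ctx m} {Γ : Ctx n} {τ σ} → Δ ⊢sub τ ∶ Θ → Γ ⊢sub σ ∶ Δ → Γ ⊢sub τ • σ ∶ Θ
  ≈ty-[]  : ∀ {m n} {Δ : Ctx m} {Γ : Ctx n} {A B σ} → Δ ⊢ A ≈ty B → Γ ⊢sub σ ∶ Δ → Γ ⊢ A [ σ ]ty ≈ty B [ σ ]ty
  ≈tm-[]  : ∀ {m n} {Δ : Ctx m} {Γ : Ctx n} {s t σ} → Δ ⊢ s ≈tm t → Γ ⊢sub σ ∶ Δ → Γ ⊢ s [ σ ]tm ≈tm t [ σ ]tm
  ≈sub-[] : ∀ {l m n} {Δ : Ctx m} {Γ : Ctx n} {τ υ : Sub l m} {σ} → Δ ⊢ τ ≈sub υ → Γ ⊢sub σ ∶ Δ → Γ ⊢ τ • σ ≈sub υ • σ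
  ty-[] ty-⋆ h = ty-⋆
  ty-[] (ty-⟶ a s t) h = ty-⟶ (ty-[] a h) (tm-[] s h) (tm-[] t h)
  tm-[] (tm-var x) h = sub-entry h x
  tm-[] (tm-conv t p) h = tm-conv (tm-[] t h) (≈ty-[] p h)
  tm-[] (tm-coh {s = s} {A} {t} {σ = τ} ps a τ∶ reg) h =
    retype (sym (assoc-ty (s ⟶[ A ] t) τ _)) (tm-coh ps a (sub-• τ∶ h) reg)
  sub-• sub-⟨⟩ h = sub-⟨⟩
  sub-• (sub-▸ {σ = τ} {A = A} τ∶ t) h = sub-▸ (sub-• τ∶ h) (retype (assoc-ty A τ _) (tm-[] t h))
  ≈ty-[] ≈-⋆ h = ≈-⋆
  ≈ty-[] (≈-⟶ p q r) h = ≈-⟶ (≈tm-[] p h) (≈ty-[] q h) (≈tm-[] r h)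
  ≈tm-[] (≈-var x) h = ≈tm-refl _
  ≈tm-[] (≈-sym p) h = ≈-sym (≈tm-[] p h)
  ≈tm-[] (≈-trans p q) h = ≈-trans (≈tm-[] p h) (≈tm-[] q h)
  ≈tm-[] (≈-coh p q) h = ≈-coh p (≈sub-[] q h)
  ≈tm-[] (≈-rule r s) h = ≈-rule (R-sub r h) (tm-[] s h)
  ≈sub-[] ≈-⟨⟩ h = ≈-⟨⟩
  ≈sub-[] (≈-▸ p q) h = ≈-▸ (≈sub-[] p h) (≈tm-[] q h)

  ty-wk : ∀ {n} {Γ : Ctx n} {A B} → Γ ⊢ty A → Γ ▸ B ⊢ty wkTy A
  ty-wk {Γ = Γ} {A} {B} h =
    subst (Γ ▸ B ⊢ty_) (trans (wk-[]ty A (idSub _)) (cong wkTy ([id]ty A))) (ty-[] h wk-typed)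

  tm-wk : ∀ {n} {Γ : Ctx n} {t A B} → Γ ⊢ t ∶ A → Γ ▸ B ⊢ wkTm t ∶ wkTy A
  tm-wk {Γ = Γ} {t} {A} {B} h =
    subst₂ (Γ ▸ B ⊢_∶_) (trans (wk-[]tm t (idSub _)) (cong wkTm ([id]tm t)))
      (trans (wk-[]ty A (idSub _)) (cong wkTy ([id]ty A))) (tm-[] h wk-typed)

  sub-wk : ∀ {m n} {Γ : Ctx n} {Δ : Ctx m} {σ B} → Γ ⊢sub σ ∶ Δ → Γ ▸ B ⊢sub wkSub σ ∶ Δ
  sub-wk {Γ = Γ} {Δ} {σ} {B} h =
    subst (Γ ▸ B ⊢sub_∶ Δ) (trans (wk-• σ (idSub _)) (cong wkSub (•-id σ))) (sub-• h wk-typed)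

  lookup-typed : ∀ {n} {Γ : Ctx n} → Γ ⊢ctx → ∀ x → Γ ⊢ty lookup Γ x
  lookup-typed (ctx-▸ h a) zero = ty-wk a
  lookup-typed (ctx-▸ h a) (suc x) = ty-wk (lookup-typed h x)

module _ {ℓ} (R : RuleSet ℓ) where
  private
    module C = Typing Catt
    module T = Typing R

  embed-ty  : ∀ {n} {Γ : Ctx n} {A} → Γ C.⊢ty A → Γ T.⊢ty A
  embed-tm  : ∀ {n} {Γ : Ctx n} {t A} → Γ C.⊢ t ∶ A → Γ T.⊢ t ∶ A
  embed-sub : ∀ {m n} {Γ : Ctx n} {Δ : Ctx m} {σ} → Γ C.⊢sub σ ∶ Δ → Γ T.⊢sub σ ∶ Δ
  embed-≈ty : ∀ {n} {Γ : Ctx n} {A B} → Γ C.⊢ A ≈ty B → Γ T.⊢ A ≈ty B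
  embed-≈tm : ∀ {n} {Γ : Ctx n} {s t} → Γ C.⊢ s ≈tm t → Γ T.⊢ s ≈tm t
  embed-≈sub : ∀ {m n} {Γ : Ctx n} {σ τ : Sub m n} → Γ C.⊢ σ ≈sub τ → Γ T.⊢ σ ≈sub τ
  embed-ty C.ty-⋆ = T.ty-⋆
  embed-ty (C.ty-⟶ a s t) = T.ty-⟶ (embed-ty a) (embed-tm s) (embed-tm t)
  embed-tm (C.tm-var x) = T.tm-var x
  embed-tm (C.tm-conv t p) = T.tm-conv (embed-tm t) (embed-≈ty p)
  embed-tm (C.tm-coh ps a σ reg) = T.tm-coh ps (embed-ty a) (embed-sub σ) reg
  embed-sub C.sub-⟨⟩ = T.sub-⟨⟩
  embed-sub (C.sub-▸ σ t) = T.sub-▸ (embed-sub σ) (embed-tm t)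
  embed-≈ty C.≈-⋆ = T.≈-⋆
  embed-≈ty (C.≈-⟶ p q r) = T.≈-⟶ (embed-≈tm p) (embed-≈ty q) (embed-≈tm r)
  embed-≈tm (C.≈-var x) = T.≈-var x
  embed-≈tm (C.≈-sym p) = T.≈-sym (embed-≈tm p)
  embed-≈tm (C.≈-trans p q) = T.≈-trans (embed-≈tm p) (embed-≈tm q)
  embed-≈tm (C.≈-coh p q) = T.≈-coh (embed-≈ty p) (embed-≈sub q)
  embed-≈sub C.≈-⟨⟩ = T.≈-⟨⟩
  embed-≈sub (C.≈-▸ p q) = T.≈-▸ (embed-≈sub p) (embed-≈tm q)

module _ {ℓ} {R : RuleSet ℓ} (R-supp : SupportCondition R) where
  open Typing R

  -- The free variables of a coherence are those of its substitution, so an equation between the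
  -- types of two coherences has no effect on supports.
  ≈tm-supp  : ∀ {n} {Γ : Ctx n} {s t} → Γ ⊢ s ≈tm t → Supp Γ s ≡ Supp Γ t
  ≈sub-supp : ∀ {m n} {Γ : Ctx n} {σ τ : Sub m n} → Γ ⊢ σ ≈sub τ → closure Γ (FVSub σ) ≡ closure Γ (FVSub τ)
  ≈tm-supp (≈-var x) = refl
  ≈tm-supp (≈-sym p) = sym (≈tm-supp p)
  ≈tm-supp (≈-trans p q) = trans (≈tm-supp p) (≈tm-supp q)
  ≈tm-supp (≈-coh p q) = ≈sub-supp q
  ≈tm-supp (≈-rule r s) = R-supp r s
  ≈sub-supp ≈-⟨⟩ = refl
  ≈sub-supp {Γ = Γ} (≈-▸ p q) = closure-∪-cong {Γ = Γ} (≈sub-supp p) (≈tm-supp q)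

module CattOnly where
  open Typing Catt
  open RawTyping {R = Catt} public
  open SubstitutionLemma {R = Catt} (λ ()) public

  -- With no rule available, a derivation of equality can only rebuild the same syntax on both
  -- sides.
  ≈ty⇒≡  : ∀ {n} {Γ : Ctx n} {A B} → Γ ⊢ A ≈ty B → A ≡ B
  ≈tm⇒≡  : ∀ {n} {Γ : Ctx n} {s t} → Γ ⊢ s ≈tm t → s ≡ t
  ≈sub⇒≡ : ∀ {m n} {Γ : Ctx n} {σ τ : Sub m n} → Γ ⊢ σ ≈sub τ → σ ≡ τ
  ≈ty⇒≡ ≈-⋆ = refl
  ≈ty⇒≡ (≈-⟶ p q r) = ⟶-cong (≈tm⇒≡ p) (≈ty⇒≡ q) (≈tm⇒≡ r)
  ≈tm⇒≡ (≈-var x) = refl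
  ≈tm⇒≡ (≈-sym p) = sym (≈tm⇒≡ p)
  ≈tm⇒≡ (≈-trans p q) = trans (≈tm⇒≡ p) (≈tm⇒≡ q)
  ≈tm⇒≡ (≈-coh p q) = cong₂ (Coh _) (≈ty⇒≡ p) (≈sub⇒≡ q)
  ≈sub⇒≡ ≈-⟨⟩ = refl
  ≈sub⇒≡ (≈-▸ p q) = cong₂ ⟨_,_⟩ (≈sub⇒≡ p) (≈tm⇒≡ q)

  -- The variables in the type of a coherence already occur in its substitution; the closure is used
  -- for variables.
  FV-type⊆Supp : ∀ {n} {Γ : Ctx n} {t A} → Γ ⊢ t ∶ A → FVTy A ⊆ Supp Γ t
  FV-type⊆Supp {Γ = Γ} (tm-var x) = closure-closed {Γ = Γ} (closure-contains {Γ = Γ} (x∈⁅x⁆ x))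
  FV-type⊆Supp (tm-conv t p) rewrite sym (≈ty⇒≡ p) = FV-type⊆Supp t
  FV-type⊆Supp {Γ = Γ} (tm-coh {s = s} {A} {t} {σ = σ} ps a σ∶ reg) x∈ =
    let z , _ , x∈z = FVTy-[]⁻ (s ⟶[ A ] t) x∈ in closure-contains {Γ = Γ} (FVSub⁺ σ z x∈z)

  -- When the closure passes from `z` to a variable of its type, the entry there occurs in the type
  -- of the entry at `z`, and `FV-type⊆Supp` applies.
  Supp-[]⁺ : ∀ {m n} {Θ : Ctx m} {Γ : Ctx n} {σ t} → Γ ⊢sub σ ∶ Θ →
             ∀ {z} → z ∈ Supp Θ t → FVTm (entry σ z) ⊆ Supp Γ (t [ σ ]tm)
  Supp-[]⁺ {Θ = Θ} {Γ} {σ} {t} σ∶ = closure-ind Θ (FVTm t) (λ z → FVTm (entry σ z) ⊆ Supp Γ (t [ σ ]tm))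
    (λ z∈ x∈ → closure-contains {Γ = Γ} (FVTm-[]⁺ t z∈ x∈))
    (λ {z} {y} ih y∈ x∈ → closure-mono {Γ = Γ} {FVTm (entry σ z)} ih
      (FV-type⊆Supp (sub-entry σ∶ z) (FVTy-[]⁺ (lookup Θ z) y∈ x∈)))

-- Ps-contexts

infix 4 _▷_∶_

-- A ▷ y ∶ B: y, of type B, is an iterated target of the type A, so that
-- Γ ⊢ps x ∶ A yields Γ ⊢ps y ∶ B.
data _▷_∶_ {n} : Ty n → Fin n → Ty n → Set where
  here  : ∀ {s B y} → (s ⟶[ B ] var y) ▷ y ∶ B
  there : ∀ {s A z y B} → A ▷ y ∶ B → (s ⟶[ A ] var z) ▷ y ∶ B

▷-dim : ∀ {n} {A B : Ty n} {y} → A ▷ y ∶ B → dim B < dim A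
▷-dim here = ≤-refl
▷-dim (there d) = m<n⇒m<1+n (▷-dim d)

▷-wk : ∀ {n} {A B : Ty n} {y} → A ▷ y ∶ B → wkTy A ▷ suc y ∶ wkTy B
▷-wk here = here
▷-wk (there d) = there (▷-wk d)

▷-wk⁻ : ∀ {n} (A : Ty n) {B y} → wkTy A ▷ y ∶ B → ∃[ y′ ] ∃[ B′ ] (y ≡ suc y′ × B ≡ wkTy B′ × A ▷ y′ ∶ B′)
▷-wk⁻ (s ⟶[ A ] var z) here = z , A , refl , refl , here
▷-wk⁻ (s ⟶[ A ] var z) (there d) = let y , B , p , q , d′ = ▷-wk⁻ A d in y , B , p , q , there d′

ps-▷ : ∀ {n} {Γ : Ctx n} {x A y B} → Γ ⊢ps x ∶ A → A ▷ y ∶ B → Γ ⊢ps y ∶ B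
ps-▷ p here = psd p
ps-▷ p (there d) = ps-▷ (psd p) d

∂-▷ : ∀ {n} {Γ : Ctx n} {x A y B} i ε (p : Γ ⊢ps x ∶ A) (d : A ▷ y ∶ B) → ∂ i ε (ps-▷ p d) ≡ ∂ i ε p
∂-▷ i ε p here = refl
∂-▷ i ε p (there d) = ∂-▷ i ε (psd p) d

-- The second component strengthens the induction: `psd` moves to a target variable whose type must
-- already be known.
ps-lookup : ∀ {n} {Γ : Ctx n} {x A} → Γ ⊢ps x ∶ A → lookup Γ x ≡ A × (∀ {y B} → A ▷ y ∶ B → lookup Γ y ≡ B)
ps-lookup pss = refl , λ ()
ps-lookup (pse {Γ = Γ} {x} {A} p) = refl , desc
  where
  desc : ∀ {y B} → wkTy (var (suc x) ⟶[ wkTy A ] var zero) ▷ y ∶ B → _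
  desc here = refl
  desc (there d) with ▷-wk⁻ (wkTy A) d
  ... | _ , _ , refl , refl , d′ with ▷-wk⁻ A d′
  ...   | _ , _ , refl , refl , d″ = cong wkTy (cong wkTy (proj₂ (ps-lookup p) d″))
ps-lookup (psd p) = proj₂ (ps-lookup p) here , λ d → proj₂ (ps-lookup p) (there d)

-- `psd` can act only if the target is literally a variable; this records that all levels of a type
-- in a ps-judgement have that shape.
data VarTy {n} : Ty n → Set where
  ⋆   : VarTy ⋆
  arr : ∀ {x A y} → VarTy A → VarTy (var x ⟶[ A ] var y)

VarTy-wk : ∀ {n} {A : Ty n} → VarTy A → VarTy (wkTy A)
VarTy-wk ⋆ = ⋆
VarTy-wk (arr v) = arr (VarTy-wk v)

ps-VarTy : ∀ {n} {Γ : Ctx n} {x A} → Γ ⊢ps x ∶ A → VarTy A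
ps-VarTy pss = ⋆
ps-VarTy (pse p) = arr (VarTy-wk (VarTy-wk (ps-VarTy p)))
ps-VarTy (psd p) with ps-VarTy p
... | arr v = v

-- Descending by `psd` leaves all boundaries unchanged, so boundaries may be computed from a
-- derivation that stops at any dangling variable.
ps-close : ∀ {n} {Γ : Ctx n} {x A} (p : Γ ⊢ps x ∶ A) → Σ[ P ∈ PsContext Γ ] (∀ i ε → ∂ i ε (proj₂ P) ≡ ∂ i ε p)
ps-close p = go (ps-VarTy p) p
  where
  go : ∀ {n} {Γ : Ctx n} {x A} → VarTy A → (p : Γ ⊢ps x ∶ A) → Σ[ P ∈ PsContext Γ ] (∀ i ε → ∂ i ε (proj₂ P) ≡ ∂ i ε p)
  go ⋆ p = (_ , p) , λ i ε → refl
  go (arr v) p = go v (psd p)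

module _ where
  open Typing Catt
  open CattOnly

  ps-ctx : ∀ {n} {Γ : Ctx n} {x A} → Γ ⊢ps x ∶ A → Γ ⊢ctx
  ps-type : ∀ {n} {Γ : Ctx n} {x A} → Γ ⊢ps x ∶ A → Γ ⊢ty A
  ps-var : ∀ {n} {Γ : Ctx n} {x A} → Γ ⊢ps x ∶ A → Γ ⊢ var x ∶ A

  ps-ctx pss = ctx-▸ ctx-∅ ty-⋆
  ps-ctx (pse p) = ctx-▸ (ctx-▸ (ps-ctx p) (ps-type p))
                         (ty-⟶ (ty-wk (ps-type p)) (tm-wk (ps-var p)) (tm-var zero))
  ps-ctx (psd p) = ps-ctx p
  ps-type pss = ty-⋆
  ps-type (pse p) = ty-wk (ty-⟶ (ty-wk (ps-type p)) (tm-wk (ps-var p)) (tm-var zero))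
  ps-type (psd p) = arrow-base (ps-type p)
  ps-var p = retype (proj₁ (ps-lookup p)) (tm-var _)

-- Boundaries of ps-contexts

module _ {n} {Γ : Ctx n} {x A} (p : Γ ⊢ps x ∶ A) where
  ∂-< : ∀ {i} ε → i < dim A → ∂ i ε (pse p) ≡ outside ∷ outside ∷ ∂ i ε p
  ∂-< {i} ε h with <-cmp i (dim A)
  ∂-< ⁻ h | tri< _ _ _ = refl
  ∂-< ⁺ h | tri< _ _ _ = refl
  ... | tri≈ ¬h _ _ = ⊥-elim (¬h h)
  ... | tri> ¬h _ _ = ⊥-elim (¬h h)

  ∂-≡⁻ : ∂ (dim A) ⁻ (pse p) ≡ outside ∷ outside ∷ ∂ (dim A) ⁻ p
  ∂-≡⁻ with <-cmp (dim A) (dim A)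
  ... | tri< _ ¬e _ = ⊥-elim (¬e refl)
  ... | tri≈ _ _ _ = refl
  ... | tri> _ ¬e _ = ⊥-elim (¬e refl)

  ∂-≡⁺ : ∂ (dim A) ⁺ (pse p) ≡ outside ∷ inside ∷ (∂ (dim A) ⁺ p - x)
  ∂-≡⁺ with <-cmp (dim A) (dim A)
  ... | tri< _ ¬e _ = ⊥-elim (¬e refl)
  ... | tri≈ _ _ _ = refl
  ... | tri> _ ¬e _ = ⊥-elim (¬e refl)

  ∂-> : ∀ {i} ε → dim A < i → ∂ i ε (pse p) ≡ inside ∷ inside ∷ ∂ i ε p
  ∂-> {i} ε h with <-cmp i (dim A)
  ... | tri< _ _ ¬h = ⊥-elim (¬h h)
  ... | tri≈ _ _ ¬h = ⊥-elim (¬h h)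
  ∂-> ⁻ h | tri> _ _ _ = refl
  ∂-> ⁺ h | tri> _ _ _ = refl

∈-⊤ : ∀ {n} {V : Subset n} → (∀ x → x ∈ V) → V ≡ Subset.⊤
∈-⊤ h = ⊆-antisym ⊆⊤ (λ {x} _ → h x)

∂-full : ∀ {n} {Γ : Ctx n} {x A} i ε (p : Γ ⊢ps x ∶ A) → dimCtx Γ ≤ i → ∂ i ε p ≡ Subset.⊤
∂-full i ε pss h = refl
∂-full i ε (psd p) h = ∂-full i ε p h
∂-full i ε (pse {Γ = Γ} {A = A} p) h =
  trans (∂-> p ε (≤-trans (s≤s (≤-reflexive (sym (dim-wk A)))) (≤-trans (m≤n⊔m (dimCtx Γ ⊔ dim A) _) h)))
        (cong (λ V → inside ∷ inside ∷ V)
          (∂-full i ε p (≤-trans (m≤m⊔n (dimCtx Γ) (dim A)) (≤-trans (m≤m⊔n _ _) h))))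

∂-dim : ∀ {n} {Γ : Ctx n} {x A} i ε (p : Γ ⊢ps x ∶ A) {v} → v ∈ ∂ i ε p → dim (lookup Γ v) ≤ i
∂-dim i ε pss here = z≤n
∂-dim i ε (psd p) h = ∂-dim i ε p h
∂-dim i ε (pse {Γ = Γ} {x} {A} p) h with <-cmp i (dim A)
∂-dim i ⁻ (pse {Γ = Γ} {x} {A} p) (there (there h)) | tri< _ _ _ = ≤-trans (≤-reflexive (trans (dim-wk (wkTy _)) (dim-wk _))) (∂-dim i ⁻ p h)
∂-dim i ⁺ (pse {Γ = Γ} {x} {A} p) (there (there h)) | tri< _ _ _ = ≤-trans (≤-reflexive (trans (dim-wk (wkTy _)) (dim-wk _))) (∂-dim i ⁺ p h)
∂-dim i ⁻ (pse {Γ = Γ} {x} {A} p) (there (there h)) | tri≈ _ _ _ = ≤-trans (≤-reflexive (trans (dim-wk (wkTy _)) (dim-wk _))) (∂-dim i ⁻ p h)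
∂-dim i ⁺ (pse {Γ = Γ} {x} {A} p) (there here) | tri≈ _ refl _ = ≤-reflexive (trans (dim-wk (wkTy A)) (dim-wk A))
∂-dim i ⁺ (pse {Γ = Γ} {x} {A} p) (there (there h)) | tri≈ _ _ _ =
  ≤-trans (≤-reflexive (trans (dim-wk (wkTy _)) (dim-wk _))) (∂-dim i ⁺ p (p─q⊆p _ ⁅ x ⁆ h))
∂-dim i ⁻ (pse {Γ = Γ} {x} {A} p) here | tri> _ _ c = ≤-trans (s≤s (≤-reflexive (trans (dim-wk (wkTy A)) (dim-wk A)))) c
∂-dim i ⁻ (pse {Γ = Γ} {x} {A} p) (there here) | tri> _ _ c = ≤-trans (≤-reflexive (trans (dim-wk (wkTy A)) (dim-wk A))) (<⇒≤ c)
∂-dim i ⁻ (pse {Γ = Γ} {x} {A} p) (there (there h)) | tri> _ _ c = ≤-trans (≤-reflexive (trans (dim-wk (wkTy _)) (dim-wk _))) (∂-dim i ⁻ p h)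
∂-dim i ⁺ (pse {Γ = Γ} {x} {A} p) here | tri> _ _ c = ≤-trans (s≤s (≤-reflexive (trans (dim-wk (wkTy A)) (dim-wk A)))) c
∂-dim i ⁺ (pse {Γ = Γ} {x} {A} p) (there here) | tri> _ _ c = ≤-trans (≤-reflexive (trans (dim-wk (wkTy A)) (dim-wk A))) (<⇒≤ c)
∂-dim i ⁺ (pse {Γ = Γ} {x} {A} p) (there (there h)) | tri> _ _ c = ≤-trans (≤-reflexive (trans (dim-wk (wkTy _)) (dim-wk _))) (∂-dim i ⁺ p h)

-- The regular operation set puts no upper bound on its index; at `dimCtx Γ` both boundaries are the
-- whole context.
regular-full : ∀ {n} {Γ : Ctx n} → PsContext Γ → Regular Γ Subset.⊤ Subset.⊤
regular-full {Γ = Γ} (x , p) =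
  subst₂ (Regular Γ) (∂-full _ ⁻ p ≤-refl) (∂-full _ ⁺ p ≤-refl) (regular (x , p) (dimCtx Γ) (n≤1+n _))

-- Discs and identities

disc-ps : ∀ n → Disc n ⊢ps zero ∶ wkTy (U n)
disc-ps zero = pss
disc-ps (suc n) = pse (disc-ps n)

closure-⊤-mono : ∀ {n} (Γ : Ctx n) {V W} → closure Γ V ≡ Subset.⊤ → V ⊆ W → closure Γ W ≡ Subset.⊤
closure-⊤-mono Γ {V} e V⊆ = ∈-⊤ λ x →
  closure-mono {Γ = Γ} {V} (λ h → closure-contains {Γ = Γ} (V⊆ h)) (subst (x ∈_) (sym e) ∈⊤)

closure-U : ∀ n → closure (Sphere n) (FVTy (U n)) ≡ Subset.⊤
closure-U zero = refl
closure-U (suc n) rewrite FVTy-wk (wkTy (U n)) | FVTy-wk (U n) =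
  cong (λ V → inside ∷ inside ∷ V)
    (closure-⊤-mono (Sphere n) {FVTy (U n)} (closure-U n) (λ h → ∪⁺ʳ {V = (Subset.⊥ ∪ (FVTy (U n) ∪ Subset.⊥)) ∪ FVTy (U n)} h))

Supp-disc : ∀ n → Supp (Disc n) (var zero) ≡ Subset.⊤
Supp-disc n = cong (inside ∷_)
  (closure-⊤-mono (Sphere n) (closure-U n) (λ h → ∪⁺ʳ {V = Subset.⊥} h))

module _ {ℓ} {R : RuleSet ℓ} where
  open Typing R
  open RawTyping {R = R}

  sphereSub-typed : ∀ {n} {Γ : Ctx n} {A} → Γ ⊢ty A → Γ ⊢sub sphereSub A ∶ Sphere (dim A)
  sphereSub-typed ty-⋆ = sub-⟨⟩
  sphereSub-typed (ty-⟶ {A = A} a s t) =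
    sub-▸ (sub-▸ (sphereSub-typed a) (retype (sym (U-sphereSub A)) s))
          (retype (sym (trans (wkTy-⟨,⟩ (U (dim A))) (U-sphereSub A))) t)

  discSub-typed : ∀ {n} {Γ : Ctx n} {A t} → Γ ⊢ty A → Γ ⊢ t ∶ A → Γ ⊢sub discSub A t ∶ Disc (dim A)
  discSub-typed {A = A} a t = sub-▸ (sphereSub-typed a) (retype (sym (U-sphereSub A)) t)

  identity-typed : ∀ {n} {Γ : Ctx n} {A t} → Γ ⊢ty A → Γ ⊢ t ∶ A → Γ ⊢ identity A t ∶ t ⟶[ A ] t
  identity-typed {A = A} {t} a t∶ =
    retype (⟶-cong refl (U-discSub A t) refl)
      (tm-coh (proj₁ (ps-close (disc-ps (dim A)))) (embed-ty R (C.ty-⟶ (ps-type (disc-ps (dim A))) (C.tm-var zero) (C.tm-var zero)))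
        (discSub-typed a t∶)
        (subst (λ V → Regular (Disc (dim A)) V V) (sym (Supp-disc (dim A))) (regular-full (proj₁ (ps-close (disc-ps (dim A)))))))
    where module C = Typing Catt

-- dim (A [ σ ]ty) and dim A agree only propositionally, hence the two substitutions
-- are compared through an arbitrary function of the dimension and the substitution.
sphereSub-[] : ∀ {m n} {Z : Set} (A : Ty m) (σ : Sub m n) (f : ∀ k → Sub (k * 2) n → Z) →
               f (dim A) (sphereSub A • σ) ≡ f (dim (A [ σ ]ty)) (sphereSub (A [ σ ]ty))
sphereSub-[] ⋆ σ f = refl
sphereSub-[] (s ⟶[ A ] t) σ f =
  sphereSub-[] A σ (λ k υ → f (suc k) ⟨ ⟨ υ , s [ σ ]tm ⟩ , t [ σ ]tm ⟩)

identity-[] : ∀ {m n} (A : Ty m) t (σ : Sub m n) → identity A t [ σ ]tm ≡ identity (A [ σ ]ty) (t [ σ ]tm)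
identity-[] A t σ =
  sphereSub-[] A σ (λ k υ → Coh (Disc k) (var zero ⟶[ wkTy (U k) ] var zero) ⟨ υ , t [ σ ]tm ⟩)

identity-wk : ∀ {n} (A : Ty n) t → identity (wkTy A) (wkTm t) ≡ wkTm (identity A t)
identity-wk {n} A t = trans
  (cong₂ identity (sym (trans (wk-[]ty A (idSub n)) (cong wkTy ([id]ty A))))
                  (sym (trans (wk-[]tm t (idSub n)) (cong wkTm ([id]tm t)))))
  (trans (sym (identity-[] A t (wkSub (idSub n))))
    (trans (wk-[]tm (identity A t) (idSub n)) (cong wkTm ([id]tm (identity A t)))))

-- Evaluation in the globe

-- (k , ε) is the cell d_k^ε of the infinite globe; it bounds all cells of higher level.
Cell : Set
Cell = ℕ × Sign

level : Cell → ℕ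
level = proj₁

data _⊑_ : Cell → Cell → Set where
  lower : ∀ {j δ k ε} → j < k → (j , δ) ⊑ (k , ε)
  same  : ∀ {c} → c ⊑ c

⊑-trans : ∀ {a b c} → a ⊑ b → b ⊑ c → a ⊑ c
⊑-trans (lower p) (lower q) = lower (<-trans p q)
⊑-trans (lower p) same = lower p
⊑-trans same q = q

⊑-antisym : ∀ {a b} → a ⊑ b → b ⊑ a → a ≡ b
⊑-antisym same _ = refl
⊑-antisym (lower p) (lower q) = ⊥-elim (<-asym p q)
⊑-antisym (lower p) same = refl

⊑-same-level : ∀ {a b} → a ⊑ b → level b ≤ level a → a ≡ b
⊑-same-level (lower p) q = ⊥-elim (<⇒≱ p q)
⊑-same-level same _ = refl

-- The source or target of a cell in dimension `i`, where a cell of level at most `i` counts as an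
-- identity and is its own boundary.
trunc : ℕ → Sign → Cell → Cell
trunc i δ (k , ε) with k ≤? i
... | yes _ = k , ε
... | no  _ = i , δ

trunc-≤ : ∀ {i} δ c → level c ≤ i → trunc i δ c ≡ c
trunc-≤ {i} δ (k , ε) h with k ≤? i
... | yes _ = refl
... | no ¬h = ⊥-elim (¬h h)

trunc-> : ∀ {i} δ c → i < level c → trunc i δ c ≡ (i , δ)
trunc-> {i} δ (k , ε) h with k ≤? i
... | yes k≤ = ⊥-elim (<⇒≱ h k≤)
... | no _ = refl

trunc-⊑ : ∀ i δ c → trunc i δ c ⊑ c
trunc-⊑ i δ (k , ε) with k ≤? i
... | yes _ = same
... | no ¬h = lower (≰⇒> ¬h)

trunc-trunc : ∀ {i j} δ δ′ c → j < i → trunc j δ (trunc i δ′ c) ≡ trunc j δ c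
trunc-trunc {i} {j} δ δ′ (k , ε) j<i with k ≤? i
... | yes _ = refl
... | no ¬h = trans (trunc-> δ (i , δ′) j<i) (sym (trunc-> δ (k , ε) (<-trans j<i (≰⇒> ¬h))))

-- A valuation of the variables in the globe gives a set of variables the join
-- of its values; Val says that this join is a cell.
Val : ∀ {n} → (Fin n → Cell) → Subset n → Cell → Set
Val w V c = (∀ {v} → v ∈ V → w v ⊑ c) × ∃[ v ] (v ∈ V × w v ≡ c)

Val-unique : ∀ {n} {w : Fin n → Cell} {V c d} → Val w V c → Val w V d → c ≡ d
Val-unique (b , v , v∈ , refl) (b′ , v′ , v′∈ , refl) = ⊑-antisym (b′ v∈) (b v′∈)

Val-var : ∀ {n} {w : Fin n → Cell} x → Val w ⁅ x ⁆ (w x)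
Val-var {w = w} x = (λ h → subst (λ y → w y ⊑ w x) (sym (x∈⁅y⁆⇒x≡y x h)) same) , x , x∈⁅x⁆ x , refl

Bd : ∀ {n} → (Fin n → Cell) → Cell → Ty n → Set
Bd w c ⋆ = ⊤
Bd w c (s ⟶[ A ] t) =
  Val w (FVTm s) (trunc (dim A) ⁻ c) × Val w (FVTm t) (trunc (dim A) ⁺ c) × Bd w c A

Bd-cong : ∀ {n} {w : Fin n → Cell} {c d} A → (∀ j δ → j < dim A → trunc j δ c ≡ trunc j δ d) → Bd w c A → Bd w d A
Bd-cong ⋆ h b = tt
Bd-cong {w = w} (s ⟶[ A ] t) h (p , q , b) =
  subst (Val w (FVTm s)) (h (dim A) ⁻ ≤-refl) p , subst (Val w (FVTm t)) (h (dim A) ⁺ ≤-refl) q ,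
  Bd-cong A (λ j δ l → h j δ (m<n⇒m<1+n l)) b

Bd-⊑ : ∀ {n} {w : Fin n → Cell} {c} A {v} → Bd w c A → v ∈ FVTy A → w v ⊑ c
Bd-⊑ ⋆ b h = ⊥-elim (∉⊥ h)
Bd-⊑ {c = c} (s ⟶[ A ] t) (p , q , b) h with arrow⁻ s A t h
... | in-src h′ = ⊑-trans (proj₁ p h′) (trunc-⊑ (dim A) ⁻ c)
... | in-base h′ = Bd-⊑ A b h′
... | in-tgt h′ = ⊑-trans (proj₁ q h′) (trunc-⊑ (dim A) ⁺ c)

record Eval {n} (w : Fin n → Cell) (t : Tm n) (B : Ty n) : Set where
  constructor eval
  field
    cell  : Cell
    val   : Val w (FVTm t) cell
    bound : level cell ≤ dim B
    bd    : Bd w cell B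
open Eval public

-- Such a valuation plays the part of a substitution into the infinite globe that may send variables
-- to degenerate cells.
Good : ∀ {n} → (Fin n → Cell) → Ctx n → Set
Good w Γ = ∀ v → level (w v) ≤ dim (lookup Γ v) × Bd w (w v) (lookup Γ v)

module _ {m n} {σ : Sub m n} {w : Fin n → Cell} {w′ : Fin m → Cell}
         (h : ∀ z → Val w (FVTm (entry σ z)) (w′ z)) where

  Val-[] : ∀ t {c} → Val w′ (FVTm t) c → Val w (FVTm (t [ σ ]tm)) c
  Val-[] t (b , z , z∈ , e) =
    (λ x∈ → let z , z∈ , x∈z = FVTm-[]⁻ t x∈ in ⊑-trans (proj₁ (h z) x∈z) (b z∈)) ,
    let v , v∈ , e′ = proj₂ (h z) in v , FVTm-[]⁺ t z∈ v∈ , trans e′ e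

  Val-[]⁻ : ∀ t {c} → Val w (FVTm (t [ σ ]tm)) c → Val w′ (FVTm t) c
  Val-[]⁻ t (b , v , v∈ , e) = above ,
    let z , z∈ , v∈z = FVTm-[]⁻ t v∈ in
    z , z∈ , ⊑-antisym (above z∈) (subst (_⊑ w′ z) e (proj₁ (h z) v∈z))
    where
    above : ∀ {z} → z ∈ FVTm t → w′ z ⊑ _
    above {z} z∈ = let v , v∈ , e = proj₂ (h z) in subst (_⊑ _) e (b (FVTm-[]⁺ t z∈ v∈))

  Bd-[] : ∀ A {c} → Bd w′ c A → Bd w c (A [ σ ]ty)
  Bd-[] ⋆ b = tt
  Bd-[] (s ⟶[ A ] t) (p , q , b) rewrite dim-[] A σ = Val-[] s p , Val-[] t q , Bd-[] A b

  Bd-[]⁻ : ∀ A {c} → Bd w c (A [ σ ]ty) → Bd w′ c A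
  Bd-[]⁻ ⋆ b = tt
  Bd-[]⁻ (s ⟶[ A ] t) (p , q , b) rewrite dim-[] A σ = Val-[]⁻ s p , Val-[]⁻ t q , Bd-[]⁻ A b

Val-wk : ∀ {n} {w : Fin (suc n) → Cell} t {c} → Val w (FVTm (wkTm t)) c → Val (w ∘ suc) (FVTm t) c
Val-wk t (b , v , v∈ , e) rewrite FVTm-wk t with v∈
... | there v∈′ = (λ h → b (there h)) , _ , v∈′ , e

Val-wk⁺ : ∀ {n} {w : Fin (suc n) → Cell} t {c} → Val (w ∘ suc) (FVTm t) c → Val w (FVTm (wkTm t)) c
Val-wk⁺ t (b , v , v∈ , e) rewrite FVTm-wk t = (λ { (there h) → b h }) , suc v , there v∈ , e

Bd-wk : ∀ {n} {w : Fin (suc n) → Cell} A {c} → Bd w c (wkTy A) → Bd (w ∘ suc) c A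
Bd-wk ⋆ b = tt
Bd-wk (s ⟶[ A ] t) (p , q , b) rewrite dim-wk A = Val-wk s p , Val-wk t q , Bd-wk A b

Bd-wk⁺ : ∀ {n} {w : Fin (suc n) → Cell} A {c} → Bd (w ∘ suc) c A → Bd w c (wkTy A)
Bd-wk⁺ ⋆ b = tt
Bd-wk⁺ (s ⟶[ A ] t) (p , q , b) rewrite dim-wk A = Val-wk⁺ s p , Val-wk⁺ t q , Bd-wk⁺ A b

Good-tail : ∀ {n} {Γ : Ctx n} {A w} → Good w (Γ ▸ A) → Good (w ∘ suc) Γ
Good-tail {Γ = Γ} g v = let l , b = g (suc v) in
  ≤-trans l (≤-reflexive (dim-wk (lookup Γ v))) , Bd-wk (lookup Γ v) b

-- A good value bounds the values of all variables in its type, so passing from free variables to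
-- the support does not raise the join.
closure-⊑ : ∀ {n} {Γ : Ctx n} {w V} → Good w Γ → ∀ {v} → v ∈ closure Γ V → ∃[ u ] (u ∈ V × w v ⊑ w u)
closure-⊑ {Γ = Γ} {w} {V} g = closure-ind Γ V (λ v → ∃[ u ] (u ∈ V × w v ⊑ w u)) (λ {x} h → x , h , same)
  (λ {x} {y} (u , u∈ , l) y∈ → u , u∈ , ⊑-trans (Bd-⊑ (lookup Γ x) (proj₂ (g x)) y∈) l)

-- `total` is the composite of the pasting diagram in the globe. `boundary` says that the syntactic
-- boundary reaches the boundary of this composite; `dangling` and `targets` are the invariants with
-- which `pse` and `psd` continue.
record PsEval {n} {Γ : Ctx n} {x A} (p : Γ ⊢ps x ∶ A) (w : Fin n → Cell) : Set where
  field
    total    : Cell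
    below    : ∀ v → w v ⊑ total
    level≤   : level total ≤ dimCtx Γ
    dangling : w x ⊑ trunc (dim A) ⁺ total
    targets  : ∀ {y B} → A ▷ y ∶ B → w y ⊑ trunc (dim B) ⁺ total
    boundary : ∀ i δ → ∃[ v ] (v ∈ ∂ i δ p × trunc i δ total ⊑ w v)
open PsEval

trunc-mono : ∀ {i j} c → i ≤ j → trunc i ⁺ c ⊑ trunc j ⁺ c
trunc-mono {i} {j} c@(k , ε) i≤j with k ≤? i | k ≤? j
... | yes p | yes q = same
... | yes p | no ¬q = ⊥-elim (¬q (≤-trans p i≤j))
... | no ¬p | yes q = lower (≰⇒> ¬p)
... | no ¬p | no ¬q with m≤n⇒m<n∨m≡n i≤j
...   | inj₁ l = lower l
...   | inj₂ refl = same

data Order (i j : ℕ) : Set where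
  before : i < j → Order i j
  equal  : i ≡ j → Order i j
  after  : j < i → Order i j

order : ∀ i j → Order i j
order i j with <-cmp i j
... | tri< l _ _ = before l
... | tri≈ _ e _ = equal e
... | tri> _ _ l = after l

module _ {n} {Γ : Ctx n} {x A} (p : Γ ⊢ps x ∶ A) {w : Fin (2 + n) → Cell}
         (g : Good w (Γ ▸ A ▸ (var (suc x) ⟶[ wkTy A ] var zero)))
         (ih : PsEval p (λ v → w (suc (suc v)))) where
  private
    a = dim A
    e = w zero
    dd : dim (wkTy (wkTy A)) ≡ a
    dd = trans (dim-wk (wkTy A)) (dim-wk A)
    e≤ : level e ≤ suc a
    e≤ = subst (λ k → level e ≤ suc k) dd (proj₁ (g zero))
    src≡ : w (suc (suc x)) ≡ trunc a ⁻ e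
    src≡ = Val-unique {w = w} (Val-var (suc (suc x))) (subst (λ k → Val w ⁅ suc (suc x) ⁆ (trunc k ⁻ e)) dd (proj₁ (proj₂ (g zero))))
    tgt≡ : w (suc zero) ≡ trunc a ⁺ e
    tgt≡ = Val-unique {w = w} (Val-var (suc zero)) (subst (λ k → Val w ⁅ suc zero ⁆ (trunc k ⁺ e)) dd (proj₁ (proj₂ (proj₂ (g zero)))))
    c = total ih
    dimΓ≤ : dimCtx Γ ≤ dimCtx (Γ ▸ A ▸ (var (suc x) ⟶[ wkTy A ] var zero))
    dimΓ≤ = ≤-trans (m≤m⊔n (dimCtx Γ) a) (m≤m⊔n _ _)
    dims : suc a ≤ dimCtx (Γ ▸ A ▸ (var (suc x) ⟶[ wkTy A ] var zero))
    dims = ≤-trans (s≤s (≤-reflexive (sym (dim-wk A)))) (m≤n⊔m (dimCtx Γ ⊔ dim A) _)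

    -- Here `x`, `y` and the new arrow share one value, so the composite does not change.
    degenerate : level e ≤ a → PsEval (pse p) w
    degenerate l = record
      { total = c
      ; below = λ { zero → e⊑c ; (suc zero) → subst (_⊑ c) (sym y≡) e⊑c ; (suc (suc v)) → below ih v }
      ; level≤ = ≤-trans (level≤ ih) dimΓ≤
      ; dangling = ⊑-trans e⊑ (trunc-mono c (m≤n⇒m≤1+n (≤-reflexive (sym dd))))
      ; targets = tgts
      ; boundary = bdry
      }
      where
      x≡ : w (suc (suc x)) ≡ e
      x≡ = trans src≡ (trunc-≤ ⁻ e l)
      y≡ : w (suc zero) ≡ e
      y≡ = trans tgt≡ (trunc-≤ ⁺ e l)
      e⊑ : e ⊑ trunc a ⁺ c
      e⊑ = subst (_⊑ trunc a ⁺ c) x≡ (dangling ih)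
      e⊑c : e ⊑ c
      e⊑c = ⊑-trans e⊑ (trunc-⊑ a ⁺ c)
      tgts : ∀ {y B} → wkTy (var (suc x) ⟶[ wkTy A ] var zero) ▷ y ∶ B → w y ⊑ trunc (dim B) ⁺ c
      tgts here = subst₂ (λ u k → u ⊑ trunc k ⁺ c) (sym y≡) (sym dd) e⊑
      tgts (there d) with ▷-wk⁻ (wkTy A) d
      ... | _ , _ , refl , refl , d′ with ▷-wk⁻ A d′
      ...   | _ , B , refl , refl , d″ = subst (λ k → _ ⊑ trunc k ⁺ c) (sym (trans (dim-wk (wkTy B)) (dim-wk B))) (targets ih d″)
      bdry : ∀ i δ → ∃[ v ] (v ∈ ∂ i δ (pse p) × trunc i δ c ⊑ w v)
      bdry i δ with boundary ih i δ | order i a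
      ... | v , v∈ , q | before i<a = suc (suc v) , subst (_ ∈_) (sym (∂-< p δ i<a)) (there (there v∈)) , q
      ... | v , v∈ , q | after i>a = suc (suc v) , subst (_ ∈_) (sym (∂-> p δ i>a)) (there (there v∈)) , q
      bdry i ⁻ | v , v∈ , q | equal refl = suc (suc v) , subst (_ ∈_) (sym (∂-≡⁻ p)) (there (there v∈)) , q
      -- The positive boundary drops `x` in favour of `y`; as their values agree, a witness `x` can
      -- be exchanged for `y`.
      bdry i ⁺ | v , v∈ , q | equal refl with v Fin.≟ x
      ... | no v≢x = suc (suc v) , subst (_ ∈_) (sym (∂-≡⁺ p)) (there (there (x∈p∧x≢y⇒x∈p-y v∈ v≢x))) , q
      ... | yes refl = suc zero , subst (_ ∈_) (sym (∂-≡⁺ p)) (there here) , subst (_ ⊑_) (trans x≡ (sym y≡)) q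

    -- The new arrow dominates: everything before it collapses to its source `(a , ⁻)`, so the
    -- arrow's value is the new composite.
    nondegenerate : a < level e → PsEval (pse p) w
    nondegenerate l = record
      { total = e
      ; below = λ { zero → same ; (suc zero) → subst (_⊑ e) (sym y≡) (lower l)
                  ; (suc (suc v)) → ⊑-trans (subst (w (suc (suc v)) ⊑_) c≡ (below ih v)) (lower l) }
      ; level≤ = ≤-trans e≤ dims
      ; dangling = subst (e ⊑_) (sym (trunc-≤ ⁺ e (≤-trans e≤ (s≤s (≤-reflexive (sym dd)))))) same
      ; targets = tgts
      ; boundary = bdry
      }
      where
      x≡ : w (suc (suc x)) ≡ (a , ⁻)
      x≡ = trans src≡ (trunc-> ⁻ e l)
      y≡ : w (suc zero) ≡ (a , ⁺)
      y≡ = trans tgt≡ (trunc-> ⁺ e l)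
      x⊑ : (a , ⁻) ⊑ trunc a ⁺ c
      x⊑ = subst (_⊑ trunc a ⁺ c) x≡ (dangling ih)
      -- If `c` had level above `a`, its target in dimension `a` would be `(a , ⁺)`, which does not
      -- bound the value `(a , ⁻)` of `x`.
      c≡ : c ≡ (a , ⁻)
      c≡ with ≤-<-connex (level c) a
      ... | inj₁ c≤ = sym (⊑-same-level (subst ((a , ⁻) ⊑_) (trunc-≤ ⁺ c c≤) x⊑) c≤)
      ... | inj₂ c> with subst ((a , ⁻) ⊑_) (trunc-> ⁺ c c>) x⊑
      ...   | lower a<a = ⊥-elim (<-irrefl refl a<a)
      low : ∀ {i} δ → i < a → trunc i δ c ≡ trunc i δ e
      low δ i<a = trans (cong (trunc _ δ) c≡) (trans (trunc-> δ (a , ⁻) i<a) (sym (trunc-> δ e (<-trans i<a l))))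
      tgts : ∀ {y B} → wkTy (var (suc x) ⟶[ wkTy A ] var zero) ▷ y ∶ B → w y ⊑ trunc (dim B) ⁺ e
      tgts here = subst₂ (λ u k → u ⊑ trunc k ⁺ e) (sym y≡) (sym dd) (subst ((a , ⁺) ⊑_) (sym (trunc-> ⁺ e l)) same)
      tgts (there d) with ▷-wk⁻ (wkTy A) d
      ... | _ , _ , refl , refl , d′ with ▷-wk⁻ A d′
      ...   | _ , B , refl , refl , d″ =
        subst (λ k → _ ⊑ trunc k ⁺ e) (sym (trans (dim-wk (wkTy B)) (dim-wk B)))
          (subst (_ ⊑_) (low ⁺ (▷-dim d″)) (targets ih d″))
      bdry : ∀ i δ → ∃[ v ] (v ∈ ∂ i δ (pse p) × trunc i δ e ⊑ w v)
      bdry i δ with boundary ih i δ | order i a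
      ... | v , v∈ , q | before i<a = suc (suc v) , subst (_ ∈_) (sym (∂-< p δ i<a)) (there (there v∈)) , subst (_⊑ _) (low δ i<a) q
      ... | v , v∈ , q | after i>a = zero , subst (_ ∈_) (sym (∂-> p δ i>a)) here , trunc-⊑ i δ e
      bdry i ⁻ | v , v∈ , q | equal refl = suc (suc v) , subst (_ ∈_) (sym (∂-≡⁻ p)) (there (there v∈)) ,
        subst (_⊑ _) (trans (trunc-≤ ⁻ c (≤-reflexive (cong level c≡))) (trans c≡ (sym (trunc-> ⁻ e l)))) q
      bdry i ⁺ | v , v∈ , q | equal refl = suc zero , subst (_ ∈_) (sym (∂-≡⁺ p)) (there here) ,
        subst (trunc a ⁺ e ⊑_) (trans (trunc-> ⁺ e l) (sym y≡)) same

  psEval-pse : PsEval (pse p) w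
  psEval-pse with ≤-<-connex (level e) a
  ... | inj₁ l = degenerate l
  ... | inj₂ l = nondegenerate l

psEval : ∀ {n} {Γ : Ctx n} {x A} (p : Γ ⊢ps x ∶ A) {w} → Good w Γ → PsEval p w
psEval pss {w} g = record
  { total = w zero
  ; below = λ { zero → same }
  ; level≤ = proj₁ (g zero)
  ; dangling = subst (w zero ⊑_) (sym (trunc-≤ ⁺ (w zero) (proj₁ (g zero)))) same
  ; targets = λ ()
  ; boundary = λ i δ → zero , here , trunc-⊑ i δ (w zero)
  }
psEval (pse p) g = psEval-pse p g (psEval p (Good-tail (Good-tail g)))
psEval (psd p) g = record
  { total = total ih ; below = below ih ; level≤ = level≤ ih ; dangling = targets ih here
  ; targets = λ d → targets ih (there d) ; boundary = boundary ih }
  where ih = psEval p g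

-- Evaluation of coherences and terms

module _ where
  open Typing Catt
  open CattOnly

  private
    module Boundary {m} {Θ : Ctx m} {x} (p : Θ ⊢ps x ∶ ⋆) {w} (g : Good w Θ) {k}
                    (Θ≤ : dimCtx Θ ≤ suc k) where
      E = psEval p g
      c = total E

      c≤ : level c ≤ suc k
      c≤ = ≤-trans (level≤ E) Θ≤

      module _ {s A} (δ : Sign) (supp : Supp Θ s ≡ ∂ k δ p) (e : Eval w s A) where
        attained : ∃[ v ] (v ∈ FVTm s × w v ≡ cell e)
        attained = proj₂ (val e)

        cell≤k : level (cell e) ≤ k
        cell≤k with attained
        ... | v , v∈ , refl = ≤-trans (proj₁ (g v)) (∂-dim k δ p (subst (v ∈_) supp (closure-contains {Γ = Θ} v∈)))

        trunc⊑cell : trunc k δ c ⊑ cell e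
        trunc⊑cell with boundary E k δ
        ... | v , v∈ , l with closure-⊑ {Γ = Θ} g (subst (v ∈_) (sym supp) v∈)
        ...   | u , u∈ , l′ = ⊑-trans l (⊑-trans l′ (proj₁ (val e) u∈))

        cell⊑c : cell e ⊑ c
        cell⊑c with attained
        ... | v , v∈ , refl = below E v

        -- The support of `s` contains a variable reaching the boundary of `c`, which bounds its
        -- value from below. From above the value is bounded by `c` and by the dimension `k` of
        -- boundary variables, of which the relevant one depends on whether `c` rises above level
        -- `k`.
        cell≡ : cell e ≡ trunc k δ c
        cell≡ with ≤-<-connex (level c) k
        ... | inj₁ l = ⊑-antisym (subst (cell e ⊑_) (sym (trunc-≤ δ c l)) cell⊑c) trunc⊑cell
        ... | inj₂ l = sym (⊑-same-level trunc⊑cell (subst (λ u → level (cell e) ≤ level u) (sym (trunc-> δ c l)) cell≤k))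

    -- If the boundary cells s and t had dimension above k, their common source would
    -- evaluate to both (k , ⁻) and (k , ⁺).
    too-high : ∀ {m} {w : Fin m → Cell} {k} A → k < dim A → Bd w (k , ⁻) A → Bd w (k , ⁺) A → ⊥
    too-high {w = w} {k} (s ⟶[ A ] t) (s≤s k≤) (p , _) (q , _)
      with Val-unique {w = w} (subst (Val w (FVTm s)) (trunc-≤ ⁻ _ k≤) p) (subst (Val w (FVTm s)) (trunc-≤ ⁻ _ k≤) q)
    ... | ()

  -- The index `k` of the regular triple need not be `dim A`. If the composite has level above `k`,
  -- the values of `s` and `t` are `(k , ⁻)` and `(k , ⁺)`, which forces `k` to equal `dim A`;
  -- otherwise truncation at either dimension leaves the composite alone.
  eval-cell : ∀ {m} {Θ : Ctx m} {w s A t} → Good w Θ → Regular Θ (Supp Θ s) (Supp Θ t) → Eval w s A → Eval w t A →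
              Σ[ c ∈ Cell ] ((∀ v → w v ⊑ c) × (∃[ v ] w v ≡ c) × level c ≤ suc (dim A) × Bd w c (s ⟶[ A ] t))
  eval-cell {Θ = Θ} {w} {s} {A} {t} g reg es et = go reg refl refl
    where
    go : ∀ {V W} → Regular Θ V W → Supp Θ s ≡ V → Supp Θ t ≡ W →
         Σ[ c ∈ Cell ] ((∀ v → w v ⊑ c) × (∃[ v ] w v ≡ c) × level c ≤ suc (dim A) × Bd w c (s ⟶[ A ] t))
    go (regular (x , p) k Θ≤) eqs eqt = c , below E , att , c≤′ ,
        subst (Val w (FVTm s)) (same-trunc ⁻ eqs es) (val es) ,
        subst (Val w (FVTm t)) (same-trunc ⁺ eqt et) (val et) ,
        Bd-cong A (λ j δ j< → trans (cong (trunc j δ) (same-trunc ⁻ eqs es)) (trunc-trunc δ ⁻ c j<)) (bd es)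
      where
      open Boundary p g Θ≤
      s≡ = cell≡ ⁻ eqs es
      t≡ = cell≡ ⁺ eqt et
      att : ∃[ v ] w v ≡ c
      -- At index `suc k` truncation does nothing to `c`, so `boundary` yields a variable that
      -- attains `c` itself.
      att = let v , v∈ , l = boundary E (suc k) ⁺ in
        v , ⊑-antisym (below E v) (subst (_⊑ w v) (trunc-≤ ⁺ c c≤) l)
      k≤A : k < level c → k ≤ dim A
      k≤A l = subst (_≤ dim A) (cong level (trans s≡ (trunc-> ⁻ c l))) (bound es)
      k≮A : k < level c → ¬ k < dim A
      k≮A l h = too-high A h (subst (λ u → Bd w u A) (trans s≡ (trunc-> ⁻ c l)) (bd es))
                             (subst (λ u → Bd w u A) (trans t≡ (trunc-> ⁺ c l)) (bd et))
      low : level c ≤ k → level c ≤ dim A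
      low l = subst (_≤ dim A) (cong level (trans s≡ (trunc-≤ ⁻ c l))) (bound es)
      c≤′ : level c ≤ suc (dim A)
      c≤′ with ≤-<-connex (level c) k
      ... | inj₂ l = ≤-trans c≤ (s≤s (k≤A l))
      ... | inj₁ l = m≤n⇒m≤1+n (low l)
      same-trunc : ∀ δ {r} → Supp Θ r ≡ ∂ k δ p → (e : Eval w r A) → cell e ≡ trunc (dim A) δ c
      same-trunc δ eq e with ≤-<-connex (level c) k
      ... | inj₂ l = trans (cell≡ δ eq e) (cong (λ i → trunc i δ c) (≤-antisym (k≤A l) (≮⇒≥ (k≮A l))))
      ... | inj₁ l = trans (cell≡ δ eq e) (trans (trunc-≤ δ c l) (sym (trunc-≤ δ c (low l))))

  -- The statement ranges over all good valuations because a coherence evaluates its source and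
  -- target in its own context, under the valuation induced by `σ`.
  eval-tm  : ∀ {n} {Γ : Ctx n} {t A w} → Γ ⊢ t ∶ A → Good w Γ → Eval w t A
  eval-sub : ∀ {m n} {Γ : Ctx n} {Θ : Ctx m} {σ w} → Γ ⊢sub σ ∶ Θ → Good w Γ → ∀ z → Eval w (entry σ z) (lookup Θ z [ σ ]ty)
  eval-tm {w = w} (tm-var x) g = eval (w x) (Val-var x) (proj₁ (g x)) (proj₂ (g x))
  eval-tm {w = w} (tm-conv t p) g = subst (Eval w _) (≈ty⇒≡ p) (eval-tm t g)
  eval-tm {w = w} (tm-coh {Δ = Θ} {s = s} {A} {t} {σ} ps (ty-⟶ a s∶ t∶) σ∶ reg) g =
    eval c
      ((λ v∈ → let z , v∈z = FVSub⁻ σ v∈ in ⊑-trans (proj₁ (vals z) v∈z) (b z)) ,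
       (let v , v∈ , eq = proj₂ (vals z₀) in v , FVSub⁺ σ z₀ v∈ , trans eq eq₀))
      (≤-trans c≤ (≤-reflexive (cong suc (sym (dim-[] A σ)))))
      (Bd-[] vals (s ⟶[ A ] t) bd′)
    where
    es = eval-sub σ∶ g
    w′ : _ → Cell
    w′ z = cell (es z)
    vals : ∀ z → Val w (FVTm (entry σ z)) (w′ z)
    vals z = val (es z)
    g′ : Good w′ Θ
    g′ z = ≤-trans (bound (es z)) (≤-reflexive (dim-[] (lookup Θ z) σ)) , Bd-[]⁻ vals (lookup Θ z) (bd (es z))
    r = eval-cell g′ reg (eval-tm s∶ g′) (eval-tm t∶ g′)
    c = proj₁ r
    b = proj₁ (proj₂ r)
    z₀ = proj₁ (proj₁ (proj₂ (proj₂ r)))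
    eq₀ = proj₂ (proj₁ (proj₂ (proj₂ r)))
    c≤ = proj₁ (proj₂ (proj₂ (proj₂ r)))
    bd′ = proj₂ (proj₂ (proj₂ (proj₂ r)))
  eval-sub {w = w} (sub-▸ {A = A} h t) g zero = subst (Eval w _) (sym (wkTy-⟨,⟩ A)) (eval-tm t g)
  eval-sub {Θ = Θ ▸ _} {w = w} (sub-▸ h t) g (suc z) = subst (Eval w _) (sym (wkTy-⟨,⟩ (lookup Θ z))) (eval-sub h g z)

-- Projecting a ps-context to a globe

-- A map from the infinite globe to the disc of dimension `d`: all cells of level at least `d`,
-- including `(d , ⁺)`, become its top cell `(d , ⁻)`.
collapse : ℕ → Cell → Cell
collapse d (k , ε) with k <? d
... | yes _ = k , ε
... | no _ = d , ⁻

collapse-< : ∀ {d} c → level c < d → collapse d c ≡ c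
collapse-< {d} (k , ε) h with k <? d
... | yes _ = refl
... | no ¬h = ⊥-elim (¬h h)

collapse-≥ : ∀ {d} c → d ≤ level c → collapse d c ≡ (d , ⁻)
collapse-≥ {d} (k , ε) h with k <? d
... | yes h′ = ⊥-elim (<⇒≱ h′ h)
... | no _ = refl

collapse-mono : ∀ {d a b} → a ⊑ b → collapse d a ⊑ collapse d b
collapse-mono same = same
collapse-mono {d} (lower {j} {δ} {k} {ε} j<k) with <-≤-connex k d | <-≤-connex j d
... | inj₁ k<d | _ = subst₂ _⊑_ (sym (collapse-< (j , δ) (<-trans j<k k<d))) (sym (collapse-< (k , ε) k<d)) (lower j<k)
... | inj₂ d≤k | inj₁ j<d = subst₂ _⊑_ (sym (collapse-< (j , δ) j<d)) (sym (collapse-≥ (k , ε) d≤k)) (lower j<d)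
... | inj₂ d≤k | inj₂ d≤j = subst₂ _⊑_ (sym (collapse-≥ (j , δ) d≤j)) (sym (collapse-≥ (k , ε) d≤k)) same

collapse-trunc : ∀ d j δ c → collapse d (trunc j δ c) ≡ trunc j δ (collapse d c)
collapse-trunc d j δ c with <-≤-connex (level c) d | ≤-<-connex (level c) j
... | inj₁ c<d | inj₁ c≤j = trans (cong (collapse d) (trunc-≤ δ c c≤j)) (trans (collapse-< c c<d)
  (sym (trans (cong (trunc j δ) (collapse-< c c<d)) (trunc-≤ δ c c≤j))))
... | inj₁ c<d | inj₂ j<c = trans (cong (collapse d) (trunc-> δ c j<c)) (trans (collapse-< (j , δ) (<-trans j<c c<d))
  (sym (trans (cong (trunc j δ) (collapse-< c c<d)) (trunc-> δ c j<c))))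
... | inj₂ d≤c | inj₁ c≤j = trans (cong (collapse d) (trunc-≤ δ c c≤j)) (trans (collapse-≥ c d≤c)
  (sym (trans (cong (trunc j δ) (collapse-≥ c d≤c)) (trunc-≤ δ (d , ⁻) (≤-trans d≤c c≤j)))))
... | inj₂ d≤c | inj₂ j<c with <-≤-connex j d
...   | inj₁ j<d = trans (cong (collapse d) (trunc-> δ c j<c)) (trans (collapse-< (j , δ) j<d)
  (sym (trans (cong (trunc j δ) (collapse-≥ c d≤c)) (trunc-> δ (d , ⁻) j<d))))
...   | inj₂ d≤j = trans (cong (collapse d) (trunc-> δ c j<c)) (trans (collapse-≥ (j , δ) d≤j)
  (sym (trans (cong (trunc j δ) (collapse-≥ c d≤c)) (trunc-≤ δ (d , ⁻) d≤j))))

collapse-level : ∀ d c → level (collapse d c) ≤ level c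
collapse-level d c with <-≤-connex (level c) d
... | inj₁ c<d = ≤-reflexive (cong level (collapse-< c c<d))
... | inj₂ d≤c = ≤-trans (≤-reflexive (cong level (collapse-≥ c d≤c))) d≤c

collapse-level′ : ∀ d c → level (collapse d c) ≤ d
collapse-level′ d c with <-≤-connex (level c) d
... | inj₁ c<d = ≤-trans (≤-reflexive (cong level (collapse-< c c<d))) (<⇒≤ c<d)
... | inj₂ d≤c = ≤-reflexive (cong level (collapse-≥ c d≤c))

Val-collapse : ∀ {n} d {w : Fin n → Cell} {V c} → Val w V c → Val (collapse d ∘ w) V (collapse d c)
Val-collapse d (b , v , v∈ , e) = (λ h → collapse-mono (b h)) , v , v∈ , cong (collapse d) e

Bd-collapse : ∀ {n} d {w : Fin n → Cell} {c} A → Bd w c A → Bd (collapse d ∘ w) (collapse d c) A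
Bd-collapse d ⋆ b = tt
Bd-collapse d {w} {c} (s ⟶[ A ] t) (p , q , b) =
  subst (Val _ (FVTm s)) (collapse-trunc d (dim A) ⁻ c) (Val-collapse d {w} p) ,
  subst (Val _ (FVTm t)) (collapse-trunc d (dim A) ⁺ c) (Val-collapse d {w} q) , Bd-collapse d A b

-- The sign `⁻` in `top` leaves room for the next pair: `x` can serve as the source of a new top
-- cell whose target is `(dim A , ⁺)`.
record Projection {n} {Γ : Ctx n} {x A} (p : Γ ⊢ps x ∶ A) : Set where
  field
    value  : Fin n → Cell
    good   : Good value Γ
    top    : value x ≡ (dim A , ⁻)
    levels : ∀ v → level (value v) ≤ dim A
open Projection

module _ {n} {Γ : Ctx n} {x A} (p : Γ ⊢ps x ∶ A) (P : Projection p) where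
  private
    w : Fin (2 + n) → Cell
    w zero = suc (dim A) , ⁻
    w (suc zero) = dim A , ⁺
    w (suc (suc v)) = value P v

    dd : dim (wkTy (wkTy A)) ≡ dim A
    dd = trans (dim-wk (wkTy A)) (dim-wk A)

    bdx : Bd (value P) (dim A , ⁻) A
    bdx = subst₂ (Bd (value P)) (top P) (proj₁ (ps-lookup p)) (proj₂ (good P x))

    bdA : ∀ c → dim A ≤ level c → Bd w c (wkTy (wkTy A))
    bdA c h = Bd-wk⁺ {w = w} (wkTy A) (Bd-wk⁺ {w = w ∘ suc} A (Bd-cong A
      (λ j δ j< → trans (trunc-> δ (dim A , ⁻) j<) (sym (trunc-> δ c (≤-trans j< h)))) bdx))

    w-good : Good w (Γ ▸ A ▸ (var (suc x) ⟶[ wkTy A ] var zero))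
    w-good zero = s≤s (≤-reflexive (sym dd)) ,
      subst (Val w ⁅ suc (suc x) ⁆) (trans (top P) (sym (trans (cong (λ k → trunc k ⁻ (suc (dim A) , ⁻)) dd) (trunc-> ⁻ (suc (dim A) , ⁻) ≤-refl)))) (Val-var {w = w} (suc (suc x))) ,
      subst (Val w ⁅ suc zero ⁆) (sym (trans (cong (λ k → trunc k ⁺ (suc (dim A) , ⁻)) dd) (trunc-> ⁺ (suc (dim A) , ⁻) ≤-refl))) (Val-var {w = w} (suc zero)) ,
      bdA _ (n≤1+n _)
    w-good (suc zero) = ≤-reflexive (sym dd) , bdA _ ≤-refl
    w-good (suc (suc v)) = ≤-trans (proj₁ (good P v)) (≤-reflexive (sym (trans (dim-wk (wkTy _)) (dim-wk _)))) ,
      Bd-wk⁺ {w = w} (wkTy (lookup Γ v)) (Bd-wk⁺ {w = w ∘ suc} (lookup Γ v) (proj₂ (good P v)))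

  projection-pse : Projection (pse p)
  projection-pse = record
    { value = w ; good = w-good ; top = cong (λ k → suc k , ⁻) (sym dd)
    ; levels = λ { zero → s≤s (≤-reflexive (sym dd)) ; (suc zero) → m≤n⇒m≤1+n (≤-reflexive (sym dd))
                 ; (suc (suc v)) → ≤-trans (levels P v) (m≤n⇒m≤1+n (≤-reflexive (sym dd))) } }

  -- The value of t is a cell above both (d , ⁻) and (d , ⁺), and only the new top
  -- variable reaches above level d.
  no-parallel-pair : ∀ {t B} → Typing._⊢_∶_ Catt (Γ ▸ A ▸ (var (suc x) ⟶[ wkTy A ] var zero)) t B →
    let U = Supp (Γ ▸ A ▸ (var (suc x) ⟶[ wkTy A ] var zero)) t in
    suc (suc x) ∈ U → suc zero ∈ U → zero ∈ U
  no-parallel-pair {t} t∶ x∈ y∈ = closure-contains {Γ = Δ} (found (proj₂ (val ev)))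
    where

    Δ = Γ ▸ A ▸ (var (suc x) ⟶[ wkTy A ] var zero)
    ev = eval-tm t∶ w-good
    under : ∀ {v} → v ∈ Supp Δ t → w v ⊑ cell ev
    under h = let u , u∈ , l = closure-⊑ {Γ = Δ} w-good h in ⊑-trans l (proj₁ (val ev) u∈)
    high : dim A < level (cell ev)
    high with cell ev | subst (_⊑ cell ev) (top P) (under x∈) | under y∈
    ... | _ | lower l | _ = l
    ... | _ | same | lower l = l
    found : ∃[ v ] (v ∈ FVTm t × w v ≡ cell ev) → zero ∈ FVTm t
    found (zero , v∈ , e) = v∈
    found (suc zero , v∈ , e) = ⊥-elim (<-irrefl refl (subst (λ c → dim A < level c) (sym e) high))
    found (suc (suc v) , v∈ , e) = ⊥-elim (<⇒≱ (subst (λ c → dim A < level c) (sym e) high) (levels P v))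

projection : ∀ {n} {Γ : Ctx n} {x A} (p : Γ ⊢ps x ∶ A) → Projection p
projection pss = record { value = λ _ → 0 , ⁻ ; good = λ { zero → z≤n , tt } ; top = refl ; levels = λ _ → z≤n }
projection (pse p) = projection-pse p (projection p)
projection (psd {Γ = Γ} {x = x} {s} {A} {y} p) = record
  -- The projection for `p` gives `y` the value `(d , ⁺)`; collapsing turns it into the required
  -- `(d , ⁻)` and removes the level above.
  { value = collapse d ∘ value P
  ; good = λ v → ≤-trans (collapse-level d (value P v)) (proj₁ (good P v)) , Bd-collapse d (lookup Γ v) (proj₂ (good P v))
  ; top = trans (cong (collapse d) y≡) (collapse-≥ (d , ⁺) ≤-refl)
  ; levels = λ v → collapse-level′ d (value P v)
  }
  where
  P = projection p
  d = dim A
  y≡ : value P y ≡ (d , ⁺)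
  y≡ = trans (Val-unique {w = value P} (Val-var y)
         (proj₁ (proj₂ (subst₂ (Bd (value P)) (top P) (proj₁ (ps-lookup p)) (proj₂ (good P x))))))
         (trunc-> ⁺ (suc d , ⁻) ≤-refl)

-- Supports in ps-contexts

ren-wk : ∀ {m n} (f : Fin m → Fin n) → ren (suc ∘ f) ≡ wkSub (ren f)
ren-wk f = sub-ext λ x → trans (entry-ren (suc ∘ f) x) (sym (trans (entry-wk (ren f) x) (cong wkTm (entry-ren f x))))

ren-wk² : ∀ {m n} (A : Ty m) (f : Fin m → Fin n) → A [ ren (λ x → suc (suc (f x))) ]ty ≡ wkTy (wkTy (A [ ren f ]ty))
ren-wk² A f = trans (cong (A [_]ty) (trans (ren-wk (suc ∘ f)) (cong wkSub (ren-wk f))))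
  (trans (wk-[]ty A (wkSub (ren f))) (cong wkTy (wk-[]ty A (ren f))))

-- Earlier variables have larger indices. This order is what shows in `x₀-maximal` that nothing
-- below `x` can mention `x`.
lookup-earlier : ∀ {n} (Γ : Ctx n) x {y} → y ∈ FVTy (lookup Γ x) → x Fin.< y
lookup-earlier (Γ ▸ A) zero {zero} h = ⊥-elim (zero∉wkTy A h)
lookup-earlier (Γ ▸ A) zero {suc y} h = s≤s z≤n
lookup-earlier (Γ ▸ A) (suc x) {zero} h = ⊥-elim (zero∉wkTy (lookup Γ x) h)
lookup-earlier (Γ ▸ A) (suc x) {suc y} h = s≤s (lookup-earlier Γ x (wk∈ty⁻ (lookup Γ x) h))

module _ where
  open Typing Catt
  open CattOnly

  Lift : ∀ {m n} → Ctx m → (Fin m → Fin n) → Fin n → Ty n → Set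
  Lift Θ ι y B = ∃[ y₀ ] ∃[ B₀ ] (Θ ⊢ps y₀ ∶ B₀ × ι y₀ ≡ y × B₀ [ ren ι ]ty ≡ B)

  Lift-▷ : ∀ {m n} {Θ : Ctx m} {ι : Fin m → Fin n} {x A y B} → Lift Θ ι x A → A ▷ y ∶ B → Lift Θ ι y B
  Lift-▷ (x₀ , A₀ , p₀ , _ , e) d with ps-VarTy p₀
  Lift-▷ (x₀ , _ , p₀ , _ , ()) here | ⋆
  Lift-▷ (x₀ , _ , p₀ , _ , ()) (there d) | ⋆
  Lift-▷ {ι = ι} (x₀ , _ , p₀ , _ , refl) d | arr {y = y₀} v rewrite entry-ren ι y₀ with d
  ... | here = y₀ , _ , psd p₀ , refl , refl
  ... | there d′ = Lift-▷ (y₀ , _ , psd p₀ , refl , refl) d′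

  -- A subset U of the variables of Γ is presented as a ps-context Θ: ι embeds Θ in Γ
  -- with image U, and ρ is a retraction of ι by substitutions.
  record SubPs {n} {Γ : Ctx n} {x A} (p : Γ ⊢ps x ∶ A) (U : Subset n) : Set where
    field
      {size′}   : ℕ
      Θ         : Ctx size′
      Θ-ps      : PsContext Θ
      ι         : Fin size′ → Fin n
      ρ         : Sub n size′
      ι-lookup  : ∀ z → lookup Θ z [ ren ι ]ty ≡ lookup Γ (ι z)
      ρ-typed   : Θ ⊢sub ρ ∶ Γ
      ι-ρ       : ∀ z → entry ρ (ι z) ≡ var z
      image     : ∀ z → ι z ∈ U
      onto      : ∀ {v} → v ∈ U → ∃[ z ] ι z ≡ v
      -- This field and the next carry the induction: they locate in `Θ` the variable at which the
      -- following `pse` or `psd` acts.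
      dangling  : x ∈ U → Lift Θ ι x A
      targets   : ∀ {y B} → A ▷ y ∶ B → y ∈ U → Lift Θ ι y B

    ι-typed : Γ ⊢sub ren ι ∶ Θ
    ι-typed = sub-intro λ z →
      subst₂ (Γ ⊢_∶_) (sym (entry-ren ι z)) (sym (ι-lookup z)) (tm-var (ι z))

    ι-•-ρ : ren ι • ρ ≡ idSub size′
    ι-•-ρ = sub-ext λ z → trans (entry-• (ren ι) ρ z)
      (trans (cong (_[ ρ ]tm) (entry-ren ι z)) (trans (ι-ρ z) (sym (entry-id z))))

    ι-injective : ∀ {z z′} → ι z ≡ ι z′ → z ≡ z′
    ι-injective {z} {z′} e = var-injective (trans (sym (ι-ρ z)) (trans (cong (entry ρ) e) (ι-ρ z′)))

    retract-lift : ∀ {A A₀} → A₀ [ ren ι ]ty ≡ A → A [ ρ ]ty ≡ A₀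
    retract-lift {A₀ = A₀} refl = trans (assoc-ty A₀ (ren ι) ρ) (trans (cong (A₀ [_]ty) ι-•-ρ) ([id]ty A₀))

    restrict-entry : ∀ {v} → v ∈ U → entry (ρ • ren ι) v ≡ entry (idSub n) v
    restrict-entry v∈ with onto v∈
    ... | z , refl = trans (entry-• ρ (ren ι) (ι z)) (trans (cong (_[ ren ι ]tm) (ι-ρ z))
      (trans (entry-ren ι z) (sym (entry-id (ι z)))))

    restrict-tm : ∀ {t} → FVTm t ⊆ U → t [ ρ ]tm [ ren ι ]tm ≡ t
    restrict-tm {t} h = trans (assoc-tm t ρ (ren ι)) (trans (agree-tm t (λ x∈ → restrict-entry (h x∈))) ([id]tm t))

    restrict-ty : ∀ {A} → FVTy A ⊆ U → A [ ρ ]ty [ ren ι ]ty ≡ A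
    restrict-ty {A} h = trans (assoc-ty A ρ (ren ι)) (trans (agree-ty A (λ x∈ → restrict-entry (h x∈))) ([id]ty A))

  open SubPs

  -- Contracts the last pair by making `f` an identity, as `π` does at a peak. It keeps a term
  -- well-typed while shortening the ps-context, which allows induction.
  retraction : ∀ {n} → Ty n → Fin n → Sub (suc (suc n)) n
  retraction {n} A x = ⟨ ⟨ idSub n , var x ⟩ , identity A (var x) ⟩

  retraction-typed : ∀ {n} {Γ : Ctx n} {x A} → Γ ⊢ps x ∶ A →
                     Γ ⊢sub retraction A x ∶ Γ ▸ A ▸ (var (suc x) ⟶[ wkTy A ] var zero)
  retraction-typed {x = x} {A} p = sub-▸ (sub-▸ idSub-typed (retype (sym ([id]ty A)) (ps-var p)))
    (retype (⟶-cong (sym (entry-id x)) (sym (trans (wkTy-⟨,⟩ A) ([id]ty A))) refl)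
      (identity-typed (ps-type p) (ps-var p)))

  module _ {n} {Γ : Ctx n} {x A} (p : Γ ⊢ps x ∶ A) {t B}
           (t∶ : Γ ▸ A ▸ (var (suc x) ⟶[ wkTy A ] var zero) ⊢ t ∶ B)
           (S : SubPs p (Supp Γ (t [ retraction A x ]tm))) where
    private
      Δ = Γ ▸ A ▸ (var (suc x) ⟶[ wkTy A ] var zero)
      Uᵗ = Supp Δ t
      V = Supp Γ (t [ retraction A x ]tm)

      x∈A→ : zero ∈ Uᵗ → suc zero ∈ Uᵗ
      x∈A→ h = closure-closed {Γ = Δ} h
        (arrow⁺ (var (suc (suc x))) (wkTy (wkTy A)) (var (suc zero)) (in-tgt (x∈⁅x⁆ (suc zero))))

      f⇒x : zero ∈ Uᵗ → suc (suc x) ∈ Uᵗ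
      f⇒x h = closure-closed {Γ = Δ} h
        (arrow⁺ (var (suc (suc x))) (wkTy (wkTy A)) (var (suc zero)) (in-src (x∈⁅x⁆ (suc (suc x)))))

      old : ∀ {v} → suc (suc v) ∈ Uᵗ → v ∈ V
      old {v} h = Supp-[]⁺ {t = t} (retraction-typed p) h (subst (λ s → v ∈ FVTm s) (sym (entry-id v)) (x∈⁅x⁆ v))

      new : suc zero ∈ Uᵗ → x ∈ V
      new h = Supp-[]⁺ {t = t} (retraction-typed p) h (x∈⁅x⁆ x)

      up : ∀ {v y} → suc (suc v) ∈ Uᵗ → y ∈ FVTy (lookup Γ v) → suc (suc y) ∈ Uᵗ
      up {v} h y∈ = closure-closed {Γ = Δ} h (wk∈ty (wkTy (lookup Γ v)) (wk∈ty (lookup Γ v) y∈))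

      -- All that the retraction can add to a support is `x` together with what its type requires,
      -- and only when `y` was present, since `f` brings `y` with it.
      back : ∀ {v} → v ∈ V → suc (suc v) ∈ Uᵗ ⊎ (suc zero ∈ Uᵗ × v ∈ closure Γ ⁅ x ⁆)
      back = closure-ind Γ (FVTm (t [ retraction A x ]tm))
        (λ v → suc (suc v) ∈ Uᵗ ⊎ (suc zero ∈ Uᵗ × v ∈ closure Γ ⁅ x ⁆)) base′
        (λ { (inj₁ h) y∈ → inj₁ (up h y∈) ; (inj₂ (y , h)) y∈ → inj₂ (y , closure-closed {Γ = Γ} h y∈) })
        where
        base′ : ∀ {v} → v ∈ FVTm (t [ retraction A x ]tm) → suc (suc v) ∈ Uᵗ ⊎ (suc zero ∈ Uᵗ × v ∈ closure Γ ⁅ x ⁆)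
        base′ {v} h with FVTm-[]⁻ t h
        ... | zero , z∈ , v∈ = inj₂ (x∈A→ (closure-contains {Γ = Δ} z∈) ,
              closure-closed-disc v∈)
          where
          closure-closed-disc : v ∈ FVSub (discSub A (var x)) → v ∈ closure Γ ⁅ x ⁆
          closure-closed-disc h′ with ∪⁻ {V = FVSub (sphereSub A)} h′
          ... | inj₂ h″ = closure-contains {Γ = Γ} h″
          ... | inj₁ h″ = closure-closed {Γ = Γ} (closure-contains {Γ = Γ} (x∈⁅x⁆ x))
                (subst (λ C → v ∈ FVTy C) (sym (proj₁ (ps-lookup p))) (sphere A h″))
            where
            sphere : ∀ C → v ∈ FVSub (sphereSub C) → v ∈ FVTy C
            sphere ⋆ k = k
            sphere (s ⟶[ C ] u) k with ∪⁻ {V = FVSub (sphereSub C) ∪ FVTm s} k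
            ... | inj₂ k′ = arrow⁺ s C u (in-tgt k′)
            ... | inj₁ k′ with ∪⁻ {V = FVSub (sphereSub C)} k′
            ...   | inj₂ k″ = arrow⁺ s C u (in-src k″)
            ...   | inj₁ k″ = arrow⁺ s C u (in-base (sphere C k″))
        ... | suc zero , z∈ , v∈ with refl ← x∈⁅y⁆⇒x≡y x v∈ =
              inj₂ (closure-contains {Γ = Δ} z∈ , closure-contains {Γ = Γ} (x∈⁅x⁆ x))
        ... | suc (suc z) , z∈ , v∈ with refl ← x∈⁅y⁆⇒x≡y z (subst (λ s → v ∈ FVTm s) (entry-id z) v∈) =
              inj₁ (closure-contains {Γ = Δ} z∈)

      retract-old : ∀ v → entry (retraction A x • ρ S) (suc (suc v)) ≡ entry (ρ S) v
      retract-old v = trans (entry-• (idSub n) (ρ S) v) (cong (_[ ρ S ]tm) (entry-id v))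

      -- Without `y` there is no `f` either, so contraction changes nothing in the support.
      omit : suc zero ∉ Uᵗ → SubPs (pse p) Uᵗ
      omit y∉ = record
        { Θ = Θ S ; Θ-ps = Θ-ps S ; ι = λ z → suc (suc (ι S z)) ; ρ = retraction A x • ρ S
        ; ι-lookup = λ z → trans (ren-wk² (lookup (Θ S) z) (ι S)) (cong (λ C → wkTy (wkTy C)) (ι-lookup S z))
        ; ρ-typed = sub-• (retraction-typed p) (ρ-typed S)
        ; ι-ρ = λ z → trans (retract-old (ι S z)) (ι-ρ S z)
        ; image = λ z → [ (λ h → h) , (λ h → ⊥-elim (y∉ (proj₁ h))) ]′ (back (image S z))
        ; onto = λ { {zero} h → ⊥-elim (y∉ (x∈A→ h)) ; {suc zero} h → ⊥-elim (y∉ h)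
                   ; {suc (suc v)} h → let z , e = onto S (old h) in z , cong (λ u → suc (suc u)) e }
        ; dangling = λ h → ⊥-elim (y∉ (x∈A→ h))
        ; targets = tgts
        }
        where
        tgts : ∀ {y C} → wkTy (var (suc x) ⟶[ wkTy A ] var zero) ▷ y ∶ C → y ∈ Uᵗ →
               ∃[ y₀ ] ∃[ C₀ ] (Θ S ⊢ps y₀ ∶ C₀ × suc (suc (ι S y₀)) ≡ y × C₀ [ ren (λ z → suc (suc (ι S z))) ]ty ≡ C)
        tgts here h = ⊥-elim (y∉ h)
        tgts (there d) h with ▷-wk⁻ (wkTy A) d
        ... | _ , _ , refl , refl , d′ with ▷-wk⁻ A d′
        ...   | y , C , refl , refl , d″ = let y₀ , C₀ , p₀ , e , e′ = targets S d″ (old h) in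
          y₀ , C₀ , p₀ , cong (λ u → suc (suc u)) e , trans (ren-wk² C₀ (ι S)) (cong (λ D → wkTy (wkTy D)) e′)

      -- The arrow `f` brings `x` and `y` along, so the same pair is attached to the smaller
      -- ps-context at the variable lying over `x`.
      extend : zero ∈ Uᵗ → SubPs (pse p) Uᵗ
      extend f∈ with dangling S (old (f⇒x f∈))
      ... | x₀ , A₀ , p₀ , ex , eA = record
        { Θ = Θ′ ; Θ-ps = proj₁ (ps-close (pse p₀)) ; ι = ι′ ; ρ = ρ′
        ; ι-lookup = λ { zero → trans (wkTy-⟨,⟩ (var (suc x₀) ⟶[ wkTy A₀ ] var zero))
                            (⟶-cong (trans (entry-ren _ x₀) ex²) (trans (wkTy-⟨,⟩ A₀) eA²) refl)
                       ; (suc zero) → trans (wkTy-⟨,⟩ (wkTy A₀)) (trans (wkTy-⟨,⟩ A₀) eA²)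
                       ; (suc (suc z)) → trans (wkTy-⟨,⟩ (wkTy (lookup (Θ S) z))) (trans (wkTy-⟨,⟩ (lookup (Θ S) z))
                            (trans (ren-wk² (lookup (Θ S) z) (ι S)) (cong (λ C → wkTy (wkTy C)) (ι-lookup S z)))) }
        ; ρ-typed = sub-▸ (sub-▸ (sub-wk (sub-wk (ρ-typed S))) (retype (sym Aρ) (tm-var (suc zero))))
            (retype (⟶-cong (sym (trans (cong (entry (wkSub (wkSub (ρ S)))) (sym ex)) (entry-ρ x₀))) (sym (trans (wkTy-⟨,⟩ A) Aρ)) refl) (tm-var zero))
        ; ι-ρ = λ { zero → refl ; (suc zero) → refl
                  ; (suc (suc z)) → entry-ρ z }
        ; image = λ { zero → f∈ ; (suc zero) → x∈A→ f∈ ; (suc (suc z)) → img z }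
        ; onto = λ { {zero} h → zero , refl ; {suc zero} h → suc zero , refl
                   ; {suc (suc v)} h → let z , e = onto S (old h) in suc (suc z) , cong (λ u → suc (suc u)) e }
        ; dangling = λ _ → lift-f
        ; targets = λ d _ → Lift-▷ lift-f d
        }
        where
        Θ′ = Θ S ▸ A₀ ▸ (var (suc x₀) ⟶[ wkTy A₀ ] var zero)
        ι′ : Fin (suc (suc (size′ S))) → Fin (suc (suc n))
        ι′ zero = zero
        ι′ (suc zero) = suc zero
        ι′ (suc (suc z)) = suc (suc (ι S z))
        ρ′ = ⟨ ⟨ wkSub (wkSub (ρ S)) , var (suc zero) ⟩ , var zero ⟩
        ex² : var (suc (suc (ι S x₀))) ≡ var (suc (suc x))
        ex² = cong (λ v → var (suc (suc v))) ex
        eA² : A₀ [ ren (λ z → suc (suc (ι S z))) ]ty ≡ wkTy (wkTy A)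
        eA² = trans (ren-wk² A₀ (ι S)) (cong (λ C → wkTy (wkTy C)) eA)
        Aρ : A [ wkSub (wkSub (ρ S)) ]ty ≡ wkTy (wkTy A₀)
        Aρ = trans (wk-[]ty A (wkSub (ρ S))) (cong wkTy (trans (wk-[]ty A (ρ S)) (cong wkTy (retract-lift S {A} eA))))
        entry-ρ : ∀ z → entry (wkSub (wkSub (ρ S))) (ι S z) ≡ var (suc (suc z))
        entry-ρ z = trans (entry-wk (wkSub (ρ S)) (ι S z)) (cong wkTm (trans (entry-wk (ρ S) (ι S z)) (cong wkTm (ι-ρ S z))))
        img : ∀ z → suc (suc (ι S z)) ∈ Uᵗ
        img z with back (image S z)
        ... | inj₁ h = h
        ... | inj₂ (_ , h) = closure-ind Γ ⁅ x ⁆ (λ v → suc (suc v) ∈ Uᵗ)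
          (λ v∈ → subst (λ v → suc (suc v) ∈ Uᵗ) (sym (x∈⁅y⁆⇒x≡y x v∈)) (f⇒x f∈)) up h
        lift-f : Lift Θ′ ι′ zero (wkTy (var (suc x) ⟶[ wkTy A ] var zero))
        lift-f = zero , _ , pse p₀ , refl , trans (wkTy-⟨,⟩ (var (suc x₀) ⟶[ wkTy A₀ ] var zero))
                            (⟶-cong (trans (entry-ren _ x₀) ex²) (trans (wkTy-⟨,⟩ A₀) eA²) refl)

      -- By `no-parallel-pair` the support avoids `x`. The ps-context of the contraction therefore
      -- keeps its shape, and its variable over `x` is made to lie over `y`.
      replace : suc zero ∈ Uᵗ → zero ∉ Uᵗ → SubPs (pse p) Uᵗ
      replace y∈ f∉ with dangling S (new y∈)
      ... | x₀ , A₀ , p₀ , ex , eA = record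
        { Θ = Θ S ; Θ-ps = Θ-ps S ; ι = ι′ ; ρ = retraction A x • ρ S
        ; ι-lookup = lookup′
        ; ρ-typed = sub-• (retraction-typed p) (ρ-typed S)
        ; ι-ρ = retract′
        ; image = image′
        ; onto = λ { {zero} h → ⊥-elim (f∉ h) ; {suc zero} h → x₀ , ι′-x₀
                   ; {suc (suc v)} h → let z , e = onto S (old h) in
                       z , trans (ι′-old z (λ { refl → x∉ (subst (λ u → suc (suc u) ∈ Uᵗ) (trans (sym e) ex) h) })) (cong (λ u → suc (suc u)) e) }
        ; dangling = λ h → ⊥-elim (f∉ h)
        ; targets = λ d _ → tgts d
        }
        where
        x∉ : suc (suc x) ∉ Uᵗ
        x∉ h = f∉ (no-parallel-pair p (projection p) t∶ h y∈)
        ι′ : Fin (size′ S) → Fin (suc (suc n))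
        ι′ z with z Fin.≟ x₀
        ... | yes _ = suc zero
        ... | no _ = suc (suc (ι S z))
        ι′-x₀ : ι′ x₀ ≡ suc zero
        ι′-x₀ with x₀ Fin.≟ x₀
        ... | yes _ = refl
        ... | no ≢ = ⊥-elim (≢ refl)
        ι′-old : ∀ z → z ≢ x₀ → ι′ z ≡ suc (suc (ι S z))
        ι′-old z ≢ with z Fin.≟ x₀
        ... | yes e = ⊥-elim (≢ e)
        ... | no _ = refl
        -- A type mentioning `x₀` belongs over a variable whose type mentions `x`. If that variable
        -- is in the support of `t`, then so is `x`, which is excluded; otherwise it is `x` or
        -- earlier than `x` and cannot mention `x`.
        x₀-maximal : ∀ z → x₀ ∉ FVTy (lookup (Θ S) z)
        x₀-maximal z h with back (image S z) | subst (λ C → ι S x₀ ∈ FVTy C) (ι-lookup S z)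
            (FVTy-[]⁺ (lookup (Θ S) z) h (subst (λ s → ι S x₀ ∈ FVTm s) (sym (entry-ren (ι S) x₀)) (x∈⁅x⁆ (ι S x₀))))
        ... | inj₁ h′ | x∈ = x∉ (subst (λ u → suc (suc u) ∈ Uᵗ) ex (up h′ x∈))
        ... | inj₂ (_ , h′) | x∈ = <⇒≱ (subst (ι S z Fin.<_) ex (lookup-earlier Γ (ι S z) x∈))
          (closure-ind Γ ⁅ x ⁆ (λ v → x Fin.≤ v) (λ v∈ → ≤-reflexive (cong Fin.toℕ (sym (x∈⁅y⁆⇒x≡y x v∈))))
            (λ {v} l y∈ → ≤-trans l (<⇒≤ (lookup-earlier Γ v y∈))) h′)
        type-ι′ : ∀ z → lookup (Θ S) z [ ren ι′ ]ty ≡ wkTy (wkTy (lookup Γ (ι S z)))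
        type-ι′ z = trans
          (agree-ty (lookup (Θ S) z) (λ {u} u∈ → trans (entry-ren ι′ u)
            (trans (cong var (ι′-old u (λ { refl → x₀-maximal z u∈ }))) (sym (entry-ren _ u)))))
          (trans (ren-wk² (lookup (Θ S) z) (ι S)) (cong (λ C → wkTy (wkTy C)) (ι-lookup S z)))
        ιx₀-type : lookup Γ (ι S x₀) ≡ A
        ιx₀-type = trans (cong (lookup Γ) ex) (proj₁ (ps-lookup p))
        lookup′ : ∀ z → lookup (Θ S) z [ ren ι′ ]ty ≡ lookup Δ (ι′ z)
        lookup′ z with z Fin.≟ x₀
        ... | yes refl = trans (type-ι′ z) (cong (λ C → wkTy (wkTy C)) ιx₀-type)
        ... | no _ = type-ι′ z
        retract′ : ∀ z → entry (retraction A x • ρ S) (ι′ z) ≡ var z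
        retract′ z with z Fin.≟ x₀
        ... | yes refl = trans (cong (entry (ρ S)) (sym ex)) (ι-ρ S z)
        ... | no _ = trans (retract-old (ι S z)) (ι-ρ S z)
        image′ : ∀ z → ι′ z ∈ Uᵗ
        image′ z with z Fin.≟ x₀
        ... | yes _ = y∈
        ... | no z≢ = [ (λ h → h) , (λ h → [ (λ e → ⊥-elim (z≢ (ι-injective S (trans e (sym ex))))) , (λ h′ → h′) ]′
            (closure-ind Γ ⁅ x ⁆ (λ v → v ≡ x ⊎ suc (suc v) ∈ Uᵗ) (λ v∈ → inj₁ (x∈⁅y⁆⇒x≡y x v∈))
              (λ { (inj₁ refl) u∈ → inj₂ (closure-closed {Γ = Δ} y∈
                     (wk∈ty (wkTy A) (wk∈ty A (subst (λ C → _ ∈ FVTy C) (proj₁ (ps-lookup p)) u∈))))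
                 ; (inj₂ h) u∈ → inj₂ (up h u∈) }) (proj₂ h))) ]′ (back (image S z))
        tgts : ∀ {y C} → wkTy (var (suc x) ⟶[ wkTy A ] var zero) ▷ y ∶ C → Lift (Θ S) ι′ y C
        tgts d with lift-y
          where
          lift-y : Lift (Θ S) ι′ (suc zero) (wkTy (wkTy A))
          lift-y = x₀ , lookup (Θ S) x₀ , subst (Θ S ⊢ps x₀ ∶_) (sym (proj₁ (ps-lookup p₀))) p₀ , ι′-x₀ ,
            trans (type-ι′ x₀) (cong (λ C → wkTy (wkTy C)) ιx₀-type)
        tgts here | l = l
        tgts (there d) | l = Lift-▷ l d

    subPs-pse : SubPs (pse p) Uᵗ
    subPs-pse with zero ∈? Uᵗ | suc zero ∈? Uᵗ
    ... | yes f∈ | _ = extend f∈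
    ... | no f∉ | yes y∈ = replace y∈ f∉
    ... | no _ | no y∉ = omit y∉

  subPs-Supp : ∀ {n} {Γ : Ctx n} {x A} (p : Γ ⊢ps x ∶ A) {t B} → Γ ⊢ t ∶ B → SubPs p (Supp Γ t)
  -- Over a point, evaluation serves to show that the term mentions the only variable.
  subPs-Supp pss {t} t∶ with val (eval-tm {w = λ _ → 0 , ⁻} t∶ λ { zero → z≤n , tt })
  ... | _ , zero , h , _ = record
    { Θ = ∅ ▸ ⋆ ; Θ-ps = zero , pss ; ι = λ z → z ; ρ = idSub 1 ; ι-lookup = λ { zero → refl }
    ; ρ-typed = idSub-typed ; ι-ρ = entry-id ; image = λ { zero → closure-contains {Γ = ∅ ▸ ⋆} h }
    ; onto = λ {v} _ → v , refl ; dangling = λ _ → zero , ⋆ , pss , refl , refl ; targets = λ () }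
  subPs-Supp (pse p) t∶ = subPs-pse p t∶ (subPs-Supp p (tm-[] t∶ (retraction-typed p)))
  subPs-Supp (psd p) t∶ = record
    { Θ = Θ S ; Θ-ps = Θ-ps S ; ι = ι S ; ρ = ρ S ; ι-lookup = ι-lookup S ; ρ-typed = ρ-typed S
    ; ι-ρ = ι-ρ S ; image = image S ; onto = onto S
    ; dangling = targets S here ; targets = λ d → targets S (there d) }
    where S = subPs-Supp p t∶

-- Coherences between equal terms

module _ where
  open Typing Catt
  open CattOnly

  type-typed : ∀ {n} {Γ : Ctx n} {t A} → Γ ⊢ctx → Γ ⊢ t ∶ A → Γ ⊢ty A
  type-typed c (tm-var x) = lookup-typed c x
  type-typed {Γ = Γ} c (tm-conv t p) = subst (Γ ⊢ty_) (≈ty⇒≡ p) (type-typed c t)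
  type-typed c (tm-coh ps a σ reg) = ty-[] a σ

module _ {ℓ} {R : RuleSet ℓ} (R-sub : SubstitutionCondition R) (R-supp : SupportCondition R)
         (R-endo : EndoCoherenceRemoval R) where
  private
    module C = Typing Catt
    module CO = CattOnly
  open Typing R
  open RawTyping {R = R}
  open SubstitutionLemma {R = R} R-sub

  -- Both terms are pulled back to the ps-context carried by their common support,
  -- where the coherence between them has full boundary.
  connecting-coherence : ∀ {n} {Δ : Ctx n} {s t A} → PsContext Δ → Δ C.⊢ s ∶ A → Δ C.⊢ t ∶ A → Δ ⊢ s ≈tm t →
    ∃[ φ ] (Δ C.⊢ φ ∶ s ⟶[ A ] t × Δ ⊢ φ ≈tm identity A t)
  connecting-coherence {Δ = Δ} {s} {t} {A} (x , p) s∶ t∶ s≈t =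
      Coh Θ (s [ ρ ]tm ⟶[ A [ ρ ]ty ] t [ ρ ]tm) (ren ι)
    , CO.retype (⟶-cong (restrict-tm s⊆) (restrict-ty A⊆) (restrict-tm t⊆))
        (C.tm-coh Θ-ps (C.ty-⟶ A∶ (CO.tm-[] s∶ ρ-typed) (CO.tm-[] t∶ ρ-typed)) ι-typed
          (subst₂ (Regular Θ) (sym (full s supp)) (sym (full t refl)) (regular-full Θ-ps)))
    -- In R the pulled-back source may be replaced by the pulled-back target, which turns the
    -- coherence into an endo-coherence.
    , ≈-trans (≈-coh (≈-⟶ (≈tm-[] s≈t (embed-sub R ρ-typed)) (≈ty-refl _) (≈tm-refl _)) (≈sub-refl _))
        (≈-trans (R-endo Θ-ps (embed-ty R A∶) (embed-tm R (CO.tm-[] t∶ ρ-typed)) (full t refl) (embed-sub R ι-typed))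
          (≈tm-reflexive (cong₂ identity (restrict-ty A⊆) (restrict-tm t⊆))))
    where
    open SubPs (subPs-Supp p t∶)
    supp : Supp Δ s ≡ Supp Δ t
    supp = ≈tm-supp R-supp s≈t
    A∶ = CO.ty-[] (type-typed (ps-ctx p) t∶) ρ-typed
    t⊆ : FVTm t ⊆ Supp Δ t
    t⊆ = closure-contains {Γ = Δ}
    s⊆ : FVTm s ⊆ Supp Δ t
    s⊆ {y} h = subst (y ∈_) supp (closure-contains {Γ = Δ} h)
    A⊆ : FVTy A ⊆ Supp Δ t
    A⊆ = CO.FV-type⊆Supp t∶
    full : ∀ u → Supp Δ u ≡ Supp Δ t → Supp Θ (u [ ρ ]tm) ≡ Subset.⊤
    full u e = ∈-⊤ λ z → CO.Supp-[]⁺ {t = u} ρ-typed (subst (ι z ∈_) (sym e) (image z))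
      (subst (λ v → z ∈ FVTm v) (sym (ι-ρ z)) (x∈⁅x⁆ z))

-- Dyck words

ups : ∀ j {d} → Dyck d → Dyck (j + d)
ups zero W = W
ups (suc j) W = ups j W ⇑

downs : ∀ j {d} → Dyck (j + d) → Dyck d
downs zero W = W
downs (suc j) W = downs j (W ⇓)

mountain : ∀ k → Dyck k
mountain zero = ⊖
mountain (suc k) = mountain k ⇑

-- Sizes of Dyck words often agree only propositionally; comparing the whole
-- packages at once avoids transports.
Package : Set
Package = Σ[ n ∈ ℕ ] Ctx n × Ty n × Tm n

package : ∀ {d} → Dyck d → Package
package W = size W , ⌊ W ⌋ , dyckTy W , dyckTm W

discPackage : ℕ → Package
discPackage n = suc (n * 2) , Disc n , wkTy (U n) , var zero

raise : Package → Package
raise (n , Γ , A , s) = suc (suc n) , (Γ ▸ A ▸ (wkTm s ⟶[ wkTy A ] var zero)) , wkTy (wkTm s ⟶[ wkTy A ] var zero) , var zero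

package-mountain : ∀ k → package (mountain k) ≡ discPackage k
package-mountain zero = refl
package-mountain (suc k) = cong raise (package-mountain k)

base-≡ : ∀ {n d} {A : Ty n} (e : dim A ≡ suc d) {s B t} → A ≡ s ⟶[ B ] t → base A e ≡ B
base-≡ e refl = refl

tgt-≡ : ∀ {n d} {A : Ty n} (e : dim A ≡ suc d) {s B t} → A ≡ s ⟶[ B ] t → tgt A e ≡ t
tgt-≡ e refl = refl

-- Descents leave the context alone; counting dimensions shows that exactly `suc j` of them lead to
-- the iterated target `y`, and rules out the remaining cases.
package-downs : ∀ j {d} (W : Dyck (suc j + d)) {A y B} → dyckTy W ≡ A → A ▷ y ∶ B → dim B ≡ d →
                package (downs (suc j) W) ≡ (size W , ⌊ W ⌋ , B , var y)
package-downs zero W e here _ = cong₂ (λ B t → size W , ⌊ W ⌋ , B , t) (base-≡ (dim-dyckTy W) e) (tgt-≡ (dim-dyckTy W) e)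
package-downs zero W e (there d) e′ =
  ⊥-elim (<-irrefl (trans e′ (suc-injective (trans (sym (dim-dyckTy W)) (cong dim e)))) (▷-dim d))
package-downs (suc j) W e here e′ =
  ⊥-elim (m≢1+n+m _ (trans (sym e′) (suc-injective (trans (sym (cong dim e)) (dim-dyckTy W)))))
package-downs (suc j) W e (there d) e′ = package-downs j (W ⇓) (base-≡ (dim-dyckTy W) e) d e′

-- Whiskering data

infixl 5 _∷⟨_,_⟩

-- Iterated boundary pairs, the outermost pair last.
data Cells (n : ℕ) : ℕ → Set where
  []      : Cells n 0
  _∷⟨_,_⟩ : ∀ {i} → Cells n i → Tm n → Tm n → Cells n (suc i)

∷-cong : ∀ {n i} {cs cs′ : Cells n i} {s s′ t t′} → cs ≡ cs′ → s ≡ s′ → t ≡ t′ → cs ∷⟨ s , t ⟩ ≡ cs′ ∷⟨ s′ , t′ ⟩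
∷-cong refl refl refl = refl

over : ∀ {n i} → Ty n → Cells n i → Ty n
over A [] = A
over A (cs ∷⟨ s , t ⟩) = s ⟶[ over A cs ] t

wkCells : ∀ {n i} → Cells n i → Cells (suc n) i
wkCells [] = []
wkCells (cs ∷⟨ s , t ⟩) = wkCells cs ∷⟨ wkTm s , wkTm t ⟩

_[_]cells : ∀ {m n i} → Cells m i → Sub m n → Cells n i
[] [ σ ]cells = []
(cs ∷⟨ s , t ⟩) [ σ ]cells = cs [ σ ]cells ∷⟨ s [ σ ]tm , t [ σ ]tm ⟩

infixl 8 _[_]cells

wkCells-⟨,⟩ : ∀ {m n i} (cs : Cells m i) {σ : Sub m n} {u} → wkCells cs [ ⟨ σ , u ⟩ ]cells ≡ cs [ σ ]cells
wkCells-⟨,⟩ [] = refl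
wkCells-⟨,⟩ (cs ∷⟨ s , t ⟩) = ∷-cong (wkCells-⟨,⟩ cs) (wkTm-⟨,⟩ s) (wkTm-⟨,⟩ t)

wk-[]cells : ∀ {m n i} (cs : Cells m i) (σ : Sub m n) → cs [ wkSub σ ]cells ≡ wkCells (cs [ σ ]cells)
wk-[]cells [] σ = refl
wk-[]cells (cs ∷⟨ s , t ⟩) σ = ∷-cong (wk-[]cells cs σ) (wk-[]tm s σ) (wk-[]tm t σ)

over-wk : ∀ {n i} (A : Ty n) (cs : Cells n i) → over (wkTy A) (wkCells cs) ≡ wkTy (over A cs)
over-wk A [] = refl
over-wk A (cs ∷⟨ s , t ⟩) = ⟶-cong refl (over-wk A cs) refl

module Whisker (k : ℕ) where

  E : Dyck k
  E = mountain k

  -- A (k+1)-cell is followed by an (i+1+k)-cell; the word lacks the last ⇑.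
  V : ∀ i → Dyck (i + k)
  V i = ups i (E ⇑ ⇓)

  -- The substitution γ carries a k-cell p′; φ : p′ → p is the first whisker and p → q
  -- the base of the cell to be whiskered.
  record Frame (n : ℕ) : Set where
    constructor frame
    field
      γ   : Sub (size E) n
      p φ q : Tm n
  open Frame public

  record Data (n : ℕ) : Set where
    constructor mkData
    field
      fr   : Frame n
      q′ ψ : Tm n
  open Data public

  wkFrame : ∀ {n} → Frame n → Frame (suc n)
  wkFrame (frame γ p φ q) = frame (wkSub γ) (wkTm p) (wkTm φ) (wkTm q)

  _[_]frame : ∀ {m n} → Frame m → Sub m n → Frame n
  frame γ p φ q [ σ ]frame = frame (γ • σ) (p [ σ ]tm) (φ [ σ ]tm) (q [ σ ]tm)

  _[_]data : ∀ {m n} → Data m → Sub m n → Data n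
  mkData f q ψ [ σ ]data = mkData (f [ σ ]frame) (q [ σ ]tm) (ψ [ σ ]tm)

  frame-cong : ∀ {n} {γ γ′ : Sub (size E) n} {p p′ φ φ′ q q′} → γ ≡ γ′ → p ≡ p′ → φ ≡ φ′ → q ≡ q′ →
               frame γ p φ q ≡ frame γ′ p′ φ′ q′
  frame-cong refl refl refl refl = refl

  data-cong : ∀ {n} {f f′ : Frame n} {q q′ ψ ψ′} → f ≡ f′ → q ≡ q′ → ψ ≡ ψ′ → mkData f q ψ ≡ mkData f′ q′ ψ′
  data-cong refl refl refl = refl

  wkFrame-⟨,⟩ : ∀ {m n} (f : Frame m) {σ : Sub m n} {u} → wkFrame f [ ⟨ σ , u ⟩ ]frame ≡ f [ σ ]frame
  wkFrame-⟨,⟩ (frame γ p φ q) = frame-cong (wkSub-⟨,⟩ γ) (wkTm-⟨,⟩ p) (wkTm-⟨,⟩ φ) (wkTm-⟨,⟩ q)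

  wk-[]frame : ∀ {m n} (f : Frame m) (σ : Sub m n) → f [ wkSub σ ]frame ≡ wkFrame (f [ σ ]frame)
  wk-[]frame (frame γ p φ q) σ = frame-cong (wk-• γ σ) (wk-[]tm p σ) (wk-[]tm φ σ) (wk-[]tm q σ)

  p⁻ : ∀ {n} → Frame n → Tm n
  p⁻ f = dyckTm E [ γ f ]tm

  C⁻ : ∀ {n} → Frame n → Ty n
  C⁻ f = dyckTy E [ γ f ]ty

  inner : ∀ {n} → Frame n → Ty n
  inner f = p f ⟶[ C⁻ f ] q f

  outer : ∀ {n} → Data n → Ty n
  outer d = p⁻ (fr d) ⟶[ C⁻ (fr d) ] q′ d

  -- It stops one variable short of `V (suc i)`: the top cell, the one being whiskered, is supplied
  -- separately.
  cells : ∀ {n i} → Frame n → Cells n i → Sub (suc (size (V i))) n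
  cells f [] = ⟨ ⟨ ⟨ γ f , p f ⟩ , φ f ⟩ , q f ⟩
  cells f (cs ∷⟨ s , t ⟩) = ⟨ ⟨ cells f cs , s ⟩ , t ⟩

  cells-[] : ∀ {m n i} f (cs : Cells m i) (σ : Sub m n) → cells f cs • σ ≡ cells (f [ σ ]frame) (cs [ σ ]cells)
  cells-[] f [] σ = refl
  cells-[] f (cs ∷⟨ s , t ⟩) σ = cong (λ τ → ⟨ ⟨ τ , s [ σ ]tm ⟩ , t [ σ ]tm ⟩) (cells-[] f cs σ)

  cells-wk : ∀ {n i} f (cs : Cells n i) → wkSub (cells f cs) ≡ cells (wkFrame f) (wkCells cs)
  cells-wk f [] = refl
  cells-wk f (cs ∷⟨ s , t ⟩) = cong (λ τ → ⟨ ⟨ τ , wkTm s ⟩ , wkTm t ⟩) (cells-wk f cs)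

  -- Generic data: together with `genCells` it assembles to the identity substitution, so what is
  -- built from it specialises to arbitrary data.
  genFrame : ∀ i → Frame (suc (size (V i)))
  genFrame zero = frame (wkSub (wkSub (wkSub (idSub (size E))))) (var (suc (suc zero))) (var (suc zero)) (var zero)
  genFrame (suc i) = wkFrame (wkFrame (genFrame i))

  genCells : ∀ i → Cells (suc (size (V i))) i
  genCells zero = []
  genCells (suc i) = wkCells (wkCells (genCells i)) ∷⟨ var (suc zero) , var zero ⟩

  cells-gen : ∀ i → cells (genFrame i) (genCells i) ≡ idSub (suc (size (V i)))
  cells-gen zero = refl
  cells-gen (suc i) = cong (λ τ → ⟨ ⟨ τ , var (suc zero) ⟩ , var zero ⟩)
    (trans (sym (cells-wk (wkFrame (genFrame i)) (wkCells (genCells i))))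
      (cong wkSub (trans (sym (cells-wk (genFrame i) (genCells i))) (cong wkSub (cells-gen i)))))

  genFrame-cells : ∀ {n i} f (cs : Cells n i) → genFrame i [ cells f cs ]frame ≡ f
  genFrame-cells f [] = frame-cong
    (trans (wkSub-⟨,⟩ (wkSub (wkSub (idSub _)))) (trans (wkSub-⟨,⟩ (wkSub (idSub _))) (trans (wkSub-⟨,⟩ (idSub _)) (id-• (γ f)))))
    refl refl refl
  genFrame-cells {i = suc i} f (cs ∷⟨ s , t ⟩) =
    trans (wkFrame-⟨,⟩ (wkFrame (genFrame i))) (trans (wkFrame-⟨,⟩ (genFrame i)) (genFrame-cells f cs))

  genCells-cells : ∀ {n i} f (cs : Cells n i) → genCells i [ cells f cs ]cells ≡ cs
  genCells-cells f [] = refl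
  genCells-cells {i = suc i} f (cs ∷⟨ s , t ⟩) = cong (_∷⟨ s , t ⟩)
    (trans (wkCells-⟨,⟩ (wkCells (genCells i))) (trans (wkCells-⟨,⟩ (genCells i)) (genCells-cells f cs)))

  -- The type and the position of the variable q.
  C⁺ : ∀ i → Ty (suc (size (V i)))
  C⁺ zero = wkTy (dyckTy (E ⇑ ⇓))
  C⁺ (suc i) = wkTy (wkTy (C⁺ i))

  q⁺ : ∀ i → Fin (suc (size (V i)))
  q⁺ zero = zero
  q⁺ (suc i) = suc (suc (q⁺ i))

  -- The (k+1)-cell φ, an (i+1+k)-cell and the (k+1)-cell ψ, composed along dimension k.
  WhiskerCtx : ∀ i → Ctx (suc (suc (size (V (suc i)))))
  WhiskerCtx i = ⌊ V (suc i) ⌋ ▸ wkTy (C⁺ i) ▸ (var (suc (suc (q⁺ i))) ⟶[ wkTy (wkTy (C⁺ i)) ] var zero)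

  build : ∀ {n i} → Data n → Cells n i → Tm n → Sub (suc (suc (size (V (suc i))))) n
  build d cs t = ⟨ ⟨ ⟨ cells (fr d) cs , t ⟩ , q′ d ⟩ , ψ d ⟩

  genData : ∀ i → Data (suc (suc (size (V (suc i)))))
  genData i = mkData (wkFrame (wkFrame (wkFrame (genFrame i)))) (var (suc zero)) (var zero)

  genCells³ : ∀ i → Cells (suc (suc (size (V (suc i))))) i
  genCells³ i = wkCells (wkCells (wkCells (genCells i)))

  -- A whiskered cell has the whiskered cells of its boundary as source and target, hence the mutual
  -- recursion on `i`; at the bottom the boundary is `p′` and `q′`. The coherence uses the generic
  -- instance of this type.
  padTy : ∀ {n} i → Data n → Cells n i → Ty n
  padTm : ∀ {n} i → Data n → Cells n i → Tm n → Tm n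
  padding : ∀ i → Ty (suc (suc (size (V (suc i)))))
  padTy zero d [] = outer d
  padTy (suc i) d (cs ∷⟨ s , t ⟩) = padTm i d cs s ⟶[ padTy i d cs ] padTm i d cs t
  padTm i d cs t = Coh (WhiskerCtx i) (padding i) (build d cs t)
  padding i = padTy i (genData i) (genCells³ i)

  padTy-[] : ∀ {m n} i d (cs : Cells m i) (σ : Sub m n) → padTy i d cs [ σ ]ty ≡ padTy i (d [ σ ]data) (cs [ σ ]cells)
  padTm-[] : ∀ {m n} i d (cs : Cells m i) t (σ : Sub m n) →
             padTm i d cs t [ σ ]tm ≡ padTm i (d [ σ ]data) (cs [ σ ]cells) (t [ σ ]tm)
  padTy-[] zero d [] σ = ⟶-cong (assoc-tm (dyckTm E) (γ (fr d)) σ) (assoc-ty (dyckTy E) (γ (fr d)) σ) refl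
  padTy-[] (suc i) d (cs ∷⟨ s , t ⟩) σ = ⟶-cong (padTm-[] i d cs s σ) (padTy-[] i d cs σ) (padTm-[] i d cs t σ)
  padTm-[] i d cs t σ = cong (λ τ → Coh (WhiskerCtx i) (padding i) ⟨ ⟨ ⟨ τ , t [ σ ]tm ⟩ , q′ d [ σ ]tm ⟩ , ψ d [ σ ]tm ⟩)
    (cells-[] (fr d) cs σ)

  genData-build : ∀ {n} i d (cs : Cells n i) t → genData i [ build d cs t ]data ≡ d
  genData-build i d cs t = data-cong
    (trans (wkFrame-⟨,⟩ (wkFrame (wkFrame (genFrame i)))) (trans (wkFrame-⟨,⟩ (wkFrame (genFrame i)))
      (trans (wkFrame-⟨,⟩ (genFrame i)) (genFrame-cells (fr d) cs)))) refl refl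

  genCells-build : ∀ {n} i d (cs : Cells n i) t → genCells³ i [ build d cs t ]cells ≡ cs
  genCells-build i d cs t = trans (wkCells-⟨,⟩ (wkCells (wkCells (genCells i))))
    (trans (wkCells-⟨,⟩ (wkCells (genCells i))) (trans (wkCells-⟨,⟩ (genCells i)) (genCells-cells (fr d) cs)))

  padding-build : ∀ {n} i d (cs : Cells n i) t → padding i [ build d cs t ]ty ≡ padTy i d cs
  padding-build i d cs t = trans (padTy-[] i (genData i) (genCells³ i) (build d cs t))
    (cong₂ (padTy i) (genData-build i d cs t) (genCells-build i d cs t))

-- Boundaries of the whiskering context

dim-U : ∀ n → dim (U n) ≡ n
dim-U zero = refl
dim-U (suc n) = cong suc (trans (dim-wk (wkTy (U n))) (trans (dim-wk (U n)) (dim-U n)))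

dimCtx-Disc : ∀ n → dimCtx (Disc n) ≤ n
dimCtx-Sphere : ∀ n → dimCtx (Sphere n) ≤ n
dimCtx-Disc n = ⊔-lub (dimCtx-Sphere n) (≤-reflexive (dim-U n))
dimCtx-Sphere zero = z≤n
dimCtx-Sphere (suc n) = m≤n⇒m≤1+n (⊔-lub (dimCtx-Disc n) (≤-reflexive (trans (dim-wk (U n)) (dim-U n))))

Full : ∀ {n} → Subset n → Set
Full V = ∀ x → x ∈ V

Full-∪ˡ : ∀ {n} {V W : Subset n} → Full V → Full (V ∪ W)
Full-∪ˡ h x = ∪⁺ˡ (h x)

Full⇒⊤ : ∀ {n} (Γ : Ctx n) {V} → Full V → closure Γ V ≡ Subset.⊤
Full⇒⊤ Γ h = ∈-⊤ λ x → closure-contains {Γ = Γ} (h x)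

FVSub-id : ∀ n → FVSub (idSub n) ≡ Subset.⊤
FVSub-id n = ∈-⊤ λ x → FVSub⁺ (idSub n) x (subst (λ t → x ∈ FVTm t) (sym (entry-id x)) (x∈⁅x⁆ x))

FV-sphereSub-wk : ∀ {n} (A : Ty n) → FVSub (sphereSub (wkTy A)) ≡ outside ∷ FVSub (sphereSub A)
FV-sphereSub-wk ⋆ = refl
FV-sphereSub-wk (s ⟶[ A ] t) rewrite FV-sphereSub-wk A | FVTm-wk s | FVTm-wk t = refl

-- For unknown `k` the term `dyckTm (mountain k)` is a variable only propositionally, whereas `pse`
-- asks for a literal one.
pse′ : ∀ {n} {Γ : Ctx n} {x A s} → s ≡ var x → Γ ⊢ps x ∶ A →
       Γ ▸ A ▸ (wkTm s ⟶[ wkTy A ] var zero) ⊢ps zero ∶ wkTy (wkTm s ⟶[ wkTy A ] var zero)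
pse′ refl p = pse p

∂-pse′ : ∀ {n} {Γ : Ctx n} {x A s} i ε (e : s ≡ var x) (p : Γ ⊢ps x ∶ A) → ∂ i ε (pse′ e p) ≡ ∂ i ε (pse p)
∂-pse′ i ε refl p = refl

RegularTy : ∀ {n} → Ctx n → Ty n → Set
RegularTy Γ ⋆ = ⊥
RegularTy Γ (s ⟶[ A ] t) = Regular Γ (Supp Γ s) (Supp Γ t)

module WhiskerPs (k : ℕ) where
  open Whisker k

  -- Context, type and term of a mountain are those of a disc, but only propositionally; facts are
  -- proved for the disc and transported together.
  via-disc : (P : Package → Set) → P (discPackage k) → P (package E)
  via-disc P = subst P (sym (package-mountain k))

  E-ps : ∃[ x ] (dyckTm E ≡ var x × ⌊ E ⌋ ⊢ps x ∶ dyckTy E)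
  E-ps = via-disc (λ (n , Γ , A , s) → ∃[ x ] (s ≡ var x × Γ ⊢ps x ∶ A)) (zero , refl , disc-ps k)

  xE = proj₁ E-ps
  xE≡ = proj₁ (proj₂ E-ps)
  pE = proj₂ (proj₂ E-ps)

  E-supp : Supp ⌊ E ⌋ (dyckTm E) ≡ Subset.⊤
  E-supp = via-disc (λ (n , Γ , A , s) → Supp Γ s ≡ Subset.⊤) (Supp-disc k)

  E-boundary : closure ⌊ E ⌋ (FVTy (dyckTy E)) ≡ Subset.⊤ - xE
  E-boundary = trans (via-disc (λ (n , Γ , A , s) → closure Γ (FVTy A) ≡ Subset.⊤ ─ FVTm s) disc) (cong (λ s → Subset.⊤ ─ FVTm s) xE≡)
    where
    disc : closure (Disc k) (FVTy (wkTy (U k))) ≡ outside ∷ (Subset.⊤ ─ Subset.⊥)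
    disc rewrite FVTy-wk (U k) = cong (outside ∷_) (trans (closure-U k) (sym (p─⊥≡p Subset.⊤)))

  E-dim : dimCtx ⌊ E ⌋ ≤ k
  E-dim = via-disc (λ (n , Γ , A , s) → dimCtx Γ ≤ k) (dimCtx-Disc k)

  pX : ⌊ V 0 ⌋ ⊢ps suc zero ∶ dyckTy (V 0)
  pX = psd (pse′ xE≡ pE)

  pV : ∀ i → ⌊ V (suc i) ⌋ ⊢ps zero ∶ dyckTy (V (suc i))
  pV zero = pse pX
  pV (suc i) = pse (pV i)

  arrow-▷ : ∀ i → arrowTy (V i) ▷ q⁺ i ∶ C⁺ i
  arrow-▷ zero = here
  arrow-▷ (suc i) = there (▷-wk (▷-wk (arrow-▷ i)))

  pQ : ∀ i → ⌊ V (suc i) ⌋ ⊢ps suc (q⁺ i) ∶ wkTy (C⁺ i)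
  pQ i = ps-▷ (pV i) (▷-wk (arrow-▷ i))

  pW : ∀ i → WhiskerCtx i ⊢ps zero ∶ _
  pW i = pse (pQ i)

  dim-C⁺ : ∀ i → dim (C⁺ i) ≡ k
  dim-C⁺ zero = trans (dim-wk (wkTy (wkTy (dyckTy E)))) (trans (dim-wk (wkTy (dyckTy E))) (trans (dim-wk (dyckTy E)) (dim-dyckTy E)))
  dim-C⁺ (suc i) = trans (dim-wk (wkTy (C⁺ i))) (trans (dim-wk (C⁺ i)) (dim-C⁺ i))

  dim-wkC⁺ : ∀ i → dim (wkTy (C⁺ i)) ≡ k
  dim-wkC⁺ i = trans (dim-wk (C⁺ i)) (dim-C⁺ i)

  dim-arrow : ∀ {d} (W : Dyck d) → dim (arrowTy W) ≡ suc d
  dim-arrow W = cong suc (trans (dim-wk (dyckTy W)) (dim-dyckTy W))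

  raise-dim : ∀ {d} (W : Dyck d) → dimCtx ⌊ W ⌋ ≤ suc d → dimCtx ⌊ W ⇑ ⌋ ≤ suc d
  raise-dim W h = ⊔-lub (⊔-lub h (m≤n⇒m≤1+n (≤-reflexive (dim-dyckTy W)))) (≤-reflexive (dim-arrow W))

  V-dim : ∀ i → dimCtx ⌊ V i ⌋ ≤ suc (i + k)
  V-dim zero = raise-dim E (m≤n⇒m≤1+n E-dim)
  V-dim (suc i) = m≤n⇒m≤1+n (raise-dim (V i) (V-dim i))

  V-dim′ : ∀ i → dimCtx ⌊ V (suc i) ⌋ ≤ suc (i + k)
  V-dim′ i = raise-dim (V i) (V-dim i)

  W-dim : ∀ i → dimCtx (WhiskerCtx i) ≤ suc (i + k)
  W-dim i = ⊔-lub (⊔-lub (V-dim′ i) (≤-trans (≤-reflexive (dim-wkC⁺ i)) (m≤n⇒m≤1+n (m≤n+m k i))))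
    (s≤s (≤-trans (≤-reflexive (trans (dim-wk (wkTy (C⁺ i))) (dim-wkC⁺ i))) (m≤n+m k i)))

  -- Boundaries

  ∂X⁻ : ∂ k ⁻ pX ≡ outside ∷ outside ∷ Subset.⊤
  ∂X⁻ = trans (∂-pse′ k ⁻ xE≡ pE) (trans (subst (λ i → ∂ i ⁻ (pse pE) ≡ outside ∷ outside ∷ ∂ i ⁻ pE) (dim-dyckTy E) (∂-≡⁻ pE))
    (cong (λ V → outside ∷ outside ∷ V) (∂-full k ⁻ pE E-dim)))

  ∂X⁺ : ∂ k ⁺ pX ≡ outside ∷ inside ∷ (Subset.⊤ - xE)
  ∂X⁺ = trans (∂-pse′ k ⁺ xE≡ pE) (trans (subst (λ i → ∂ i ⁺ (pse pE) ≡ outside ∷ inside ∷ (∂ i ⁺ pE - xE)) (dim-dyckTy E) (∂-≡⁺ pE))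
    (cong (λ V → outside ∷ inside ∷ (V - xE)) (∂-full k ⁺ pE E-dim)))

  ∂V₁⁻ : ∂ k ⁻ (pV 0) ≡ outside ∷ outside ∷ outside ∷ outside ∷ Subset.⊤
  ∂V₁⁻ = trans (subst (λ i → ∂ i ⁻ (pse pX) ≡ outside ∷ outside ∷ ∂ i ⁻ pX) (dim-dyckTy (V 0)) (∂-≡⁻ pX))
    (cong (λ V → outside ∷ outside ∷ V) ∂X⁻)

  ∂V₁⁺ : ∂ k ⁺ (pV 0) ≡ outside ∷ inside ∷ outside ∷ outside ∷ (Subset.⊤ - xE)
  ∂V₁⁺ = trans (subst (λ i → ∂ i ⁺ (pse pX) ≡ outside ∷ inside ∷ (∂ i ⁺ pX - suc zero)) (dim-dyckTy (V 0)) (∂-≡⁺ pX))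
    (cong (λ V → outside ∷ inside ∷ V) (trans (cong (_- suc zero) ∂X⁺) (cong (λ V → outside ∷ outside ∷ V) (p─⊥≡p _))))

  ∂V⁻ : ∀ i → ∂ (suc i + k) ⁻ (pV (suc i)) ≡ outside ∷ outside ∷ Subset.⊤
  ∂V⁻ i = trans (subst (λ j → ∂ j ⁻ (pse (pV i)) ≡ outside ∷ outside ∷ ∂ j ⁻ (pV i)) (dim-dyckTy (V (suc i))) (∂-≡⁻ (pV i)))
    (cong (λ V → outside ∷ outside ∷ V) (∂-full (suc i + k) ⁻ (pV i) (V-dim′ i)))

  ∂V⁺ : ∀ i → ∂ (suc i + k) ⁺ (pV (suc i)) ≡ outside ∷ inside ∷ outside ∷ Subset.⊤
  ∂V⁺ i = trans (subst (λ j → ∂ j ⁺ (pse (pV i)) ≡ outside ∷ inside ∷ (∂ j ⁺ (pV i) - zero)) (dim-dyckTy (V (suc i))) (∂-≡⁺ (pV i)))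
    (cong (λ V → outside ∷ inside ∷ V) (trans (cong (_- zero) (∂-full (suc i + k) ⁺ (pV i) (V-dim′ i)))
      (cong (outside ∷_) (p─⊥≡p Subset.⊤))))

  ∂W₀⁻ : ∂ k ⁻ (pW 0) ≡ outside ∷ outside ∷ ∂ k ⁻ (pV 0)
  ∂W₀⁻ = subst (λ i → ∂ i ⁻ (pse (pQ 0)) ≡ outside ∷ outside ∷ ∂ i ⁻ (pQ 0)) (dim-wkC⁺ 0) (∂-≡⁻ (pQ 0))

  ∂W₀⁺ : ∂ k ⁺ (pW 0) ≡ outside ∷ inside ∷ (∂ k ⁺ (pV 0) - suc zero)
  ∂W₀⁺ = subst (λ i → ∂ i ⁺ (pse (pQ 0)) ≡ outside ∷ inside ∷ (∂ i ⁺ (pQ 0) - suc zero)) (dim-wkC⁺ 0) (∂-≡⁺ (pQ 0))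

  ∂W : ∀ i ε → ∂ (suc i + k) ε (pW (suc i)) ≡ inside ∷ inside ∷ ∂ (suc i + k) ε (pV (suc i))
  ∂W i ε = trans (∂-> (pQ (suc i)) ε (≤-trans (≤-reflexive (cong suc (dim-wkC⁺ (suc i)))) (s≤s (m≤n+m k i))))
    (cong (λ V → inside ∷ inside ∷ V) (∂-▷ (suc i + k) ε (pV (suc i)) (▷-wk (arrow-▷ (suc i)))))

  -- The type of the composite before and after its last factor ψ is made trivial

  dataL : ∀ i → Data (size (V (suc i)))
  dataL i = mkData (wkFrame (genFrame i)) (var (suc (q⁺ i))) (identity (wkTy (C⁺ i)) (var (suc (q⁺ i))))

  paddingL : ∀ i → Ty (size (V (suc i)))
  paddingL i = padTy i (dataL i) (wkCells (genCells i))

  regular-by : ∀ {n} {Γ : Ctx n} {x A V W} (p : Γ ⊢ps x ∶ A) i → dimCtx Γ ≤ suc i → V ≡ ∂ i ⁻ p → W ≡ ∂ i ⁺ p → Regular Γ V W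
  regular-by {Γ = Γ} p i h e e′ = let P , b = ps-close p in
    subst₂ (Regular Γ) (trans (b i ⁻) (sym e)) (trans (b i ⁺) (sym e′)) (regular P i h)

  wk³id : ∀ {i} → cells (wkFrame (wkFrame (wkFrame (genFrame i)))) (wkCells (wkCells (wkCells (genCells i))))
          ≡ wkSub (wkSub (wkSub (idSub (suc (size (V i))))))
  wk³id {i} = trans (sym (cells-wk (wkFrame (wkFrame (genFrame i))) (wkCells (wkCells (genCells i)))))
    (cong wkSub (trans (sym (cells-wk (wkFrame (genFrame i)) (wkCells (genCells i))))
      (cong wkSub (trans (sym (cells-wk (genFrame i) (genCells i))) (cong wkSub (cells-gen i))))))

  wk⁵id : ∀ {i} → cells (wkFrame (wkFrame (wkFrame (wkFrame (wkFrame (genFrame i)))))) (wkCells (wkCells (wkCells (wkCells (wkCells (genCells i))))))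
          ≡ wkSub (wkSub (wkSub (wkSub (wkSub (idSub (suc (size (V i))))))))
  wk⁵id {i} = trans (sym (cells-wk (wkFrame (wkFrame (wkFrame (wkFrame (genFrame i))))) (wkCells (wkCells (wkCells (wkCells (genCells i)))))))
    (cong wkSub (trans (sym (cells-wk (wkFrame (wkFrame (wkFrame (genFrame i)))) (wkCells (wkCells (wkCells (genCells i)))))) (cong wkSub wk³id)))

  FV³ : ∀ {i} → FVSub (cells (wkFrame (wkFrame (wkFrame (genFrame i)))) (wkCells (wkCells (wkCells (genCells i)))))
        ≡ outside ∷ outside ∷ outside ∷ Subset.⊤
  FV³ {i} rewrite wk³id {i} | FVSub-wk (wkSub (wkSub (idSub (suc (size (V i)))))) | FVSub-wk (wkSub (idSub (suc (size (V i)))))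
    | FVSub-wk (idSub (suc (size (V i)))) | FVSub-id (suc (size (V i))) = refl

  FV⁵ : ∀ {i} → FVSub (cells (wkFrame (wkFrame (wkFrame (wkFrame (wkFrame (genFrame i)))))) (wkCells (wkCells (wkCells (wkCells (wkCells (genCells i)))))))
        ≡ outside ∷ outside ∷ outside ∷ outside ∷ outside ∷ Subset.⊤
  FV⁵ {i} rewrite wk⁵id {i} | FVSub-wk (wkSub (wkSub (wkSub (wkSub (idSub (suc (size (V i))))))))
    | FVSub-wk (wkSub (wkSub (wkSub (idSub (suc (size (V i))))))) | FVSub-wk (wkSub (wkSub (idSub (suc (size (V i))))))
    | FVSub-wk (wkSub (idSub (suc (size (V i)))))
    | FVSub-wk (idSub (suc (size (V i)))) | FVSub-id (suc (size (V i))) = refl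

  module _ (i : ℕ) where
    private
      FV-C¹ : FVTy (wkTy (C⁺ (suc i))) ≡ outside ∷ outside ∷ outside ∷ FVTy (C⁺ i)
      FV-C¹ rewrite FVTy-wk (wkTy (wkTy (C⁺ i))) | FVTy-wk (wkTy (C⁺ i)) | FVTy-wk (C⁺ i) = refl
      FV-C² : FVTy (wkTy (wkTy (C⁺ (suc i)))) ≡ outside ∷ outside ∷ outside ∷ outside ∷ FVTy (C⁺ i)
      FV-C² rewrite FVTy-wk (wkTy (C⁺ (suc i))) | FV-C¹ = refl

    closure-V⁻ : ∀ {T} → Full T → closure ⌊ V (suc (suc i)) ⌋ (outside ∷ outside ∷ inside ∷ T) ≡ outside ∷ outside ∷ Subset.⊤
    closure-V⁻ h = cong (λ V → outside ∷ outside ∷ inside ∷ V) (Full⇒⊤ (⌊ V i ⌋ ▸ dyckTy (V i)) (Full-∪ˡ h))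

    closure-V⁺ : ∀ {T} → Full T → closure ⌊ V (suc (suc i)) ⌋ (outside ∷ inside ∷ outside ∷ T) ≡ outside ∷ inside ∷ outside ∷ Subset.⊤
    closure-V⁺ h rewrite FVTy-wk (arrowTy (V i)) = cong (λ V → outside ∷ inside ∷ outside ∷ V) (Full⇒⊤ (⌊ V i ⌋ ▸ dyckTy (V i)) (Full-∪ˡ h))

    closure-W⁻ : ∀ {T} → Full T → closure (WhiskerCtx (suc i)) (inside ∷ inside ∷ outside ∷ outside ∷ inside ∷ T)
                 ≡ inside ∷ inside ∷ outside ∷ outside ∷ Subset.⊤
    closure-W⁻ h rewrite FV-C² | FV-C¹ = cong (λ V → inside ∷ inside ∷ V) (closure-V⁻ (Full-∪ˡ (Full-∪ˡ h)))

    closure-W⁺ : ∀ {T} → Full T → closure (WhiskerCtx (suc i)) (inside ∷ inside ∷ outside ∷ inside ∷ outside ∷ T)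
                 ≡ inside ∷ inside ∷ outside ∷ inside ∷ outside ∷ Subset.⊤
    closure-W⁺ h rewrite FV-C² | FV-C¹ = cong (λ V → inside ∷ inside ∷ V) (closure-V⁺ (Full-∪ˡ (Full-∪ˡ h)))

    full : ∀ {n} (A B C : Subset n) → Full (((Subset.⊤ ∪ A) ∪ B) ∪ C)
    full A B C = Full-∪ˡ (Full-∪ˡ (Full-∪ˡ λ x → ∈⊤))

    -- The source composite mentions both whiskers and all generic cells except the last target and
    -- the top cell, and dually for the target composite. After closure these are the boundaries in
    -- dimension `suc i + k`.
    regular-padding-suc : RegularTy (WhiskerCtx (suc i)) (padding (suc i))
    regular-padding-suc rewrite FV⁵ {i} = regular-by (pW (suc i)) (suc i + k) (W-dim (suc i))
      (trans (closure-W⁻ (full Subset.⊥ Subset.⊥ Subset.⊥)) (sym (trans (∂W i ⁻) (cong (λ V → inside ∷ inside ∷ V) (∂V⁻ i)))))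
      (trans (closure-W⁺ (full Subset.⊥ Subset.⊥ Subset.⊥)) (sym (trans (∂W i ⁺) (cong (λ V → inside ∷ inside ∷ V) (∂V⁺ i)))))

    regular-paddingL-suc : RegularTy ⌊ V (suc (suc i)) ⌋ (paddingL (suc i))
    regular-paddingL-suc
      rewrite FV³ {i}
      | FV-sphereSub-wk (wkTy (wkTy (C⁺ i))) | FV-sphereSub-wk (wkTy (C⁺ i)) | FV-sphereSub-wk (C⁺ i)
      = regular-by (pV (suc i)) (suc i + k) (V-dim′ (suc i))
      (trans (closure-V⁻ (full Subset.⊥ ⁅ q⁺ i ⁆ (FVSub (sphereSub (C⁺ i)) ∪ ⁅ q⁺ i ⁆))) (sym (∂V⁻ i))) (trans (closure-V⁺ (full Subset.⊥ ⁅ q⁺ i ⁆ (FVSub (sphereSub (C⁺ i)) ∪ ⁅ q⁺ i ⁆))) (sym (∂V⁺ i)))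

  private
    p⁻-wk³ : ∀ {n} (γ : Sub (size E) n) → dyckTm E [ wkSub (wkSub (wkSub γ)) ]tm ≡ wkTm (wkTm (wkTm (dyckTm E [ γ ]tm)))
    p⁻-wk³ γ = trans (wk-[]tm (dyckTm E) (wkSub (wkSub γ))) (cong wkTm (trans (wk-[]tm (dyckTm E) (wkSub γ)) (cong wkTm (wk-[]tm (dyckTm E) γ))))

    FV-p⁻ : FVTm (dyckTm E [ wkSub (wkSub (wkSub (idSub (size E)))) ]tm) ≡ outside ∷ outside ∷ outside ∷ FVTm (dyckTm E)
    FV-p⁻ rewrite p⁻-wk³ (idSub (size E)) | [id]tm (dyckTm E)
      | FVTm-wk (wkTm (wkTm (dyckTm E))) | FVTm-wk (wkTm (dyckTm E)) | FVTm-wk (dyckTm E) = refl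

    FV-wkp⁻ : ∀ {n} (γ : Sub (size E) n) → FVTm (dyckTm E [ wkSub γ ]tm) ≡ outside ∷ FVTm (dyckTm E [ γ ]tm)
    FV-wkp⁻ γ rewrite wk-[]tm (dyckTm E) γ = FVTm-wk (dyckTm E [ γ ]tm)

    FV-X : FVTy (dyckTy (V 0)) ≡ outside ∷ outside ∷ FVTy (dyckTy E)
    FV-X rewrite FVTy-wk (wkTy (dyckTy E)) | FVTy-wk (dyckTy E) = refl

    closure-q : closure ⌊ V 1 ⌋ (outside ∷ inside ∷ Subset.⊥) ≡ outside ∷ inside ∷ outside ∷ outside ∷ (Subset.⊤ - xE)
    closure-q rewrite FV-X | ∪-identityˡ (FVTy (dyckTy E)) = cong (λ V → outside ∷ inside ∷ outside ∷ outside ∷ V) E-boundary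

    closure-q′ : closure (WhiskerCtx 0) (outside ∷ inside ∷ Subset.⊥) ≡ outside ∷ inside ∷ outside ∷ outside ∷ outside ∷ outside ∷ (Subset.⊤ - xE)
    closure-q′ rewrite FVTy-wk (C⁺ 0) | FVTy-wk (dyckTy (V 0)) | FV-X | ∪-identityˡ (FVTy (dyckTy E)) =
      cong (λ V → outside ∷ inside ∷ outside ∷ outside ∷ outside ∷ outside ∷ V) E-boundary

  -- At level zero the padding is `p′ → q′`, so the relevant boundary has dimension `k` and contains
  -- neither whisker.
  regular-padding : ∀ i → RegularTy (WhiskerCtx i) (padding i)
  regular-padding (suc i) = regular-padding-suc i
  regular-padding zero = regular-by (pW 0) k (W-dim 0)
    (trans (cong (closure (WhiskerCtx 0)) fv) (trans (cong (λ V → outside ∷ outside ∷ outside ∷ outside ∷ outside ∷ outside ∷ V) E-supp)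
      (sym (trans ∂W₀⁻ (cong (λ V → outside ∷ outside ∷ V) ∂V₁⁻)))))
    (trans closure-q′ (sym (trans ∂W₀⁺ (cong (λ V → outside ∷ inside ∷ V)
      (trans (cong (_- suc zero) ∂V₁⁺) (cong (λ V → outside ∷ outside ∷ outside ∷ outside ∷ V) (p─⊥≡p _)))))))
    where
    γ₃ = wkSub (wkSub (wkSub (idSub (size E))))
    fv : FVTm (dyckTm E [ wkSub (wkSub (wkSub γ₃)) ]tm) ≡ outside ∷ outside ∷ outside ∷ outside ∷ outside ∷ outside ∷ FVTm (dyckTm E)
    fv rewrite FV-wkp⁻ (wkSub (wkSub γ₃)) | FV-wkp⁻ (wkSub γ₃) | FV-wkp⁻ γ₃ | FV-p⁻ = refl

  regular-paddingL : ∀ i → RegularTy ⌊ V (suc i) ⌋ (paddingL i)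
  regular-paddingL (suc i) = regular-paddingL-suc i
  regular-paddingL zero = regular-by (pV 0) k (V-dim′ 0)
    (trans (cong (closure ⌊ V 1 ⌋) fv) (trans (cong (λ V → outside ∷ outside ∷ outside ∷ outside ∷ V) E-supp) (sym ∂V₁⁻)))
    (trans closure-q (sym ∂V₁⁺))
    where
    fv : FVTm (dyckTm E [ wkSub (wkSub (wkSub (wkSub (idSub (size E))))) ]tm) ≡ outside ∷ outside ∷ outside ∷ outside ∷ FVTm (dyckTm E)
    fv rewrite FV-wkp⁻ (wkSub (wkSub (wkSub (idSub (size E))))) | FV-p⁻ = refl

-- Typing of whiskered cells

module CellsTyping {ℓ} {R : RuleSet ℓ} (R-sub : SubstitutionCondition R) where
  open Typing R
  open RawTyping {R = R}
  open SubstitutionLemma {R = R} R-sub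

  data CellsTyped {n} (Γ : Ctx n) (A : Ty n) : ∀ {i} → Cells n i → Set ℓ where
    []  : CellsTyped Γ A []
    _∷⟨_,_⟩ : ∀ {i} {cs : Cells n i} {s t} → CellsTyped Γ A cs → Γ ⊢ s ∶ over A cs → Γ ⊢ t ∶ over A cs →
              CellsTyped Γ A (cs ∷⟨ s , t ⟩)

  CellsTyped-wk : ∀ {n i} {Γ : Ctx n} {A B} {cs : Cells n i} → CellsTyped Γ A cs → CellsTyped (Γ ▸ B) (wkTy A) (wkCells cs)
  CellsTyped-wk [] = []
  CellsTyped-wk {A = A} (_∷⟨_,_⟩ {cs = cs} h s t) =
    CellsTyped-wk h ∷⟨ retype (sym (over-wk A cs)) (tm-wk s) , retype (sym (over-wk A cs)) (tm-wk t) ⟩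

  over-≈ : ∀ {n i} {Γ : Ctx n} {A B} (cs : Cells n i) → Γ ⊢ A ≈ty B → Γ ⊢ over A cs ≈ty over B cs
  over-≈ [] h = h
  over-≈ (cs ∷⟨ s , t ⟩) h = ≈-⟶ (≈tm-refl s) (over-≈ cs h) (≈tm-refl t)

  CellsTyped-≈ : ∀ {n i} {Γ : Ctx n} {A B} {cs : Cells n i} → Γ ⊢ A ≈ty B → CellsTyped Γ A cs → CellsTyped Γ B cs
  CellsTyped-≈ e [] = []
  CellsTyped-≈ e (_∷⟨_,_⟩ {cs = cs} h s t) = CellsTyped-≈ e h ∷⟨ tm-conv s (over-≈ cs e) , tm-conv t (over-≈ cs e) ⟩

  coh-typed : ∀ {m n} {Δ : Ctx m} {Γ : Ctx n} A {σ} → PsContext Δ → Δ ⊢ty A → Γ ⊢sub σ ∶ Δ → RegularTy Δ A →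
              Γ ⊢ Coh Δ A σ ∶ A [ σ ]ty
  coh-typed (s ⟶[ A ] t) = tm-coh

  module _ (k : ℕ) where
    open Whisker k
    open WhiskerPs k

    record FrameTyped {n} (Γ : Ctx n) (f : Frame n) : Set ℓ where
      field
        γ∶ : Γ ⊢sub γ f ∶ ⌊ E ⌋
        p∶ : Γ ⊢ p f ∶ C⁻ f
        φ∶ : Γ ⊢ φ f ∶ p⁻ f ⟶[ C⁻ f ] p f
        q∶ : Γ ⊢ q f ∶ C⁻ f
    open FrameTyped public

    record DataTyped {n} (Γ : Ctx n) (d : Data n) : Set ℓ where
      field
        fr∶ : FrameTyped Γ (fr d)
        q′∶ : Γ ⊢ q′ d ∶ C⁻ (fr d)
        ψ∶  : Γ ⊢ ψ d ∶ q (fr d) ⟶[ C⁻ (fr d) ] q′ d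
    open DataTyped public

    E-type : ⌊ E ⌋ ⊢ty dyckTy E
    E-type = embed-ty R (ps-type pE)

    E-term : ⌊ E ⌋ ⊢ dyckTm E ∶ dyckTy E
    E-term = subst (λ s → ⌊ E ⌋ ⊢ s ∶ dyckTy E) (sym xE≡) (embed-tm R (ps-var pE))

    C⁻-typed : ∀ {n} {Γ : Ctx n} {f} → FrameTyped Γ f → Γ ⊢ty C⁻ f
    C⁻-typed h = ty-[] E-type (γ∶ h)

    p⁻-typed : ∀ {n} {Γ : Ctx n} {f} → FrameTyped Γ f → Γ ⊢ p⁻ f ∶ C⁻ f
    p⁻-typed h = tm-[] E-term (γ∶ h)

    C⁻-wk : ∀ {n} (f : Frame n) → C⁻ (wkFrame f) ≡ wkTy (C⁻ f)
    C⁻-wk f = wk-[]ty (dyckTy E) (γ f)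

    p⁻-wk : ∀ {n} (f : Frame n) → p⁻ (wkFrame f) ≡ wkTm (p⁻ f)
    p⁻-wk f = wk-[]tm (dyckTm E) (γ f)

    inner-wk : ∀ {n} (f : Frame n) → inner (wkFrame f) ≡ wkTy (inner f)
    inner-wk f = ⟶-cong refl (C⁻-wk f) refl

    FrameTyped-wk : ∀ {n} {Γ : Ctx n} {A f} → FrameTyped Γ f → FrameTyped (Γ ▸ A) (wkFrame f)
    FrameTyped-wk {f = f} h = record
      { γ∶ = sub-wk (γ∶ h) ; p∶ = retype (sym (C⁻-wk f)) (tm-wk (p∶ h))
      ; φ∶ = retype (sym (⟶-cong (p⁻-wk f) (C⁻-wk f) refl)) (tm-wk (φ∶ h))
      ; q∶ = retype (sym (C⁻-wk f)) (tm-wk (q∶ h)) }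

    wkTy³-⟨,⟩ : ∀ {m n} (A : Ty m) {σ : Sub m n} {s t u} → wkTy (wkTy (wkTy A)) [ ⟨ ⟨ ⟨ σ , s ⟩ , t ⟩ , u ⟩ ]ty ≡ A [ σ ]ty
    wkTy³-⟨,⟩ A = trans (wkTy-⟨,⟩ (wkTy (wkTy A))) (trans (wkTy-⟨,⟩ (wkTy A)) (wkTy-⟨,⟩ A))

    arrow-cells : ∀ {n i} f (cs : Cells n i) → arrowTy (V i) [ cells f cs ]ty ≡ over (inner f) cs
    arrow-cells f [] = ⟶-cong refl (wkTy³-⟨,⟩ (dyckTy E)) refl
    arrow-cells {i = suc i} f (cs ∷⟨ s , t ⟩) = ⟶-cong refl
      (trans (wkTy-⟨,⟩ (wkTy (arrowTy (V i)))) (trans (wkTy-⟨,⟩ (arrowTy (V i))) (arrow-cells f cs))) refl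

    C⁺-cells : ∀ {n i} f (cs : Cells n i) → C⁺ i [ cells f cs ]ty ≡ C⁻ f
    C⁺-cells f [] = wkTy³-⟨,⟩ (dyckTy E)
    C⁺-cells {i = suc i} f (cs ∷⟨ s , t ⟩) = trans (wkTy-⟨,⟩ (wkTy (C⁺ i))) (trans (wkTy-⟨,⟩ (C⁺ i)) (C⁺-cells f cs))

    q⁺-cells : ∀ {n i} f (cs : Cells n i) → entry (cells f cs) (q⁺ i) ≡ q f
    q⁺-cells f [] = refl
    q⁺-cells f (cs ∷⟨ s , t ⟩) = q⁺-cells f cs

    C⁻-gen : ∀ i → C⁻ (genFrame i) ≡ C⁺ i
    C⁻-gen i = trans (sym (C⁺-cells (genFrame i) (genCells i))) (trans (cong (C⁺ i [_]ty) (cells-gen i)) ([id]ty (C⁺ i)))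

    q-gen : ∀ i → q (genFrame i) ≡ var (q⁺ i)
    q-gen i = trans (sym (q⁺-cells (genFrame i) (genCells i))) (trans (cong (λ σ → entry σ (q⁺ i)) (cells-gen i)) (entry-id (q⁺ i)))

    over-gen : ∀ i → over (inner (genFrame i)) (genCells i) ≡ arrowTy (V i)
    over-gen i = trans (sym (arrow-cells (genFrame i) (genCells i)))
      (trans (cong (arrowTy (V i) [_]ty) (cells-gen i)) ([id]ty (arrowTy (V i))))

    cells-typed : ∀ {n i} {Γ : Ctx n} {f} {cs : Cells n i} → FrameTyped Γ f → CellsTyped Γ (inner f) cs →
                  Γ ⊢sub cells f cs ∶ ⌊ V i ⌋ ▸ dyckTy (V i)
    cells-typed h [] = sub-▸ (sub-▸ (sub-▸ (γ∶ h) (p∶ h))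
      (retype (sym (⟶-cong (wkTm-⟨,⟩ (dyckTm E)) (wkTy-⟨,⟩ (dyckTy E)) refl)) (φ∶ h)))
      (retype (sym (trans (wkTy-⟨,⟩ (wkTy (dyckTy E))) (wkTy-⟨,⟩ (dyckTy E)))) (q∶ h))
    cells-typed {i = suc i} {f = f} h (_∷⟨_,_⟩ {cs = cs} c s t) = sub-▸ (sub-▸ (cells-typed h c)
      (retype (sym (arrow-cells f cs)) s)) (retype (sym (trans (wkTy-⟨,⟩ (arrowTy (V i))) (arrow-cells f cs))) t)

    top-typed : ∀ {n i} {Γ : Ctx n} {f t} {cs : Cells n i} → FrameTyped Γ f → CellsTyped Γ (inner f) cs → Γ ⊢ t ∶ over (inner f) cs →
                Γ ⊢sub ⟨ cells f cs , t ⟩ ∶ ⌊ V (suc i) ⌋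
    top-typed {f = f} {cs = cs} h c t = sub-▸ (cells-typed h c) (retype (sym (arrow-cells f cs)) t)

    build-typed : ∀ {n i} {Γ : Ctx n} {d t} {cs : Cells n i} → DataTyped Γ d → CellsTyped Γ (inner (fr d)) cs →
                  Γ ⊢ t ∶ over (inner (fr d)) cs → Γ ⊢sub build d cs t ∶ WhiskerCtx i
    build-typed {i = i} {d = d} {cs = cs} h c t = sub-▸ (sub-▸ (top-typed (fr∶ h) c t)
        (retype (sym C≡) (q′∶ h)))
      (retype (sym (⟶-cong (q⁺-cells (fr d) cs) (trans (wkTy-⟨,⟩ (wkTy (C⁺ i))) C≡) refl)) (ψ∶ h))
      where
      C≡ : ∀ {t} → wkTy (C⁺ i) [ ⟨ cells (fr d) cs , t ⟩ ]ty ≡ C⁻ (fr d)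
      C≡ = trans (wkTy-⟨,⟩ (C⁺ i)) (C⁺-cells (fr d) cs)

    genFrame-typed : ∀ i → FrameTyped (⌊ V i ⌋ ▸ dyckTy (V i)) (genFrame i)
    genFrame-typed zero = record
      { γ∶ = sub-wk (sub-wk (sub-wk idSub-typed)) ; p∶ = retype (sym C≡) (tm-var (suc (suc zero)))
      ; φ∶ = retype (sym (⟶-cong p≡ C≡ refl)) (tm-var (suc zero)) ; q∶ = retype (sym C≡) (tm-var zero) }
      where
      γ₀ = idSub (size E)
      C≡ : dyckTy E [ wkSub (wkSub (wkSub γ₀)) ]ty ≡ wkTy (wkTy (wkTy (dyckTy E)))
      C≡ = trans (wk-[]ty (dyckTy E) (wkSub (wkSub γ₀))) (cong wkTy (trans (wk-[]ty (dyckTy E) (wkSub γ₀))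
        (cong wkTy (trans (wk-[]ty (dyckTy E) γ₀) (cong wkTy ([id]ty (dyckTy E)))))))
      p≡ : dyckTm E [ wkSub (wkSub (wkSub γ₀)) ]tm ≡ wkTm (wkTm (wkTm (dyckTm E)))
      p≡ = trans (wk-[]tm (dyckTm E) (wkSub (wkSub γ₀))) (cong wkTm (trans (wk-[]tm (dyckTm E) (wkSub γ₀))
        (cong wkTm (trans (wk-[]tm (dyckTm E) γ₀) (cong wkTm ([id]tm (dyckTm E)))))))
    genFrame-typed (suc i) = FrameTyped-wk (FrameTyped-wk (genFrame-typed i))

    CellsTyped-wkFrame : ∀ {n i} {Γ : Ctx n} {A f} {cs : Cells n i} → CellsTyped Γ (inner f) cs →
                         CellsTyped (Γ ▸ A) (inner (wkFrame f)) (wkCells cs)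
    CellsTyped-wkFrame {Γ = Γ} {A} {f} {cs} h = subst (λ B → CellsTyped (Γ ▸ A) B (wkCells cs)) (sym (inner-wk f)) (CellsTyped-wk h)

    over-wkFrame : ∀ {n i} f (cs : Cells n i) → over (inner (wkFrame f)) (wkCells cs) ≡ wkTy (over (inner f) cs)
    over-wkFrame f cs = trans (cong (λ A → over A (wkCells cs)) (inner-wk f)) (over-wk (inner f) cs)

    genCells-typed : ∀ i → CellsTyped (⌊ V i ⌋ ▸ dyckTy (V i)) (inner (genFrame i)) (genCells i)
    genCells-typed zero = []
    genCells-typed (suc i) = CellsTyped-wkFrame {f = wkFrame (genFrame i)} (CellsTyped-wkFrame {f = genFrame i} (genCells-typed i))
        ∷⟨ retype (sym type≡) (tm-var (suc zero)) , retype (sym type≡) (tm-var zero) ⟩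
      where
      type≡ : over (inner (wkFrame (wkFrame (genFrame i)))) (wkCells (wkCells (genCells i))) ≡ wkTy (wkTy (arrowTy (V i)))
      type≡ = trans (over-wkFrame (wkFrame (genFrame i)) (wkCells (genCells i)))
        (cong wkTy (trans (over-wkFrame (genFrame i) (genCells i)) (cong wkTy (over-gen i))))

    genData-typed : ∀ i → DataTyped (WhiskerCtx i) (genData i)
    genData-typed i = record
      { fr∶ = FrameTyped-wk (FrameTyped-wk (FrameTyped-wk (genFrame-typed i)))
      ; q′∶ = retype (sym C≡) (tm-var (suc zero))
      ; ψ∶ = retype (sym (⟶-cong (cong (λ s → wkTm (wkTm (wkTm s))) (q-gen i)) C≡ refl)) (tm-var zero) }
      where
      C≡ : C⁻ (wkFrame (wkFrame (wkFrame (genFrame i)))) ≡ wkTy (wkTy (wkTy (C⁺ i)))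
      C≡ = trans (C⁻-wk (wkFrame (wkFrame (genFrame i)))) (cong wkTy (trans (C⁻-wk (wkFrame (genFrame i)))
        (cong wkTy (trans (C⁻-wk (genFrame i)) (cong wkTy (C⁻-gen i))))))

    genCells³-typed : ∀ i → CellsTyped (WhiskerCtx i) (inner (fr (genData i))) (genCells³ i)
    genCells³-typed i = CellsTyped-wkFrame {f = wkFrame (wkFrame (genFrame i))} (CellsTyped-wkFrame {f = wkFrame (genFrame i)}
      (CellsTyped-wkFrame {f = genFrame i} (genCells-typed i)))

    padTy-typed : ∀ {n} i {Γ : Ctx n} {d} {cs : Cells n i} → DataTyped Γ d → CellsTyped Γ (inner (fr d)) cs → Γ ⊢ty padTy i d cs
    padTm-typed : ∀ {n} i {Γ : Ctx n} {d} {cs : Cells n i} {t} → DataTyped Γ d → CellsTyped Γ (inner (fr d)) cs →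
                  Γ ⊢ t ∶ over (inner (fr d)) cs → Γ ⊢ padTm i d cs t ∶ padTy i d cs
    padding-typed : ∀ i → WhiskerCtx i ⊢ty padding i
    padTy-typed zero h [] = ty-⟶ (C⁻-typed (fr∶ h)) (p⁻-typed (fr∶ h)) (q′∶ h)
    padTy-typed (suc i) h (c ∷⟨ s , t ⟩) = ty-⟶ (padTy-typed i h c) (padTm-typed i h c s) (padTm-typed i h c t)
    padTm-typed i {d = d} {cs} {t} h c t∶ = retype (padding-build i d cs t)
      (coh-typed (padding i) (proj₁ (ps-close (pW i))) (padding-typed i) (build-typed h c t∶) (regular-padding i))
    padding-typed i = padTy-typed i (genData-typed i) (genCells³-typed i)

    -- What remains of the data once the last whisker is pruned: `q′` has become `q`.
    trivial : ∀ {n} → Frame n → Data n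
    trivial f = mkData f (q f) (identity (C⁻ f) (q f))

    trivial-[] : ∀ {m n} (f : Frame m) (σ : Sub m n) → trivial f [ σ ]data ≡ trivial (f [ σ ]frame)
    trivial-[] f σ = data-cong refl refl
      (trans (identity-[] (C⁻ f) (q f) σ) (cong (λ A → identity A (q f [ σ ]tm)) (assoc-ty (dyckTy E) (γ f) σ)))

    trivial-typed : ∀ {n} {Γ : Ctx n} {f} → FrameTyped Γ f → DataTyped Γ (trivial f)
    trivial-typed h = record { fr∶ = h ; q′∶ = q∶ h ; ψ∶ = identity-typed (C⁻-typed h) (q∶ h) }

    dataL≡ : ∀ i → dataL i ≡ trivial (wkFrame (genFrame i))
    dataL≡ i = data-cong refl (sym (cong wkTm (q-gen i)))
      (cong₂ identity (sym (trans (C⁻-wk (genFrame i)) (cong wkTy (C⁻-gen i)))) (sym (cong wkTm (q-gen i))))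

    paddingL-typed : ∀ i → ⌊ V (suc i) ⌋ ⊢ty paddingL i
    paddingL-typed i = padTy-typed i
      (subst (DataTyped ⌊ V (suc i) ⌋) (sym (dataL≡ i)) (trivial-typed (FrameTyped-wk (genFrame-typed i))))
      (CellsTyped-wkFrame {f = genFrame i} (genCells-typed i))

-- Removing whiskers in the theory of R

-- Every substitution out of a sphere comes from a type. The dimensions agree only propositionally,
-- so the comparison again goes through an arbitrary function.
sphereSub-U : ∀ {m} {Z : Set} n (τ : Sub (n * 2) m) (f : ∀ k → Sub (k * 2) m → Z) →
              f (dim (U n [ τ ]ty)) (sphereSub (U n [ τ ]ty)) ≡ f n τ
sphereSub-U zero ⟨⟩ f = refl
sphereSub-U (suc n) ⟨ ⟨ τ , s ⟩ , t ⟩ f = trans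
  (cong (λ A → f (suc (dim A)) ⟨ ⟨ sphereSub A , s ⟩ , t ⟩) (trans (wkTy-⟨,⟩ (wkTy (U n))) (wkTy-⟨,⟩ (U n))))
  (sphereSub-U n τ (λ k υ → f (suc k) ⟨ ⟨ υ , s ⟩ , t ⟩))

module WhiskerRemoval {ℓ} {R : RuleSet ℓ} (R-sub : SubstitutionCondition R)
         (R-prune : HasPruning R) (R-disc : DiscRemoval R) where
  open Typing R
  open RawTyping {R = R}
  open SubstitutionLemma {R = R} R-sub
  open CellsTyping {R = R} R-sub

  -- Pruning is assumed for words of depth zero; appending descents changes neither the context nor
  -- what pruning does to it.
  prune : ∀ {d n} {W : Dyck d} (P : Peak W) {Γ : Ctx n} {A} {σ : Sub (size W) n} →
          ⌊ W ⌋ ⊢ty A → Γ ⊢sub σ ∶ ⌊ W ⌋ → RegularTy ⌊ W ⌋ A → IsIdentity (entry σ (peakVar P)) →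
          Γ ⊢ Coh ⌊ W ⌋ A σ ≈tm Coh ⌊ W // P ⌋ (A [ π P ]ty) (σ //ˢ P)
  prune {zero} P {A = s ⟶[ A ] t} = R-prune P
  prune {suc d} P = prune (P ⇓)

  -- The whiskering context comes from a Dyck word only up to a propositional equality; quantifying
  -- over the package lets that equality be matched with `refl`.
  prune-last : ∀ {d m n} (W : Dyck d) {Δ : Ctx m} {T x} → package W ≡ (m , Δ , T , x) →
               ∀ {Γ : Ctx n} {A σ y f} → let Δ′ = Δ ▸ T ▸ (wkTm x ⟶[ wkTy T ] var zero) in
               Δ′ ⊢ty A → Γ ⊢sub ⟨ ⟨ σ , y ⟩ , f ⟩ ∶ Δ′ → RegularTy Δ′ A → IsIdentity f →
               Γ ⊢ Coh Δ′ A ⟨ ⟨ σ , y ⟩ , f ⟩ ≈tm Coh Δ (A [ ⟨ ⟨ idSub m , x ⟩ , identity T x ⟩ ]ty) σ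
  prune-last W refl = prune (peak {E = W})

  remove-disc : ∀ {m n k} {Δ : Ctx m} {T x} → (m , Δ , T , x) ≡ discPackage (suc k) →
                ∀ {Γ : Ctx n} {σ} → Γ ⊢sub σ ∶ Δ → Γ ⊢ Coh Δ T σ ≈tm x [ σ ]tm
  remove-disc {k = k} refl {Γ} {⟨ τ , t ⟩} (sub-▸ τ∶ t∶) =
    subst (λ s → Γ ⊢ s ≈tm t) (sphereSub-U (suc k) τ (λ j υ → Coh (Disc j) (wkTy (U j)) ⟨ υ , t ⟩))
      (R-disc (ty-[] U-typed τ∶) t∶ (s≤s z≤n))
    where
    U-typed : Sphere (suc k) ⊢ty U (suc k)
    U-typed with ctx-▸ _ h ← ps-ctx (disc-ps (suc k)) = embed-ty R h
      where open Typing Catt using (ctx-▸)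

  module _ (k : ℕ) where
    open Whisker k
    open WhiskerPs k

    record Near {n} (Γ : Ctx n) (d : Data n) : Set ℓ where
      field
        φ≈ : Γ ⊢ φ (fr d) ≈tm identity (C⁻ (fr d)) (p (fr d))
        ψ≈ : Γ ⊢ ψ d ≈tm identity (C⁻ (fr d)) (q (fr d))
        p≈ : Γ ⊢ p⁻ (fr d) ≈tm p (fr d)
        q≈ : Γ ⊢ q′ d ≈tm q (fr d)
    open Near public

    -- Y i is V i after the peak φ has been pruned.

    φ-peak : ∀ i → Peak (V i)
    φ-peak zero = peak
    φ-peak (suc i) = φ-peak i ⇑

    Y : ∀ i → Dyck (i + k)
    Y i = V i // φ-peak i

    package-Y : ∀ i → package (Y i) ≡ discPackage (i + k)
    package-Y zero = package-mountain k
    package-Y (suc i) = cong raise (package-Y i)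

    cellsY : ∀ {n i} → Frame n → Cells n i → Sub (suc (size (Y i))) n
    cellsY f [] = ⟨ γ f , q f ⟩
    cellsY f (cs ∷⟨ s , t ⟩) = ⟨ ⟨ cellsY f cs , s ⟩ , t ⟩

    prune-cells : ∀ {n i} f (cs : Cells n i) t → ⟨ cells f cs , t ⟩ //ˢ φ-peak (suc i) ≡ ⟨ cellsY f cs , t ⟩
    prune-cells f [] t = refl
    prune-cells f (cs ∷⟨ s , u ⟩) t = cong (λ σ → ⟨ ⟨ σ , u ⟩ , t ⟩) (prune-cells f cs s)

    entry-φ : ∀ {n i} f (cs : Cells n i) t → entry ⟨ cells f cs , t ⟩ (peakVar (φ-peak (suc i))) ≡ φ f
    entry-φ f [] t = refl
    entry-φ f (cs ∷⟨ s , u ⟩) t = entry-φ f cs s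

    innerY : ∀ {n} → Frame n → Ty n
    innerY f = p⁻ f ⟶[ C⁻ f ] q f

    arrow-cellsY : ∀ {n i} f (cs : Cells n i) → arrowTy (Y i) [ cellsY f cs ]ty ≡ over (innerY f) cs
    arrow-cellsY f [] = ⟶-cong (wkTm-⟨,⟩ (dyckTm E)) (wkTy-⟨,⟩ (dyckTy E)) refl
    arrow-cellsY {i = suc i} f (cs ∷⟨ s , t ⟩) = ⟶-cong refl
      (trans (wkTy-⟨,⟩ (wkTy (arrowTy (Y i)))) (trans (wkTy-⟨,⟩ (arrowTy (Y i))) (arrow-cellsY f cs))) refl

    cellsY-typed : ∀ {n i} {Γ : Ctx n} {f} {cs : Cells n i} → FrameTyped k Γ f → CellsTyped Γ (innerY f) cs →
                   Γ ⊢sub cellsY f cs ∶ ⌊ Y i ⌋ ▸ dyckTy (Y i)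
    cellsY-typed h [] = sub-▸ (γ∶ h) (q∶ h)
    cellsY-typed {i = suc i} {f = f} h (_∷⟨_,_⟩ {cs = cs} c s t) = sub-▸ (sub-▸ (cellsY-typed h c)
      (retype (sym (arrow-cellsY f cs)) s)) (retype (sym (trans (wkTy-⟨,⟩ (arrowTy (Y i))) (arrow-cellsY f cs))) t)

    genFrameY : ∀ i → Frame (suc (size (Y i)))
    genFrameY zero = frame (wkSub (idSub (size E))) (wkTm (dyckTm E)) (wkTm (identity (dyckTy E) (dyckTm E))) (var zero)
    genFrameY (suc i) = wkFrame (wkFrame (genFrameY i))

    genCellsY : ∀ i → Cells (suc (size (Y i))) i
    genCellsY zero = []
    genCellsY (suc i) = wkCells (wkCells (genCellsY i)) ∷⟨ var (suc zero) , var zero ⟩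

    π⁺ : ∀ i → Sub (suc (size (V i))) (suc (size (Y i)))
    π⁺ i = ⟨ wkSub (π (φ-peak i)) , var zero ⟩

    genFrame-π : ∀ i → genFrame i [ π⁺ i ]frame ≡ genFrameY i
    genFrame-π zero = frame-cong (trans (wkSub-⟨,⟩ (wkSub (wkSub (idSub _)))) (trans (wkSub-⟨,⟩ (wkSub (idSub _)))
      (trans (wkSub-⟨,⟩ (idSub _)) (id-• _)))) refl refl refl
    genFrame-π (suc i) = trans (wkFrame-⟨,⟩ (wkFrame (genFrame i))) (trans (wkFrame-⟨,⟩ (genFrame i))
      (trans (wk-[]frame (genFrame i) (wkSub (π⁺ i))) (cong wkFrame (trans (wk-[]frame (genFrame i) (π⁺ i)) (cong wkFrame (genFrame-π i))))))

    genCells-π : ∀ i → genCells i [ π⁺ i ]cells ≡ genCellsY i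
    genCells-π zero = refl
    genCells-π (suc i) = cong (_∷⟨ var (suc zero) , var zero ⟩)
      (trans (wkCells-⟨,⟩ (wkCells (genCells i))) (trans (wkCells-⟨,⟩ (genCells i))
        (trans (wk-[]cells (genCells i) (wkSub (π⁺ i))) (cong wkCells (trans (wk-[]cells (genCells i) (π⁺ i)) (cong wkCells (genCells-π i)))))))

    E-id-ty : dyckTy E [ wkSub (idSub (size E)) ]ty ≡ wkTy (dyckTy E)
    E-id-ty = trans (wk-[]ty (dyckTy E) (idSub _)) (cong wkTy ([id]ty (dyckTy E)))

    E-id-tm : dyckTm E [ wkSub (idSub (size E)) ]tm ≡ wkTm (dyckTm E)
    E-id-tm = trans (wk-[]tm (dyckTm E) (idSub _)) (cong wkTm ([id]tm (dyckTm E)))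

    genFrameY-typed : ∀ i → FrameTyped k (⌊ Y i ⌋ ▸ dyckTy (Y i)) (genFrameY i)
    genFrameY-typed zero = record
      { γ∶ = sub-wk idSub-typed ; p∶ = retype (sym E-id-ty) (tm-wk (E-term k))
      ; φ∶ = retype (sym (⟶-cong E-id-tm E-id-ty refl)) (tm-wk (identity-typed (E-type k) (E-term k)))
      ; q∶ = retype (sym E-id-ty) (tm-var zero) }
    genFrameY-typed (suc i) = FrameTyped-wk k (FrameTyped-wk k (genFrameY-typed i))

    over-genY : ∀ i → over (inner (genFrameY i)) (genCellsY i) ≡ arrowTy (Y i)
    over-genY zero = ⟶-cong refl E-id-ty refl
    over-genY (suc i) = ⟶-cong refl (trans (over-wkFrame k (wkFrame (genFrameY i)) (wkCells (genCellsY i)))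
      (cong wkTy (trans (over-wkFrame k (genFrameY i) (genCellsY i)) (cong wkTy (over-genY i))))) refl

    genCellsY-typed : ∀ i → CellsTyped (⌊ Y i ⌋ ▸ dyckTy (Y i)) (inner (genFrameY i)) (genCellsY i)
    genCellsY-typed zero = []
    genCellsY-typed (suc i) = CellsTyped-wkFrame k {f = wkFrame (genFrameY i)} (CellsTyped-wkFrame k {f = genFrameY i} (genCellsY-typed i))
        ∷⟨ retype (sym type≡) (tm-var (suc zero)) , retype (sym type≡) (tm-var zero) ⟩
      where
      type≡ : over (inner (wkFrame (wkFrame (genFrameY i)))) (wkCells (wkCells (genCellsY i))) ≡ wkTy (wkTy (arrowTy (Y i)))
      type≡ = trans (over-wkFrame k (wkFrame (genFrameY i)) (wkCells (genCellsY i)))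
        (cong wkTy (trans (over-wkFrame k (genFrameY i) (genCellsY i)) (cong wkTy (over-genY i))))

    -- On the pruned generic data the equations of `Near` at `φ` and `p` hold syntactically, so
    -- `padTy-≈` applies to it as well.
    record TrivialFrame {n} (f : Frame n) : Set where
      field
        φ≡ : φ f ≡ identity (C⁻ f) (p f)
        p≡ : p⁻ f ≡ p f
    open TrivialFrame

    TrivialFrame-wk : ∀ {n} {f : Frame n} → TrivialFrame f → TrivialFrame (wkFrame f)
    TrivialFrame-wk {f = f} h = record
      { φ≡ = trans (cong wkTm (φ≡ h)) (trans (sym (identity-wk (C⁻ f) (p f))) (cong (λ A → identity A (wkTm (p f))) (sym (C⁻-wk k f))))
      ; p≡ = trans (p⁻-wk k f) (cong wkTm (p≡ h)) }

    genFrameY-trivial : ∀ i → TrivialFrame (genFrameY i)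
    genFrameY-trivial zero = record
      { φ≡ = trans (sym (identity-wk (dyckTy E) (dyckTm E))) (cong (λ A → identity A (wkTm (dyckTm E))) (sym E-id-ty))
      ; p≡ = E-id-tm }
    genFrameY-trivial (suc i) = TrivialFrame-wk (TrivialFrame-wk (genFrameY-trivial i))

    dataY : ∀ i → Data (size (Y (suc i)))
    dataY i = trivial k (wkFrame (genFrameY i))

    dataY-near : ∀ i → Near ⌊ Y (suc i) ⌋ (dataY i)
    dataY-near i = record { φ≈ = ≈tm-reflexive (φ≡ h) ; ψ≈ = ≈tm-refl _ ; p≈ = ≈tm-reflexive (p≡ h) ; q≈ = ≈tm-refl _ }
      where h = TrivialFrame-wk (genFrameY-trivial i)

    ψ-pruning : ∀ i → Sub (suc (suc (size (V (suc i))))) (size (V (suc i)))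
    ψ-pruning i = ⟨ ⟨ idSub _ , var (suc (q⁺ i)) ⟩ , identity (wkTy (C⁺ i)) (var (suc (q⁺ i))) ⟩

    [id]frame : ∀ {n} (f : Frame n) → f [ idSub n ]frame ≡ f
    [id]frame (frame γ p φ q) = frame-cong (•-id γ) ([id]tm p) ([id]tm φ) ([id]tm q)

    [id]cells : ∀ {n i} (cs : Cells n i) → cs [ idSub n ]cells ≡ cs
    [id]cells [] = refl
    [id]cells (cs ∷⟨ s , t ⟩) = ∷-cong ([id]cells cs) ([id]tm s) ([id]tm t)

    padding-ψ : ∀ i → padding i [ ψ-pruning i ]ty ≡ paddingL i
    padding-ψ i = trans (padTy-[] i (genData i) (genCells³ i) (ψ-pruning i)) (cong₂ (padTy i)
      (data-cong (trans (wkFrame-⟨,⟩ (wkFrame (wkFrame (genFrame i)))) (trans (wkFrame-⟨,⟩ (wkFrame (genFrame i))) ([id]frame _))) refl refl)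
      (trans (wkCells-⟨,⟩ (wkCells (wkCells (genCells i)))) (trans (wkCells-⟨,⟩ (wkCells (genCells i))) ([id]cells _))))

    padding-φ : ∀ i → paddingL i [ π (φ-peak (suc i)) ]ty ≡ padTy i (dataY i) (wkCells (genCellsY i))
    padding-φ i = trans (padTy-[] i (dataL i) (wkCells (genCells i)) (π (φ-peak (suc i)))) (cong₂ (padTy i)
      (trans (cong (_[ π (φ-peak (suc i)) ]data) (dataL≡ k i)) (trans (trivial-[] k (wkFrame (genFrame i)) (π (φ-peak (suc i))))
        (cong (trivial k) (trans (wkFrame-⟨,⟩ (genFrame i)) (trans (wk-[]frame (genFrame i) (π⁺ i)) (cong wkFrame (genFrame-π i)))))))
      (trans (wkCells-⟨,⟩ (genCells i)) (trans (wk-[]cells (genCells i) (π⁺ i)) (cong wkCells (genCells-π i)))))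

    cells-≈ : ∀ {n i} {Γ : Ctx n} {f f′} (cs : Cells n i) → γ f ≡ γ f′ → p f ≡ p f′ → Γ ⊢ φ f ≈tm φ f′ → q f ≡ q f′ →
              Γ ⊢ cells f cs ≈sub cells f′ cs
    cells-≈ [] refl refl e refl = ≈-▸ (≈-▸ (≈sub-refl _) e) (≈tm-refl _)
    cells-≈ (cs ∷⟨ s , t ⟩) a b e c = ≈-▸ (≈-▸ (cells-≈ cs a b e c) (≈tm-refl s)) (≈tm-refl t)

    -- After both prunings the coherence lives over a disc, but its type is still a padding of
    -- generic cells. The induction on `i` identifies this padding with the disc's own type, and
    -- only then does disc removal apply.
    padTm-≈ : ∀ {n} i {Γ : Ctx n} {d t} {cs : Cells n i} → DataTyped k Γ d → CellsTyped Γ (inner (fr d)) cs →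
              Γ ⊢ t ∶ over (inner (fr d)) cs → Near Γ d → Γ ⊢ padTm i d cs t ≈tm t
    padTy-≈ : ∀ {n} i {Γ : Ctx n} {d} {cs : Cells n i} → DataTyped k Γ d → CellsTyped Γ (inner (fr d)) cs →
              Near Γ d → Γ ⊢ padTy i d cs ≈ty over (inner (fr d)) cs
    padTm-≈ i {Γ} {d} {t} {cs} h c t∶ e =
      -- Pruning demands literal identities, so the whiskers are first replaced by the identities
      -- they equal.
      ≈-trans (≈-coh (≈ty-refl (padding i)) (≈-▸ (≈-▸ (≈-▸ (cells-≈ cs refl refl (φ≈ e) refl) (≈tm-refl t)) (≈tm-refl (q′ d))) (ψ≈ e)))
      (≈-trans (prune-last (downs (suc i) (V (suc i))) (package-downs i (V (suc i)) refl (▷-wk (arrow-▷ i)) (dim-wkC⁺ i))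
        (padding-typed k i) (build-typed k h° c t∶) (regular-padding i) (_ , _ , refl))
      (≈-trans (≈tm-reflexive (cong (λ A → Coh ⌊ V (suc i) ⌋ A ⟨ cells f° cs , t ⟩) (padding-ψ i)))
      (≈-trans (prune (φ-peak (suc i)) (paddingL-typed k i) (top-typed k (fr∶ h°) c t∶) (regular-paddingL i)
        (_ , _ , entry-φ f° cs t))
      (≈-trans (≈tm-reflexive (cong₂ (Coh ⌊ Y (suc i) ⌋) (padding-φ i) (prune-cells f° cs t)))
      (≈-trans (≈-coh padY≈ (≈sub-refl _))
      (remove-disc (package-Y (suc i)) (sub-▸ (cellsY-typed (fr∶ h°) (CellsTyped-≈ inner≈ c))
        (retype (sym (arrow-cellsY f° cs)) (tm-conv t∶ (over-≈ cs inner≈))))))))))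
      where
      f = fr d
      -- The identity on `p` has type `p → p`; it is typed as a whisker `p′ → p` by conversion in R,
      -- and likewise on the other side.
      f° = frame (γ f) (p f) (identity (C⁻ f) (p f)) (q f)
      inner≈ : Γ ⊢ inner f ≈ty innerY f
      inner≈ = ≈-⟶ (≈-sym (p≈ e)) (≈ty-refl _) (≈tm-refl _)
      h° : DataTyped k Γ (mkData f° (q′ d) (identity (C⁻ f) (q f)))
      h° = record
        { fr∶ = record { γ∶ = γ∶ (fr∶ h) ; p∶ = p∶ (fr∶ h) ; q∶ = q∶ (fr∶ h)
                       ; φ∶ = tm-conv (identity-typed (C⁻-typed k (fr∶ h)) (p∶ (fr∶ h)))
                                      (≈-⟶ (≈-sym (p≈ e)) (≈ty-refl _) (≈tm-refl _)) }
        ; q′∶ = q′∶ h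
        ; ψ∶ = tm-conv (identity-typed (C⁻-typed k (fr∶ h)) (q∶ (fr∶ h))) (≈-⟶ (≈tm-refl _) (≈ty-refl _) (≈-sym (q≈ e))) }
      padY≈ : ⌊ Y (suc i) ⌋ ⊢ padTy i (dataY i) (wkCells (genCellsY i)) ≈ty dyckTy (Y (suc i))
      padY≈ = ≈ty-trans
        (padTy-≈ i (trivial-typed k (FrameTyped-wk k (genFrameY-typed i))) (CellsTyped-wkFrame k {f = genFrameY i} (genCellsY-typed i)) (dataY-near i))
        (≈ty-reflexive (trans (over-wkFrame k (genFrameY i) (genCellsY i)) (cong wkTy (over-genY i))))
    padTy-≈ zero h [] e = ≈-⟶ (p≈ e) (≈ty-refl _) (q≈ e)
    padTy-≈ (suc i) h (c ∷⟨ s , t ⟩) e = ≈-⟶ (padTm-≈ i h c s e) (padTy-≈ i h c e) (padTm-≈ i h c t e)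

-- Converting types and rehydrating terms

-- Towers grow at the outermost pair, whereas conversion starts with the innermost; this gives
-- access from the bottom.
cons : ∀ {n i} → Tm n → Tm n → Cells n i → Cells n (suc i)
cons p q [] = [] ∷⟨ p , q ⟩
cons p q (cs ∷⟨ s , t ⟩) = cons p q cs ∷⟨ s , t ⟩

uncons : ∀ {n i} (cs : Cells n (suc i)) → ∃[ p ] ∃[ q ] ∃[ cs′ ] cs ≡ cons p q cs′
uncons ([] ∷⟨ p , q ⟩) = p , q , [] , refl
uncons (cs@(_ ∷⟨ _ , _ ⟩) ∷⟨ s , t ⟩) = let p , q , cs′ , e = uncons cs in p , q , cs′ ∷⟨ s , t ⟩ , ∷-cong e refl refl

over-cons : ∀ {n i} A p q (cs : Cells n i) → over A (cons p q cs) ≡ over (p ⟶[ A ] q) cs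
over-cons A p q [] = refl
over-cons A p q (cs ∷⟨ s , t ⟩) = ⟶-cong refl (over-cons A p q cs) refl

module Rehydration {ℓ} (R : RuleSet ℓ) (R-sub : SubstitutionCondition R) (R-supp : SupportCondition R)
         (R-prune : HasPruning R) (R-disc : DiscRemoval R) (R-endo : EndoCoherenceRemoval R) where
  private
    module C = Typing Catt
    module CO = CattOnly
    module CT = CellsTyping {R = Catt} (λ ())
  open Typing R
  open RawTyping {R = R}
  open SubstitutionLemma {R = R} R-sub
  open CellsTyping {R = R} R-sub
  open WhiskerRemoval {R = R} R-sub R-prune R-disc

  infix 4 _⊢_≈cells_

  data _⊢_≈cells_ {n} (Γ : Ctx n) : ∀ {i} → Cells n i → Cells n i → Set ℓ where
    []      : Γ ⊢ [] ≈cells []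
    _∷⟨_,_⟩ : ∀ {i} {cs cs′ : Cells n i} {s s′ t t′} → Γ ⊢ cs ≈cells cs′ → Γ ⊢ s ≈tm s′ → Γ ⊢ t ≈tm t′ →
              Γ ⊢ cs ∷⟨ s , t ⟩ ≈cells cs′ ∷⟨ s′ , t′ ⟩

  ≈cells-trans : ∀ {n i} {Γ : Ctx n} {cs cs′ cs″ : Cells n i} → Γ ⊢ cs ≈cells cs′ → Γ ⊢ cs′ ≈cells cs″ → Γ ⊢ cs ≈cells cs″
  ≈cells-trans [] [] = []
  ≈cells-trans (h ∷⟨ p , q ⟩) (h′ ∷⟨ p′ , q′ ⟩) = ≈cells-trans h h′ ∷⟨ ≈-trans p p′ , ≈-trans q q′ ⟩

  ≈cells-uncons : ∀ {n i} {Γ : Ctx n} {p q p′ q′} (cs cs′ : Cells n i) → Γ ⊢ cons p q cs ≈cells cons p′ q′ cs′ →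
                  Γ ⊢ p ≈tm p′ × Γ ⊢ q ≈tm q′ × Γ ⊢ cs ≈cells cs′
  ≈cells-uncons [] [] ([] ∷⟨ a , b ⟩) = a , b , []
  ≈cells-uncons (cs ∷⟨ _ , _ ⟩) (cs′ ∷⟨ _ , _ ⟩) (h ∷⟨ a , b ⟩) = let x , y , z = ≈cells-uncons cs cs′ h in x , y , z ∷⟨ a , b ⟩

  typed-uncons : ∀ {n i} {Γ : Ctx n} {A p q} (cs : Cells n i) → CT.CellsTyped Γ A (cons p q cs) →
                 Γ C.⊢ p ∶ A × Γ C.⊢ q ∶ A × CT.CellsTyped Γ (p ⟶[ A ] q) cs
  typed-uncons [] (CT.[] CT.∷⟨ s , t ⟩) = s , t , CT.[]
  typed-uncons {A = A} {p} {q} (cs ∷⟨ _ , _ ⟩) (h CT.∷⟨ s , t ⟩) = let x , y , z = typed-uncons cs h in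
    x , y , z CT.∷⟨ CO.retype (over-cons A p q cs) s , CO.retype (over-cons A p q cs) t ⟩

  cells-of-typed : ∀ {n i} {Γ : Ctx n} {A} (cs : Cells n i) → Γ C.⊢ty over A cs → CT.CellsTyped Γ A cs
  cells-of-typed [] h = CT.[]
  cells-of-typed (cs ∷⟨ s , t ⟩) (C.ty-⟶ h s∶ t∶) = cells-of-typed cs h CT.∷⟨ s∶ , t∶ ⟩

  cells-of : ∀ {n} {Γ : Ctx n} {A B} → Γ ⊢ A ≈ty B →
             ∃[ i ] Σ[ cs ∈ Cells n i ] Σ[ cs′ ∈ Cells n i ] (over ⋆ cs ≡ A × over ⋆ cs′ ≡ B × Γ ⊢ cs ≈cells cs′)
  cells-of ≈-⋆ = 0 , [] , [] , refl , refl , []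
  cells-of (≈-⟶ p q r) = let i , cs , cs′ , e , e′ , h = cells-of q in
    suc i , cs ∷⟨ _ , _ ⟩ , cs′ ∷⟨ _ , _ ⟩ , ⟶-cong refl e refl , ⟶-cong refl e′ refl , h ∷⟨ p , r ⟩

  module _ (k : ℕ) where
    open Whisker k

    -- The levels of `padTy` above its bottom pair, which are those that conversion still has to
    -- align.
    padCells : ∀ {n} i → Data n → Cells n i → Cells n i
    padCells zero d [] = []
    padCells (suc i) d (cs ∷⟨ s , t ⟩) = padCells i d cs ∷⟨ padTm i d cs s , padTm i d cs t ⟩

    over-padCells : ∀ {n} i d (cs : Cells n i) → over (outer d) (padCells i d cs) ≡ padTy i d cs
    over-padCells zero d [] = refl
    over-padCells (suc i) d (cs ∷⟨ s , t ⟩) = ⟶-cong refl (over-padCells i d cs) refl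

    embed-cells : ∀ {n i} {Γ : Ctx n} {A} {cs : Cells n i} → CT.CellsTyped Γ A cs → CellsTyped Γ A cs
    embed-cells CT.[] = []
    embed-cells (h CT.∷⟨ s , t ⟩) = embed-cells h ∷⟨ embed-tm R s , embed-tm R t ⟩

    embed-data : ∀ {n} {Γ : Ctx n} {d} → CT.DataTyped k Γ d → DataTyped k Γ d
    embed-data h = record
      { fr∶ = record { γ∶ = embed-sub R (CT.γ∶ (CT.fr∶ h)) ; p∶ = embed-tm R (CT.p∶ (CT.fr∶ h))
                     ; φ∶ = embed-tm R (CT.φ∶ (CT.fr∶ h)) ; q∶ = embed-tm R (CT.q∶ (CT.fr∶ h)) }
      ; q′∶ = embed-tm R (CT.q′∶ h) ; ψ∶ = embed-tm R (CT.ψ∶ h) }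

    padCells-≈ : ∀ {n} i {Γ : Ctx n} {d} {cs : Cells n i} → DataTyped k Γ d → CellsTyped Γ (inner (fr d)) cs →
                 Near k Γ d → Γ ⊢ padCells i d cs ≈cells cs
    padCells-≈ zero h [] e = []
    padCells-≈ (suc i) h (c ∷⟨ s , t ⟩) e = padCells-≈ i h c e ∷⟨ padTm-≈ k i h c s e , padTm-≈ k i h c t e ⟩

  disc-into : ∀ {n} {Δ : Ctx n} {A t} → Δ C.⊢ty A → Δ C.⊢ t ∶ A → let W = mountain (dim A) in
              ∃[ γ ] (dyckTy W [ γ ]ty ≡ A × dyckTm W [ γ ]tm ≡ t × Δ C.⊢sub γ ∶ ⌊ W ⌋)
  disc-into {Δ = Δ} {A} {t} a t∶ = WhiskerPs.via-disc (dim A)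
    (λ (m , Γ , T , s) → Σ[ γ ∈ Sub m _ ] (T [ γ ]ty ≡ A × s [ γ ]tm ≡ t × Δ C.⊢sub γ ∶ Γ))
    (discSub A t , U-discSub A t , refl , discSub-typed a t∶)

  -- The levels of the two types are made to agree from the bottom up, by whiskering
  -- with the coherences between the lowest cells that differ.
  convert-cells : ∀ {n} i {Δ : Ctx n} → PsContext Δ → ∀ {A} {cs cs′ : Cells n i} {t} → Δ C.⊢ty A →
                  CT.CellsTyped Δ A cs → CT.CellsTyped Δ A cs′ → Δ ⊢ cs ≈cells cs′ → Δ C.⊢ t ∶ over A cs →
                  ∃[ t′ ] (Δ C.⊢ t′ ∶ over A cs′ × Δ ⊢ t′ ≈tm t)
  convert-cells zero ps a CT.[] CT.[] [] t∶ = _ , t∶ , ≈tm-refl _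
  convert-cells {n} (suc i) {Δ} ps {A} {cs} {cs′} {t} a c c′ e t∶ with uncons cs | uncons cs′
  ... | p , q , ds , refl | p′ , q′ , ds′ , refl =
    -- Whiskering makes the bottom level literally `p′ → q′`; the padded upper levels still agree
    -- with `ds′` in R, so `i` levels remain over the enlarged base.
    let t″ , t″∶ , t″≈ = convert-cells i ps (C.ty-⟶ a p′-ty q′-ty) typed ds′∶ (≈cells-trans (padCells-≈ k i (embed-data k d∶) (embed-cells k ds⁻∶) near) ds≈)
                           (CO.retype over≡ (CT.padTm-typed k i d∶ ds⁻∶ t⁻∶))
    in t″ , CO.retype (sym (over-cons A p′ q′ ds′)) t″∶ ,
       ≈-trans t″≈ (padTm-≈ k i (embed-data k d∶) (embed-cells k ds⁻∶) (embed-tm R t⁻∶) near)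
    where
    k = dim A
    open Whisker k using (Data; mkData; frame; fr; inner; outer; padTy)
    p-eq : Δ ⊢ p ≈tm p′
    p-eq = proj₁ (≈cells-uncons ds ds′ e)
    q-eq : Δ ⊢ q ≈tm q′
    q-eq = proj₁ (proj₂ (≈cells-uncons ds ds′ e))
    ds≈ = proj₂ (proj₂ (≈cells-uncons ds ds′ e))
    p-ty = proj₁ (typed-uncons ds c)
    q-ty = proj₁ (proj₂ (typed-uncons ds c))
    ds∶ = proj₂ (proj₂ (typed-uncons ds c))
    p′-ty = proj₁ (typed-uncons ds′ c′)
    q′-ty = proj₁ (proj₂ (typed-uncons ds′ c′))
    ds′∶ = proj₂ (proj₂ (typed-uncons ds′ c′))
    φ-coh = connecting-coherence R-sub R-supp R-endo ps p′-ty p-ty (≈-sym p-eq)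
    ψ-coh = connecting-coherence R-sub R-supp R-endo ps q-ty q′-ty q-eq
    base-disc = disc-into a p′-ty
    γ′ = proj₁ base-disc
    A≡ = proj₁ (proj₂ base-disc)
    p′≡ = proj₁ (proj₂ (proj₂ base-disc))
    d : Data n
    d = mkData (frame γ′ p (proj₁ φ-coh) q) q′ (proj₁ ψ-coh)
    inner≡ : inner (fr d) ≡ p ⟶[ A ] q
    inner≡ = ⟶-cong refl A≡ refl
    outer≡ : outer d ≡ p′ ⟶[ A ] q′
    outer≡ = ⟶-cong p′≡ A≡ refl
    d∶ : CT.DataTyped k Δ d
    d∶ = record
      { fr∶ = record { γ∶ = proj₂ (proj₂ (proj₂ base-disc)) ; p∶ = CO.retype (sym A≡) p-ty
                     ; φ∶ = CO.retype (sym (⟶-cong p′≡ A≡ refl)) (proj₁ (proj₂ φ-coh)) ; q∶ = CO.retype (sym A≡) q-ty }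
      ; q′∶ = CO.retype (sym A≡) q′-ty ; ψ∶ = CO.retype (sym (⟶-cong refl A≡ refl)) (proj₁ (proj₂ ψ-coh)) }
    near : Near k Δ d
    near = record
      { φ≈ = subst (λ B → Δ ⊢ proj₁ φ-coh ≈tm identity B p) (sym A≡) (proj₂ (proj₂ φ-coh))
      ; ψ≈ = subst (λ B → Δ ⊢ proj₁ ψ-coh ≈tm identity B q) (sym A≡)
               -- The connecting coherence is equal to the identity on its target `q′`, whereas
               -- `Near` asks for the identity on `q`.
               (≈-trans (proj₂ (proj₂ ψ-coh)) (≈-coh (≈ty-refl _) (≈-▸ (≈sub-refl _) (≈-sym q-eq))))
      ; p≈ = ≈-trans (≈tm-reflexive p′≡) (≈-sym p-eq)
      ; q≈ = ≈-sym q-eq }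
    ds⁻∶ : CT.CellsTyped Δ (inner (fr d)) ds
    ds⁻∶ = subst (λ B → CT.CellsTyped Δ B ds) (sym inner≡) ds∶
    t⁻∶ : Δ C.⊢ t ∶ over (inner (fr d)) ds
    t⁻∶ = CO.retype (trans (over-cons A p q ds) (cong (λ B → over B ds) (sym inner≡))) t∶
    over≡ : padTy i d ds ≡ over (p′ ⟶[ A ] q′) (padCells k i d ds)
    over≡ = trans (sym (over-padCells k i d ds)) (cong (λ B → over B (padCells k i d ds)) outer≡)
    typed : CT.CellsTyped Δ (p′ ⟶[ A ] q′) (padCells k i d ds)
    typed = cells-of-typed (padCells k i d ds) (subst (Δ C.⊢ty_) over≡ (CT.padTy-typed k i d∶ ds⁻∶))

  convert : ∀ {n} {Δ : Ctx n} {t A B} → PsContext Δ → Δ C.⊢ t ∶ A → Δ C.⊢ty B → Δ ⊢ A ≈ty B →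
            ∃[ t′ ] (Δ C.⊢ t′ ∶ B × Δ ⊢ t′ ≈tm t)
  convert ps t∶ b e with cells-of e
  ... | i , cs , cs′ , refl , refl , h = convert-cells i ps C.ty-⋆
    (cells-of-typed cs (type-typed (ps-ctx (proj₂ ps)) t∶)) (cells-of-typed cs′ b) h t∶

  -- The recursion enters the types inside coherences because their contexts are again ps-contexts.
  -- A term comes back with a type prescribed only up to R; the enclosing arrow or substitution
  -- supplies the exact Catt type to which it is converted.
  rehydrate-ty  : ∀ {n} {Δ : Ctx n} {A} → PsContext Δ → Δ ⊢ty A → ∃[ A′ ] (Δ C.⊢ty A′ × Δ ⊢ A ≈ty A′)
  rehydrate-tm  : ∀ {n} {Δ : Ctx n} {t A} → PsContext Δ → Δ ⊢ t ∶ A →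
                  ∃[ t′ ] ∃[ A′ ] (Δ C.⊢ t′ ∶ A′ × Δ ⊢ A ≈ty A′ × Δ ⊢ t ≈tm t′)
  rehydrate-sub : ∀ {m n} {Δ : Ctx n} {Θ : Ctx m} {σ} → PsContext Δ → Θ C.⊢ctx → Δ ⊢sub σ ∶ Θ →
                  ∃[ σ′ ] (Δ C.⊢sub σ′ ∶ Θ × Δ ⊢ σ ≈sub σ′)
  rehydrate-ty ps ty-⋆ = ⋆ , C.ty-⋆ , ≈-⋆
  rehydrate-ty ps (ty-⟶ a s t) =
    let A′ , a′ , eA = rehydrate-ty ps a
        s₁ , S , s₁∶ , eS , es = rehydrate-tm ps s
        t₁ , T , t₁∶ , eT , et = rehydrate-tm ps t
        s₂ , s₂∶ , es₂ = convert ps s₁∶ a′ (≈ty-trans (≈ty-sym eS) eA)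
        t₂ , t₂∶ , et₂ = convert ps t₁∶ a′ (≈ty-trans (≈ty-sym eT) eA)
    in s₂ ⟶[ A′ ] t₂ , C.ty-⟶ a′ s₂∶ t₂∶ , ≈-⟶ (≈-trans es (≈-sym es₂)) eA (≈-trans et (≈-sym et₂))
  rehydrate-tm ps (tm-var x) = var x , _ , C.tm-var x , ≈ty-refl _ , ≈-var x
  rehydrate-tm ps (tm-conv t e) =
    let t′ , A′ , t′∶ , eA , et = rehydrate-tm ps t in t′ , A′ , t′∶ , ≈ty-trans (≈ty-sym e) eA , et
  rehydrate-tm ps (tm-coh {Δ = Θ} {s = s} {A} {t} psΘ a σ reg) with rehydrate-ty psΘ a | rehydrate-sub ps (ps-ctx (proj₂ psΘ)) σ
  ... | s′ ⟶[ A′ ] t′ , a′ , ≈-⟶ es eA et | σ′ , σ′∶ , eσ =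
    Coh Θ (s′ ⟶[ A′ ] t′) σ′ , _ ,
    -- The operation set sees only supports, which equality in R preserves.
    C.tm-coh psΘ a′ σ′∶ (subst₂ (Regular Θ) (≈tm-supp R-supp es) (≈tm-supp R-supp et) reg) ,
    ≈ty-trans (≈ty-[] (≈-⟶ es eA et) σ) ([]-congʳ-ty (s′ ⟶[ A′ ] t′) eσ) ,
    ≈-coh (≈-⟶ es eA et) eσ
  rehydrate-sub ps c sub-⟨⟩ = ⟨⟩ , C.sub-⟨⟩ , ≈-⟨⟩
  rehydrate-sub ps (C.ctx-▸ c a) (sub-▸ {A = A} σ t) =
    let σ′ , σ′∶ , eσ = rehydrate-sub ps c σ
        t₁ , T , t₁∶ , eT , et = rehydrate-tm ps t
        -- The required type has moved from `A [ σ ]ty` to `A [ σ′ ]ty`, since the earlier entries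
        -- were replaced.
        t₂ , t₂∶ , et₂ = convert ps t₁∶ (CO.ty-[] a σ′∶) (≈ty-trans (≈ty-sym eT) ([]-congʳ-ty A eσ))
    in ⟨ σ′ , t₂ ⟩ , C.sub-▸ σ′∶ t₂∶ , ≈-▸ eσ (≈-trans et (≈-sym et₂))

theorem4p5p3 : ∀ {ℓ} (R : RuleSet ℓ) → Tame R → SupportCondition R →
    HasPruning R → DiscRemoval R → EndoCoherenceRemoval R →
    ∀ {n : ℕ} (Δ : Ctx n) → PsContext Δ → (t : Tm n) → Typing.WellFormed R Δ t →
    ∃[ s ] (Typing.WellFormed Catt Δ s × Typing._⊢_≈tm_ R Δ s t)
theorem4p5p3 R tame R-supp R-prune R-disc R-endo Δ ps t (A , t∶) =
  let s , B , s∶ , _ , e = rehydrate-tm ps t∶ in s , (B , s∶) , Typing.≈-sym e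
  where open Rehydration R (Tame.substitution tame) R-supp R-prune R-disc R-endo
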